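{- Let $n,s$ be positive integers and $r,j$ non-negative integers with $r+s\equiv 1\pmod{2}$ and $j\leqslant s$. Then \begin{align*} &\sum_{k=0}^{n}q^{j(k^2+k)-rk}[2k+1]^r A_{n,k}(q)^s\equiv 0 \mod{ {2n\brack n} },\\ &\sum_{k=0}^{n}(-1)^k q^{{k\choose 2}+j(k^2+k)-(r-1)k}[2k+1]^r A_{n,k}(q)^s \equiv 0 \mod{ {2n\brack n}}. \end{align*}
   Context: For a non-negative integer $n$, $[n]=1+q+\cdots+q^{n-1}$. The $q$-binomial coefficient is ${n\brack k}=\prod_{i=1}^k\frac{1-q^{n-i+1}}{1-q^i}$ if $k\geqslant 0$ and ${n\brack k}=0$ if $k<0$. The $q$-ballot numbers are, for $0\leqslant k\leqslant n$, $A_{n,k}(q)=q^{n-k}\frac{[2k+1]}{[2n+1]}{2n+1\brack n-k}={2n\brack n-k}-{2n\brack n-k-1}$. For a polynomial $D$ in $q$ and Laurent polynomials $A,B$ in $q$, $A\equiv B \bmod D$ means that $(A-B)/D$ is a Laurent polynomial in $q$. -}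

module Defs where

open import Data.Nat as ℕ using (ℕ; zero; suc; _∸_)
open import Data.Nat.Combinatorics using (_C_)
open import Data.Integer as ℤ using (ℤ; +_; -[1+_])
open import Data.List using (List; []; _∷_; replicate; _++_; length; foldr; map; upTo)
open import Data.Product using (Σ; _×_; _,_)
open import Relation.Binary.PropositionalEquality using (_≡_)

-- Polynomials in q with integer coefficients, as coefficient lists
-- (lowest degree first). Trailing zeros are allowed; equality is
-- coefficientwise.

Poly : Set
Poly = List ℤ

coeff : Poly → ℕ → ℤ
coeff []       _       = + 0
coeff (a ∷ p)  zero    = a
coeff (a ∷ p)  (suc i) = coeff p i

infix 4 _≈P_
_≈P_ : Poly → Poly → Set
p ≈P p' = ∀ i → coeff p i ≡ coeff p' i

infixl 6 _+P_ _-P_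
infixl 7 _*P_

_+P_ : Poly → Poly → Poly
[]      +P p'       = p'
(a ∷ p) +P []       = a ∷ p
(a ∷ p) +P (b ∷ p') = (a ℤ.+ b) ∷ (p +P p')

scaleP : ℤ → Poly → Poly
scaleP c = map (c ℤ.*_)

negP : Poly → Poly
negP = scaleP (ℤ.- (+ 1))

_-P_ : Poly → Poly → Poly
p -P p' = p +P negP p'

_*P_ : Poly → Poly → Poly
[]      *P p' = []
(a ∷ p) *P p' = scaleP a p' +P (+ 0 ∷ (p *P p'))

oneP : Poly
oneP = + 1 ∷ []

shiftP : ℕ → Poly → Poly
shiftP k p = replicate k (+ 0) ++ p

_^P_ : Poly → ℕ → Poly
p ^P zero  = oneP
p ^P suc r = p *P (p ^P r)

prodP : List Poly → Poly
prodP = foldr _*P_ oneP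

qint : ℕ → Poly
qint n = replicate n (+ 1)

oneMinusQ : ℕ → Poly
oneMinusQ m = oneP -P shiftP m oneP

-- Power-series division: divS f a d gives the first f coefficients of
-- the formal power series a / d (meaningful when d has constant term 1).
-- When d divides a, the quotient polynomial has degree < length a, so
-- divS (length a) a d is exactly the polynomial a / d.

headP : Poly → ℤ
headP []      = + 0
headP (a ∷ _) = a

tailP : Poly → Poly
tailP []      = []
tailP (_ ∷ p) = p

divS : ℕ → Poly → Poly → Poly
divS zero    a d = []
divS (suc f) a d = headP a ∷ divS f (tailP (a -P scaleP (headP a) d)) d

divP : Poly → Poly → Poly
divP a d = divS (length a) a d

-- q-binomial coefficient for k ≥ 0, via the product formula
--   [n k] = ∏_{i=1}^k (1 - q^{n-i+1}) / ∏_{i=1}^k (1 - q^i).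
-- (For i ≤ k, n - i + 1 is computed as (suc n ∸ i); if k > n the
-- factor with i = n+1 is 1 - q^0 = 0, so the value is 0, as it should be.)

qbinomℕ : ℕ → ℕ → Poly
qbinomℕ n k = divP (prodP (map (λ i → oneMinusQ (suc n ∸ suc i)) (upTo k)))
                   (prodP (map (λ i → oneMinusQ (suc i)) (upTo k)))

qbinom : ℕ → ℤ → Poly
qbinom n (+ k)     = qbinomℕ n k
qbinom n -[1+ _ ]  = []

ballot : ℕ → ℕ → Poly
ballot n k = qbinom (2 ℕ.* n) (+ n ℤ.- + k) -P qbinom (2 ℕ.* n) (+ n ℤ.- + k ℤ.- + 1)

-- Laurent polynomials: (e , p) represents q^(-e) * p.

Laurent : Set
Laurent = ℕ × Poly

infix 4 _≈L_
_≈L_ : Laurent → Laurent → Set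
(e₁ , p₁) ≈L (e₂ , p₂) = shiftP e₂ p₁ ≈P shiftP e₁ p₂

poly : Poly → Laurent
poly p = (0 , p)

infixl 6 _+L_ _-L_
infixl 7 _*L_

_+L_ : Laurent → Laurent → Laurent
(e₁ , p₁) +L (e₂ , p₂) = (e₁ ℕ.+ e₂ , shiftP e₂ p₁ +P shiftP e₁ p₂)

_*L_ : Laurent → Laurent → Laurent
(e₁ , p₁) *L (e₂ , p₂) = (e₁ ℕ.+ e₂ , p₁ *P p₂)

negL : Laurent → Laurent
negL (e , p) = (e , negP p)

_-L_ : Laurent → Laurent → Laurent
x -L y = x +L negL y

zeroL : Laurent
zeroL = (0 , [])

qpow : ℤ → Laurent
qpow (+ m)     = (0 , shiftP m oneP)
qpow -[1+ m ]  = (suc m , oneP)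

signL : ℕ → Laurent
signL zero    = poly oneP
signL (suc k) = negL (signL k)

sumL : ℕ → (ℕ → Laurent) → Laurent
sumL n f = foldr _+L_ zeroL (map f (upTo (suc n)))

_≡_[modP_] : Laurent → Laurent → Poly → Set
A ≡ B [modP D ] = Σ Laurent (λ C → (A -L B) ≈L (C *L poly D))

-- Write [m] for q-integers, w l k = 1/([l-k]! [l+k+1]!) and v k = q^(-k) [2k+1],
-- so that A_{n,k} = q^n v k [2n]! w n k, and put moment m f = Σ_k v k · w m k · f k.
-- Call f admissible (for a fixed n) if [n]! [m]!/[n-m]! · moment m f is a Laurent
-- polynomial for all m ≤ n; at m = n this gives [2n]! moment n f ∈ (2n choose n) ℤ[q,1/q].
-- By telescoping, 1 and (-1)^k q^(k(k+1)/2) are admissible.  Admissibility is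
-- preserved by u k = q^(-k) [k] [k+1], since (u l - u k) · w l k = q^(-l) w (l-1) k,
-- hence by v k · v k, a polynomial in u k; and by q^(k²+k), by a Bailey-type
-- expansion of q^(k²+k) w m k in the w l k.
-- The q-Chu–Vandermonde expansion of w n k · w m k in the w l k shows that
-- [2n+1]! w n and [2n]! w (n-1) preserve admissibility, and so does the product
-- [2n]! w n · [2n]! w (n-1).  Writing v k · v k = v n · v n - (u n - u k) · (polynomial
-- in u k) gets rid of the extra factor [2n+1]: v² times one or two factors [2n]! w n
-- preserves admissibility.  As r + s is odd, the summand v^(r+s) ([2n]! w n)^s
-- consists of v · [2n]! w n and such blocks.

module Submission where

open import Defs
open import Level using (0ℓ)
open import Algebra.Bundles using (CommutativeRing)
open import Algebra.Structures using (IsCommutativeRing)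
open import Algebra.Solver.Ring.AlmostCommutativeRing using (fromCommutativeRing; _-Raw-AlmostCommutative⟶_)
import Algebra.Consequences.Setoid
import Algebra.Definitions
import Algebra.Properties.CommutativeSemiring.Exp
import Algebra.Properties.Ring
import Algebra.Properties.Semiring.Exp
import Algebra.Properties.Semiring.Mult.TCOptimised
import Algebra.Solver.Ring
open import Data.Integer as ℤ using (ℤ; +_; -[1+_])
import Data.Integer.Properties as ℤₚ
import Data.Integer.Solver
open import Data.List using ([]; _∷_; applyUpTo; foldr; length)
import Data.List.Properties as Listₚ
open import Data.Maybe using (Maybe; just; nothing)
open import Data.Nat as ℕ using (ℕ; zero; suc; z≤n; s≤s; _∸_)
open import Data.Nat.Combinatorics using (_C_; nC1≡n; nCk+nC[k+1]≡[n+1]C[k+1])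
import Data.Nat.DivMod as DivMod
import Data.Nat.Properties as ℕₚ
open import Data.Product using (Σ; _,_; proj₂; _×_)
open import Data.Sum using (inj₁; inj₂)
open import Function using (id; _∘_)
open import Relation.Binary.Bundles using (Setoid)
open import Relation.Binary.Core using (Rel)
open import Relation.Binary.Definitions using (tri<; tri≈; tri>)
open import Relation.Binary.PropositionalEquality as ≡ using (_≡_)
import Relation.Binary.Reasoning.Setoid
open import Relation.Binary.Structures using (IsEquivalence)
open import Relation.Nullary using (contradiction; yes; no)

-- The weight W m = [n]! [m]! / [n-m]! in the notion of admissibility is dictated by two
-- requirements. It has to turn the moment of 1, which is q^(-m) / [m]!^2, into a Laurent
-- polynomial: the result is a q-binomial coefficient. And if multiplication by some function of k
-- expands w m k in the w l k with coefficients c m l, admissibility survives as soon as W m · c m l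
-- / W l is a Laurent polynomial; since W m / W l contains [m]! / [l]!, a denominator [m-l]! of c m
-- l is absorbed by the q-binomial coefficient of m over l. The obstacle is that [2n+1] is not a
-- unit among Laurent polynomials: q-Chu-Vandermonde asks for [2n+1]! per factor w n, while a ballot
-- number brings only [2n]!. The square of v n contains [2n+1] twice, so one v² can pay for two
-- ballot factors, and there are enough squares because s - 1 ≤ r + s - 1. All of this happens in a
-- ring of fractions of ℤ[q], where q-factorials are invertible and being a Laurent polynomial is a
-- predicate on elements.

-- A ring solver with integer coefficients

module IntegerCoefficients (R : CommutativeRing 0ℓ 0ℓ) where
  open CommutativeRing R
  open Algebra.Properties.Ring ring
  open Algebra.Properties.Semiring.Mult.TCOptimised semiring renaming (_×_ to _×′_)
  open Relation.Binary.Reasoning.Setoid setoid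

  -- With the optimised multiple the images of 0 and 1 reduce to `0#` and `1#`, so that the
  -- constants of the solver match the goals definitionally.
  ⟦_⟧ℤ : ℤ → Carrier
  ⟦ + n ⟧ℤ      = n ×′ 1#
  ⟦ -[1+ n ] ⟧ℤ = - (suc n ×′ 1#)

  private
    cancel-one : ∀ a b → a - b ≈ (1# + a) - (1# + b)
    cancel-one a b = begin
      a - b                     ≈⟨ +-identityˡ _ ⟨
      0# + (a - b)              ≈⟨ +-congʳ (-‿inverseʳ 1#) ⟨
      (1# - 1#) + (a - b)       ≈⟨ +-assoc _ _ _ ⟩
      1# + (- 1# + (a - b))     ≈⟨ +-congˡ (+-congˡ (+-comm _ _)) ⟩
      1# + (- 1# + (- b + a))   ≈⟨ +-congˡ (+-assoc _ _ _) ⟨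
      1# + ((- 1# - b) + a)     ≈⟨ +-congˡ (+-congʳ (-‿+-comm 1# b)) ⟩
      1# + (- (1# + b) + a)     ≈⟨ +-congˡ (+-comm _ _) ⟩
      1# + (a - (1# + b))       ≈⟨ +-assoc _ _ _ ⟨
      (1# + a) - (1# + b)       ∎

    suc-× : ∀ n → suc n ×′ 1# ≈ 1# + n ×′ 1#
    suc-× n = ×-homo-+ 1# 1 n

    ⊖-homo : ∀ m n → ⟦ m ℤ.⊖ n ⟧ℤ ≈ m ×′ 1# - n ×′ 1#
    ⊖-homo zero    zero    = sym (-‿inverseʳ 0#)
    ⊖-homo zero    (suc n) = sym (+-identityˡ _)
    ⊖-homo (suc m) zero    = sym (trans (+-congˡ -0#≈0#) (+-identityʳ _))
    ⊖-homo (suc m) (suc n) = begin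
      ⟦ suc m ℤ.⊖ suc n ⟧ℤ                ≡⟨ ≡.cong ⟦_⟧ℤ (ℤₚ.[1+m]⊖[1+n]≡m⊖n m n) ⟩
      ⟦ m ℤ.⊖ n ⟧ℤ                        ≈⟨ ⊖-homo m n ⟩
      m ×′ 1# - n ×′ 1#                   ≈⟨ cancel-one _ _ ⟩
      (1# + m ×′ 1#) - (1# + n ×′ 1#)     ≈⟨ +-cong (suc-× m) (-‿cong (suc-× n)) ⟨
      suc m ×′ 1# - suc n ×′ 1#           ∎

    +-homo : ∀ x y → ⟦ x ℤ.+ y ⟧ℤ ≈ ⟦ x ⟧ℤ + ⟦ y ⟧ℤ
    +-homo (+ m)    (+ n)    = ×-homo-+ 1# m n
    +-homo (+ m)    -[1+ n ] = ⊖-homo m (suc n)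
    +-homo -[1+ m ] (+ n)    = trans (⊖-homo n (suc m)) (+-comm _ _)
    +-homo -[1+ m ] -[1+ n ] = begin
      - (suc (suc (m ℕ.+ n)) ×′ 1#)        ≡⟨ ≡.cong (λ t → - (suc t ×′ 1#)) (ℕₚ.+-suc m n) ⟨
      - ((suc m ℕ.+ suc n) ×′ 1#)          ≈⟨ -‿cong (×-homo-+ 1# (suc m) (suc n)) ⟩
      - (suc m ×′ 1# + suc n ×′ 1#)         ≈⟨ -‿+-comm _ _ ⟨
      - (suc m ×′ 1#) - suc n ×′ 1#         ∎

    neg-homo : ∀ x → ⟦ ℤ.- x ⟧ℤ ≈ - ⟦ x ⟧ℤ
    neg-homo (+ zero)  = sym -0#≈0#
    neg-homo (+ suc n) = refl
    neg-homo -[1+ n ]  = sym (-‿involutive _)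

    pos-*-homo : ∀ m y → ⟦ + m ℤ.* y ⟧ℤ ≈ m ×′ 1# * ⟦ y ⟧ℤ
    pos-*-homo m (+ n)    = trans (reflexive (≡.cong ⟦_⟧ℤ (≡.sym (ℤₚ.pos-* m n)))) (×1-homo-* m n)
    pos-*-homo m -[1+ n ] = begin
      ⟦ + m ℤ.* -[1+ n ] ⟧ℤ         ≡⟨ ≡.cong ⟦_⟧ℤ (ℤₚ.neg-distribʳ-* (+ m) (+ suc n)) ⟨
      ⟦ ℤ.- (+ m ℤ.* + suc n) ⟧ℤ    ≈⟨ neg-homo (+ m ℤ.* + suc n) ⟩
      - ⟦ + m ℤ.* + suc n ⟧ℤ        ≈⟨ -‿cong (pos-*-homo m (+ suc n)) ⟩
      - (m ×′ 1# * suc n ×′ 1#)       ≈⟨ -‿distribʳ-* _ _ ⟩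
      m ×′ 1# * - (suc n ×′ 1#)       ∎

    *-homo : ∀ x y → ⟦ x ℤ.* y ⟧ℤ ≈ ⟦ x ⟧ℤ * ⟦ y ⟧ℤ
    *-homo (+ m)    y = pos-*-homo m y
    *-homo -[1+ m ] y = begin
      ⟦ -[1+ m ] ℤ.* y ⟧ℤ           ≡⟨ ≡.cong ⟦_⟧ℤ (ℤₚ.neg-distribˡ-* (+ suc m) y) ⟨
      ⟦ ℤ.- (+ suc m ℤ.* y) ⟧ℤ      ≈⟨ neg-homo (+ suc m ℤ.* y) ⟩
      - ⟦ + suc m ℤ.* y ⟧ℤ          ≈⟨ -‿cong (pos-*-homo (suc m) y) ⟩
      - (suc m ×′ 1# * ⟦ y ⟧ℤ)       ≈⟨ -‿distribˡ-* _ _ ⟩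
      - (suc m ×′ 1#) * ⟦ y ⟧ℤ       ∎

    -- ℤ serves as coefficient ring because the solver must recognise cancelling coefficients, and
    -- equality in `R` need not be decidable.
    homomorphism : ℤ.+-*-rawRing -Raw-AlmostCommutative⟶ fromCommutativeRing R
    homomorphism = record
      { ⟦_⟧    = ⟦_⟧ℤ
      ; +-homo = +-homo
      ; *-homo = *-homo
      ; -‿homo = neg-homo
      ; 0-homo = refl
      ; 1-homo = refl
      }

    ℤ-≟ : ∀ x y → Maybe (⟦ x ⟧ℤ ≈ ⟦ y ⟧ℤ)
    ℤ-≟ x y with x ℤ.≟ y
    ... | yes ≡.refl = just refl
    ... | no _       = nothing

  open Algebra.Solver.Ring ℤ.+-*-rawRing (fromCommutativeRing R) homomorphism ℤ-≟ public
    using (solve; _:=_; _:+_; _:*_; _:-_; :-_; con)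

-- q-calculus over an abstract ring

module FiniteSums (R : CommutativeRing 0ℓ 0ℓ) where
  open CommutativeRing R
  open IntegerCoefficients R
  open Relation.Binary.Reasoning.Setoid setoid

  ∑ : ℕ → (ℕ → Carrier) → Carrier
  ∑ zero    f = 0#
  ∑ (suc n) f = ∑ n f + f n

  ∑-cong-< : ∀ n {f g : ℕ → Carrier} → (∀ k → k ℕ.< n → f k ≈ g k) → ∑ n f ≈ ∑ n g
  ∑-cong-< zero    e = refl
  ∑-cong-< (suc n) e = +-cong (∑-cong-< n λ k k<n → e k (ℕₚ.m<n⇒m<1+n k<n)) (e n ℕₚ.≤-refl)

  ∑-cong : ∀ n {f g : ℕ → Carrier} → (∀ k → f k ≈ g k) → ∑ n f ≈ ∑ n g
  ∑-cong n e = ∑-cong-< n λ k _ → e k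

  ∑-zero : ∀ n {f : ℕ → Carrier} → (∀ k → k ℕ.< n → f k ≈ 0#) → ∑ n f ≈ 0#
  ∑-zero zero    e = refl
  ∑-zero (suc n) e = trans (+-cong (∑-zero n λ k k<n → e k (ℕₚ.m<n⇒m<1+n k<n)) (e n ℕₚ.≤-refl)) (+-identityʳ _)

  ∑-+ : ∀ n {f g : ℕ → Carrier} → ∑ n (λ k → f k + g k) ≈ ∑ n f + ∑ n g
  ∑-+ zero            = sym (+-identityʳ _)
  ∑-+ (suc n) {f} {g} = begin
    ∑ n (λ k → f k + g k) + (f n + g n)  ≈⟨ +-congʳ (∑-+ n {f} {g}) ⟩
    (∑ n f + ∑ n g) + (f n + g n)
        ≈⟨ solve 4 (λ a b c d →
          (a :+ b) :+ (c :+ d)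
          := (a :+ c) :+ (b :+ d))
        refl (∑ n f) (∑ n g) (f n) (g n) ⟩
    (∑ n f + f n) + (∑ n g + g n)        ∎

  *-∑ : ∀ n {a} {f : ℕ → Carrier} → a * ∑ n f ≈ ∑ n (λ k → a * f k)
  *-∑ zero            = zeroʳ _
  *-∑ (suc n) {a} {f} = trans (distribˡ a (∑ n f) (f n)) (+-congʳ (*-∑ n))

  ∑-* : ∀ n {a} {f : ℕ → Carrier} → ∑ n f * a ≈ ∑ n (λ k → f k * a)
  ∑-* n {a} {f} = trans (*-comm (∑ n f) a) (trans (*-∑ n) (∑-cong n λ k → *-comm a (f k)))

  ∑-swap : ∀ m n {f : ℕ → ℕ → Carrier} →
           ∑ m (λ i → ∑ n (λ j → f i j)) ≈ ∑ n (λ j → ∑ m (λ i → f i j))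
  ∑-swap zero    n     = sym (∑-zero n λ _ _ → refl)
  ∑-swap (suc m) n {f} = trans (+-congʳ (∑-swap m n)) (sym (∑-+ n {λ j → ∑ m (λ i → f i j)}))

  ∑-head : ∀ n {f : ℕ → Carrier} → ∑ (suc n) f ≈ f 0 + ∑ n (λ k → f (suc k))
  ∑-head zero    {f} = trans (+-identityˡ (f 0)) (sym (+-identityʳ (f 0)))
  ∑-head (suc n) {f} = trans (+-congʳ (∑-head n {f})) (+-assoc _ _ _)

  ∑-telescope : ∀ n {f : ℕ → Carrier} → ∑ n (λ k → f k - f (suc k)) ≈ f 0 - f n
  ∑-telescope zero        = sym (-‿inverseʳ _)
  ∑-telescope (suc n) {f} = begin
    ∑ n (λ k → f k - f (suc k)) + (f n - f (suc n))  ≈⟨ +-congʳ (∑-telescope n {f}) ⟩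
    (f 0 - f n) + (f n - f (suc n))                  ≈⟨ solve 3 (λ a b c → (a :- b) :+ (b :- c) := a :- c) refl (f 0) (f n) (f (suc n)) ⟩
    f 0 - f (suc n)                                  ∎

  ∑-single : ∀ n i {f : ℕ → Carrier} → i ℕ.< n → (∀ k → k ≡.≢ i → f k ≈ 0#) → ∑ n f ≈ f i
  ∑-single (suc n) i i<1+n e with ℕₚ.m≤n⇒m<n∨m≡n (ℕₚ.≤-pred i<1+n)
  ... | inj₁ i<n    = trans (+-cong (∑-single n i i<n e) (e n λ n≡i → ℕₚ.<⇒≢ i<n (≡.sym n≡i))) (+-identityʳ _)
  ... | inj₂ ≡.refl = trans (+-congʳ (∑-zero n λ k k<n → e k (ℕₚ.<⇒≢ k<n))) (+-identityˡ _)

-- p and ρ stand for 1/q and 1/(1-q), Integral for being a Laurent polynomial.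
record QRing : Set₁ where
  field
    commutativeRing : CommutativeRing 0ℓ 0ℓ
  open CommutativeRing commutativeRing public
  open Algebra.Properties.Semiring.Exp semiring public
  field
    q p ρ     : Carrier
    q*p≈1     : q * p ≈ 1#
    [1-q]*ρ≈1 : (1# - q) * ρ ≈ 1#

  -- The closed form makes identities between q-integers polynomial in `ρ` and the powers of q,
  -- hence accessible to the ring solver.
  ⟦_⟧ : ℕ → Carrier
  ⟦ m ⟧ = (1# - q ^ m) * ρ

  field
    ⟦⟧⁻¹       : ℕ → Carrier
    ⟦⟧-inverse : ∀ n → ⟦ suc n ⟧ * ⟦⟧⁻¹ n ≈ 1#
    Integral   : Carrier → Set
    int-≈      : ∀ {x y} → x ≈ y → Integral x → Integral y
    int-+      : ∀ {x y} → Integral x → Integral y → Integral (x + y)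
    int-*      : ∀ {x y} → Integral x → Integral y → Integral (x * y)
    int-neg    : ∀ {x} → Integral x → Integral (- x)
    int-1      : Integral 1#
    int-q      : Integral q
    int-p      : Integral p

-- q-factorials, Gaussian binomials and the kernels `w`

module QCalculus (Q : QRing) where
  open QRing Q public
  open IntegerCoefficients commutativeRing public
  open FiniteSums commutativeRing public
  open Algebra.Properties.CommutativeSemiring.Exp commutativeSemiring public using (^-distrib-*)
  open Relation.Binary.Reasoning.Setoid setoid public

  1^ : ∀ n → 1# ^ n ≈ 1#
  1^ zero    = refl
  1^ (suc n) = trans (*-identityˡ _) (1^ n)

  ^-inverse : ∀ {a b} n → a * b ≈ 1# → a ^ n * b ^ n ≈ 1#
  ^-inverse {a} {b} n e = trans (sym (^-distrib-* a b n)) (trans (^-congˡ n e) (1^ n))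

  q^*p^ : ∀ n → q ^ n * p ^ n ≈ 1#
  q^*p^ n = ^-inverse n q*p≈1

  absorb : ∀ {a b} → a ≈ 1# → a * b ≈ b
  absorb e = trans (*-congʳ e) (*-identityˡ _)

  cancel-unit : ∀ {a b x y} → a * b ≈ 1# → a * x ≈ a * y → x ≈ y
  cancel-unit {a} {b} {x} {y} ab e = begin
    x            ≈⟨ absorb ab ⟨
    a * b * x    ≈⟨ solve 3 (λ a b c → a :* b :* c := b :* (a :* c)) refl a b x ⟩
    b * (a * x)  ≈⟨ *-congˡ e ⟩
    b * (a * y)  ≈⟨ solve 3 (λ a b c → b :* (a :* c) := a :* b :* c) refl a b y ⟩
    a * b * y    ≈⟨ absorb ab ⟩
    y            ∎

  unit-* : ∀ {a b c d} → a * b ≈ 1# → c * d ≈ 1# → (a * c) * (b * d) ≈ 1#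
  unit-* {a} {b} {c} {d} ab cd = begin
    (a * c) * (b * d)  ≈⟨ solve 4 (λ a b c d → (a :* c) :* (b :* d) := (a :* b) :* (c :* d)) refl a b c d ⟩
    (a * b) * (c * d)  ≈⟨ absorb ab ⟩
    c * d              ≈⟨ cd ⟩
    1#                 ∎

  q^-+ : ∀ l k → q ^ (l ℕ.+ k) ≈ q ^ l * q ^ k
  q^-+ = ^-homo-* q

  ⟦1+⟧ : ∀ n → ⟦ suc n ⟧ ≈ 1# + q * ⟦ n ⟧
  ⟦1+⟧ n = begin
    ⟦ suc n ⟧
        ≈⟨ solve 3 (λ a b c →
          ((con (+ 1) :- (b :* a)) :* c)
          := (con (+ 1) :- b) :* c :+ b :* ((con (+ 1) :- a) :* c))
        refl (q ^ n) q ρ ⟩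
    (1# - q) * ρ + q * ⟦ n ⟧      ≈⟨ +-congʳ [1-q]*ρ≈1 ⟩
    1# + q * ⟦ n ⟧                ∎

  ⟦0⟧ : ⟦ 0 ⟧ ≈ 0#
  ⟦0⟧ = trans (*-congʳ (-‿inverseʳ 1#)) (zeroˡ ρ)

  ⟦1++⟧ : ∀ l k → ⟦ suc (l ℕ.+ k) ⟧ ≈ (1# - q * (q ^ l * q ^ k)) * ρ
  ⟦1++⟧ l k = *-congʳ (+-congˡ (-‿cong (*-congˡ (q^-+ l k))))

  int-0 : Integral 0#
  int-0 = int-≈ (-‿inverseʳ 1#) (int-+ int-1 (int-neg int-1))

  int-^ : ∀ {x} n → Integral x → Integral (x ^ n)
  int-^ zero    i = int-1
  int-^ (suc n) i = int-* i (int-^ n i)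

  int-⟦⟧ : ∀ n → Integral ⟦ n ⟧
  int-⟦⟧ zero    = int-≈ (sym ⟦0⟧) int-0
  int-⟦⟧ (suc n) = int-≈ (sym (⟦1+⟧ n)) (int-+ int-1 (int-* int-q (int-⟦⟧ n)))

  int-∑ : ∀ n {f : ℕ → Carrier} → (∀ k → Integral (f k)) → Integral (∑ n f)
  int-∑ zero    i = int-0
  int-∑ (suc n) i = int-+ (int-∑ n i) (i n)

  fac : ℕ → Carrier
  fac zero    = 1#
  fac (suc n) = ⟦ suc n ⟧ * fac n

  ι : ℕ → Carrier
  ι zero    = 1#
  ι (suc n) = ⟦⟧⁻¹ n * ι n

  fac*ι : ∀ n → fac n * ι n ≈ 1#
  fac*ι zero    = *-identityˡ 1#
  fac*ι (suc n) = unit-* (⟦⟧-inverse n) (fac*ι n)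

  ⟦⟧*ι : ∀ n → ⟦ suc n ⟧ * ι (suc n) ≈ ι n
  ⟦⟧*ι n = trans (sym (*-assoc _ _ _)) (absorb (⟦⟧-inverse n))

  int-fac : ∀ n → Integral (fac n)
  int-fac zero    = int-1
  int-fac (suc n) = int-* (int-⟦⟧ (suc n)) (int-fac n)

  -- The q-binomial coefficient with top a + b; naming both lower parts avoids truncated
  -- subtraction.
  gaussian : ℕ → ℕ → Carrier
  gaussian a b = fac (a ℕ.+ b) * (ι a * ι b)

  gaussian-0ˡ : ∀ b → gaussian 0 b ≈ 1#
  gaussian-0ˡ b = trans (*-congˡ (*-identityˡ _)) (fac*ι b)

  gaussian-0ʳ : ∀ a → gaussian a 0 ≈ 1#
  gaussian-0ʳ a = trans (*-congˡ (*-identityʳ _)) (trans (*-congʳ (reflexive (≡.cong fac (ℕₚ.+-identityʳ a)))) (fac*ι a))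

  -- Rests on [a+b+2] = [a+1] + q^(a+1) [b+1]: each summand cancels the leading factor of one of the
  -- two denominators.
  gaussian-pascal : ∀ a b → gaussian (suc a) (suc b) ≈ gaussian a (suc b) + q ^ suc a * gaussian (suc a) b
  gaussian-pascal a b = begin
    ⟦ suc (a ℕ.+ suc b) ⟧ * f * (ι (suc a) * ι (suc b))
      ≈⟨ *-congʳ (*-congʳ split) ⟩
    (⟦ suc a ⟧ + q ^ suc a * ⟦ suc b ⟧) * f * (ι (suc a) * ι (suc b))
      ≈⟨ solve 6 (λ a b c d e f →
            (a :+ c :* b) :* d :* (e :* f)
            := d :* ((a :* e) :* f) :+ c :* (d :* (e :* (b :* f))))
          refl (⟦ suc a ⟧) (⟦ suc b ⟧) (q ^ suc a) f (ι (suc a)) (ι (suc b)) ⟩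
    f * ((⟦ suc a ⟧ * ι (suc a)) * ι (suc b)) + q ^ suc a * (f * (ι (suc a) * (⟦ suc b ⟧ * ι (suc b))))
      ≈⟨ +-cong (*-congˡ (*-congʳ (⟦⟧*ι a))) (*-congˡ (*-cong (reflexive (≡.cong fac (ℕₚ.+-suc a b))) (*-congˡ (⟦⟧*ι b)))) ⟩
    f * (ι a * ι (suc b)) + q ^ suc a * gaussian (suc a) b ∎
    where
    f = fac (a ℕ.+ suc b)
    split : ⟦ suc (a ℕ.+ suc b) ⟧ ≈ ⟦ suc a ⟧ + q ^ suc a * ⟦ suc b ⟧
    split = begin
      ⟦ suc (a ℕ.+ suc b) ⟧                  ≈⟨ ⟦1++⟧ a (suc b) ⟩
      (1# - q * (q ^ a * q ^ suc b)) * ρ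
          ≈⟨ solve 4 (λ a b c d →
            (con (+ 1) :- c :* (a :* (c :* b))) :* d
            := ((con (+ 1) :- (c :* a)) :* d) :+ (c :* a) :* ((con (+ 1) :- (c :* b)) :* d))
          refl (q ^ a) (q ^ b) q ρ ⟩
      ⟦ suc a ⟧ + q ^ suc a * ⟦ suc b ⟧      ∎

  -- Induction along `gaussian-pascal`. The q-binomial coefficients met below owe their integrality
  -- to this.
  int-gaussian : ∀ a b → Integral (gaussian a b)
  int-gaussian zero    b       = int-≈ (sym (gaussian-0ˡ b)) int-1
  int-gaussian (suc a) zero    = int-≈ (sym (gaussian-0ʳ (suc a))) int-1
  int-gaussian (suc a) (suc b) = int-≈ (sym (gaussian-pascal a b))
    (int-+ (int-gaussian a (suc b)) (int-* (int-^ (suc a) int-q) (int-gaussian (suc a) b)))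

  int-binomial : ∀ a b {c} → a ℕ.+ b ≡ c → Integral (fac c * (ι a * ι b))
  int-binomial a b ≡.refl = int-gaussian a b

  -- κ l k = 1/[l-k]!, which vanishes for k > l.
  κ : ℕ → ℕ → Carrier
  κ l       zero    = ι l
  κ zero    (suc k) = 0#
  κ (suc l) (suc k) = κ l k

  κ-+ : ∀ k i → κ (k ℕ.+ i) k ≡ ι i
  κ-+ zero    i = ≡.refl
  κ-+ (suc k) i = κ-+ k i

  κ-diag : ∀ k → κ k k ≡ 1#
  κ-diag zero    = ≡.refl
  κ-diag (suc k) = κ-diag k

  κ-< : ∀ {l k} → l ℕ.< k → κ l k ≡ 0#
  κ-< {zero}  {suc k} _         = ≡.refl
  κ-< {suc l} {suc k} (s≤s l<k) = κ-< l<k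

  -- For k < l the left factor is q^k [l-k], which shortens the factorial; for k ≥ l both sides
  -- vanish. Users therefore need no case distinction.
  κ-rec : ∀ l k → (q ^ k - q ^ l) * ρ * κ l k ≈ q ^ k * κ l (suc k)
  κ-rec zero    zero    = begin
    (1# - 1#) * ρ * 1#  ≈⟨ solve 1 (λ a → (con (+ 1) :- con (+ 1)) :* a :* con (+ 1) := con (+ 1) :* con (+ 0)) refl ρ ⟩
    1# * 0#             ∎
  κ-rec (suc l) zero    = trans (⟦⟧*ι l) (sym (*-identityˡ _))
  κ-rec zero    (suc k) = trans (zeroʳ _) (sym (zeroʳ _))
  κ-rec (suc l) (suc k) = begin
    (q ^ suc k - q ^ suc l) * ρ * κ l k
        ≈⟨ solve 5 (λ a b c d e →
          ((c :* a) :- (c :* b)) :* d :* e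
          := c :* ((a :- b) :* d :* e))
        refl (q ^ k) (q ^ l) q ρ (κ l k) ⟩
    q * ((q ^ k - q ^ l) * ρ * κ l k)      ≈⟨ *-congˡ (κ-rec l k) ⟩
    q * (q ^ k * κ l (suc k))              ≈⟨ *-assoc _ _ _ ⟨
    q ^ suc k * κ l (suc k)                ∎

  κ-suc : ∀ l k → κ l (suc k) ≈ p ^ k * ((q ^ k - q ^ l) * ρ) * κ l k
  κ-suc l k = begin
    κ l (suc k)                               ≈⟨ absorb (q^*p^ k) ⟨
    q ^ k * p ^ k * κ l (suc k)               ≈⟨ solve 3 (λ a b c → a :* b :* c := b :* (a :* c)) refl (q ^ k) (p ^ k) (κ l (suc k)) ⟩
    p ^ k * (q ^ k * κ l (suc k))             ≈⟨ *-congˡ (κ-rec l k) ⟨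
    p ^ k * ((q ^ k - q ^ l) * ρ * κ l k)     ≈⟨ *-assoc _ _ _ ⟨
    p ^ k * ((q ^ k - q ^ l) * ρ) * κ l k     ∎

  -- The factor is q^(-k) ([l] - [k]), which is [l-k] for k ≤ l but remains a Laurent polynomial for
  -- every k.
  int-κ-factor : ∀ l k → Integral (p ^ k * ((q ^ k - q ^ l) * ρ))
  int-κ-factor l k = int-* (int-^ k int-p) (int-≈ eq (int-+ (int-⟦⟧ l) (int-neg (int-⟦⟧ k))))
    where
    eq : ⟦ l ⟧ - ⟦ k ⟧ ≈ (q ^ k - q ^ l) * ρ
    eq = begin
      ⟦ l ⟧ - ⟦ k ⟧
          ≈⟨ solve 3 (λ a b c →
            ((con (+ 1) :- b) :* c) :- ((con (+ 1) :- a) :* c)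
            := (a :- b) :* c)
          refl (q ^ k) (q ^ l) ρ ⟩
      (q ^ k - q ^ l) * ρ    ∎

  -- `w⁻ l` is `w` at l - 1, and zero at l = 0; `w⁻ (suc l) k` reduces to `w l k`.
  w w⁻ : ℕ → ℕ → Carrier
  w  l k = κ l k * ι (suc (l ℕ.+ k))
  w⁻ l k = κ l (suc k) * ι (l ℕ.+ k)

  w-< : ∀ {l k} → l ℕ.< k → w l k ≈ 0#
  w-< l<k = trans (*-congʳ (reflexive (κ-< l<k))) (zeroˡ _)

  U u v : ℕ → Carrier
  U k = ⟦ k ⟧ * ⟦ suc k ⟧
  u k = p ^ k * U k
  v k = p ^ k * ⟦ suc (k ℕ.+ k) ⟧

  -- The q-analogue of l(l+1) - k(k+1) = (l-k)(l+k+1).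
  U-diff : ∀ l k → q ^ k * U l - q ^ l * U k ≈ (q ^ k - q ^ l) * ρ * ⟦ suc (l ℕ.+ k) ⟧
  U-diff l k = begin
    q ^ k * U l - q ^ l * U k
        ≈⟨ solve 4 (λ a b c d →
          a :* (((con (+ 1) :- b) :* d) :* ((con (+ 1) :- (c :* b)) :* d)) :- b :* (((con (+ 1) :- a) :* d) :* ((con (+ 1) :- (c :* a)) :* d))
          := (a :- b) :* d :* ((con (+ 1) :- c :* (b :* a)) :* d))
        refl (q ^ k) (q ^ l) q ρ ⟩
    (q ^ k - q ^ l) * ρ * ((1# - q * (q ^ l * q ^ k)) * ρ)    ≈⟨ *-congˡ (⟦1++⟧ l k) ⟨
    (q ^ k - q ^ l) * ρ * ⟦ suc (l ℕ.+ k) ⟧                   ∎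

  -- The two factors in `U-diff` each shorten one of the two factorials in the denominator of
  -- `w l k`.
  w-rec : ∀ l k → (q ^ k * U l - q ^ l * U k) * w l k ≈ q ^ k * w⁻ l k
  w-rec l k = begin
    (q ^ k * U l - q ^ l * U k) * w l k
      ≈⟨ *-congʳ (U-diff l k) ⟩
    (q ^ k - q ^ l) * ρ * ⟦ suc (l ℕ.+ k) ⟧ * (κ l k * ι (suc (l ℕ.+ k)))
      ≈⟨ solve 6 (λ a b c d e f →
            (a :- b) :* c :* d :* (e :* f)
            := ((a :- b) :* c :* e) :* (d :* f))
          refl (q ^ k) (q ^ l) ρ (⟦ suc (l ℕ.+ k) ⟧) (κ l k) (ι (suc (l ℕ.+ k))) ⟩
    ((q ^ k - q ^ l) * ρ * κ l k) * (⟦ suc (l ℕ.+ k) ⟧ * ι (suc (l ℕ.+ k)))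
      ≈⟨ *-cong (κ-rec l k) (⟦⟧*ι (l ℕ.+ k)) ⟩
    (q ^ k * κ l (suc k)) * ι (l ℕ.+ k)
      ≈⟨ *-assoc _ _ _ ⟩
    q ^ k * w⁻ l k ∎

  -- `w-rec` solved for `u k`: multiplication by u is triangular on the kernels, with eigenvalue
  -- `u l` and one lowering term.
  u*w : ∀ l k → u k * w l k ≈ u l * w l k - p ^ l * w⁻ l k
  u*w l k = begin
    p ^ k * U k * w l k
      ≈⟨ absorb (q^*p^ l) ⟨
    q ^ l * p ^ l * (p ^ k * U k * w l k)
      ≈⟨ solve 7 (λ a b c d e f g →
            a :* c :* (d :* e :* g)
            := b :* d :* (c :* f :* g) :- d :* c :* ((b :* f :- a :* e) :* g))
          refl (q ^ l) (q ^ k) (p ^ l) (p ^ k) (U k) (U l) (w l k) ⟩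
    q ^ k * p ^ k * (p ^ l * U l * w l k) - p ^ k * p ^ l * ((q ^ k * U l - q ^ l * U k) * w l k)
      ≈⟨ +-cong (absorb (q^*p^ k)) (-‿cong (*-congˡ (w-rec l k))) ⟩
    p ^ l * U l * w l k - p ^ k * p ^ l * (q ^ k * w⁻ l k)
      ≈⟨ solve 6 (λ a b c d e f →
            b :* d :* e :- c :* b :* (a :* f)
            := b :* d :* e :- a :* c :* (b :* f))
          refl (q ^ k) (p ^ l) (p ^ k) (U l) (w l k) (w⁻ l k) ⟩
    p ^ l * U l * w l k - q ^ k * p ^ k * (p ^ l * w⁻ l k)
      ≈⟨ +-congˡ (-‿cong (absorb (q^*p^ k))) ⟩
    u l * w l k - p ^ l * w⁻ l k ∎

  -- Used twice: it telescopes the moment of 1, whose summand explains the trailing `1#`, and after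
  -- multiplication by [2l]! it is the passage from the difference of two q-binomials to the product
  -- form of the ballot number.
  κι-diff : ∀ l k → κ l k * ι (l ℕ.+ k) - κ l (suc k) * ι (l ℕ.+ suc k) ≈ q ^ l * (v k * w l k * 1#)
  κι-diff l k = begin
    κ l k * ι (l ℕ.+ k) - κ l (suc k) * ι (l ℕ.+ suc k)
      ≈⟨ +-cong (*-congˡ (sym (⟦⟧*ι (l ℕ.+ k)))) (-‿cong (*-cong (κ-suc l k) (reflexive (≡.cong ι (ℕₚ.+-suc l k))))) ⟩
    κ l k * (⟦ suc (l ℕ.+ k) ⟧ * I) - p ^ k * ((q ^ k - q ^ l) * ρ) * κ l k * I
      ≈⟨ +-congʳ (*-congˡ (*-congʳ (⟦1++⟧ l k))) ⟩
    κ l k * ((1# - q * (q ^ l * q ^ k)) * ρ * I) - p ^ k * ((q ^ k - q ^ l) * ρ) * κ l k * I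
      -- The solver does not know that q p = 1. The product q^k p^k is isolated and replaced by 1,
      -- and a factor 1 is exposed where q^k p^k is to be inserted instead.
      ≈⟨ solve 7 (λ a b c d e f g →
            a :* ((con (+ 1) :- b :* (c :* d)) :* e :* f) :- g :* ((d :- c) :* e) :* a :* f
            := a :* f :* e :* ((con (+ 1) :- d :* g) :+ (g :* c :- b :* (c :* (con (+ 1) :* d)))))
          refl (κ l k) q (q ^ l) (q ^ k) ρ I (p ^ k) ⟩
    κ l k * I * ρ * ((1# - q ^ k * p ^ k) + (p ^ k * q ^ l - q * (q ^ l * (1# * q ^ k))))
      ≈⟨ *-congˡ (+-cong (trans (+-congˡ (-‿cong (q^*p^ k))) (-‿inverseʳ 1#)) (+-congˡ (-‿cong (*-congˡ (*-congˡ (*-congʳ (sym (q^*p^ k)))))))) ⟩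
    κ l k * I * ρ * (0# + (p ^ k * q ^ l - q * (q ^ l * (q ^ k * p ^ k * q ^ k))))
      ≈⟨ solve 7 (λ a b c d e f g →
            a :* f :* e :* (con (+ 0) :+ (g :* c :- b :* (c :* (d :* g :* d))))
            := c :* (g :* ((con (+ 1) :- b :* (d :* d)) :* e) :* (a :* f) :* con (+ 1)))
          refl (κ l k) q (q ^ l) (q ^ k) ρ I (p ^ k) ⟩
    q ^ l * (p ^ k * ((1# - q * (q ^ k * q ^ k)) * ρ) * (κ l k * I) * 1#)
      ≈⟨ *-congˡ (*-congʳ (*-congʳ (*-congˡ (⟦1++⟧ k k)))) ⟨
    q ^ l * (v k * w l k * 1#) ∎
    where I = ι (suc (l ℕ.+ k))

-- Expansions in the kernels `w l k`

module Expansions (Q : QRing) where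
  open QCalculus Q

  -- By `U-diff` the difference is q^k times two q-integers of positive index. Cancelling it is the
  -- induction step of `expand`.
  unit-U-diff : ∀ {n k} → k ℕ.≤ n → Σ Carrier λ b → (q ^ k * U (suc n) - q ^ suc n * U k) * b ≈ 1#
  unit-U-diff {n} {k} k≤n with ℕₚ.m≤n⇒∃[o]m+o≡n k≤n
  ... | i , ≡.refl = p ^ k * (⟦⟧⁻¹ i * ⟦⟧⁻¹ m) , trans (*-congʳ factored) (unit-* (q^*p^ k) (unit-* (⟦⟧-inverse i) (⟦⟧-inverse m)))
    where
    m = suc (k ℕ.+ i) ℕ.+ k
    factored : q ^ k * U (suc (k ℕ.+ i)) - q ^ suc (k ℕ.+ i) * U k ≈ q ^ k * (⟦ suc i ⟧ * ⟦ suc m ⟧)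
    factored = begin
      q ^ k * U (suc (k ℕ.+ i)) - q ^ suc (k ℕ.+ i) * U k
        ≈⟨ U-diff (suc (k ℕ.+ i)) k ⟩
      (q ^ k - q * q ^ (k ℕ.+ i)) * ρ * ⟦ suc m ⟧
        ≈⟨ *-congʳ (*-congʳ (+-congˡ (-‿cong (*-congˡ (q^-+ k i))))) ⟩
      (q ^ k - q * (q ^ k * q ^ i)) * ρ * ⟦ suc m ⟧
        ≈⟨ solve 5 (λ a b c d e →
              (a :- c :* (a :* b)) :* d :* e
              := a :* (((con (+ 1) :- (c :* b)) :* d) :* e))
            refl (q ^ k) (q ^ i) q ρ (⟦ suc m ⟧) ⟩
      q ^ k * (⟦ suc i ⟧ * ⟦ suc m ⟧) ∎

  -- A family g n is identified with its expansion in the w l k by means of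
  -- the recurrence w-rec; only the diagonal n = k has to be compared directly,
  -- because there the factor in front of g n vanishes.
  module Expansion (k N : ℕ) (g θ : ℕ → Carrier) (c : ℕ → ℕ → Carrier)
    (g-rec : ∀ n → (q ^ k * U (suc n) - q ^ suc n * U k) * g (suc n) ≈ q ^ k * (θ n * g n))
    (g-< : ∀ n → n ℕ.< k → g n ≈ 0#)
    (g-diag : g k ≈ c k k * w k k)
    (c-rec : ∀ n l → c (suc n) l * (U (suc n) - q ^ suc n * u l) + q ^ suc n * p ^ suc l * c (suc n) (suc l) ≈ θ n * c n l)
    (c-< : ∀ n l → n ℕ.< l → c n l ≈ 0#)
    where

    expansion : ℕ → Carrier
    expansion n = ∑ (suc N) λ l → c n l * w l k

    -- `u*w` splits every term into a part with `w l k` and a part with `w⁻ l k`. After an index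
    -- shift in the latter, comparison of the coefficients of `w l k` is exactly `c-rec`.
    expansion-rec : ∀ n → n ℕ.< N →
      (q ^ k * U (suc n) - q ^ suc n * U k) * expansion (suc n) ≈ q ^ k * (θ n * expansion n)
    expansion-rec n n<N = begin
      (q ^ k * U (suc n) - q ^ suc n * U k) * expansion (suc n)
        ≈⟨ *-∑ (suc N) ⟩
      ∑ (suc N) (λ l → (q ^ k * U (suc n) - q ^ suc n * U k) * (c (suc n) l * w l k))
        ≈⟨ ∑-cong (suc N) termwise ⟩
      ∑ (suc N) (λ l → q ^ k * (A l * w l k + B l * w⁻ l k))
        ≈⟨ *-∑ (suc N) ⟨
      q ^ k * ∑ (suc N) (λ l → A l * w l k + B l * w⁻ l k)
        ≈⟨ *-congˡ (∑-+ (suc N)) ⟩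
      q ^ k * (∑ (suc N) (λ l → A l * w l k) + ∑ (suc N) (λ l → B l * w⁻ l k))
        ≈⟨ *-congˡ (+-congˡ shifted) ⟩
      q ^ k * (∑ (suc N) (λ l → A l * w l k) + ∑ (suc N) (λ l → B (suc l) * w l k))
        ≈⟨ *-congˡ (∑-+ (suc N)) ⟨
      q ^ k * ∑ (suc N) (λ l → A l * w l k + B (suc l) * w l k)
        ≈⟨ *-congˡ (∑-cong (suc N) λ l → trans (sym (distribʳ (w l k) (A l) (B (suc l)))) (trans (*-congʳ (c-rec n l)) (*-assoc _ _ _))) ⟩
      q ^ k * ∑ (suc N) (λ l → θ n * (c n l * w l k))
        ≈⟨ *-congˡ (*-∑ (suc N)) ⟨
      q ^ k * (θ n * expansion n) ∎
      where
      A B : ℕ → Carrier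
      A l = c (suc n) l * (U (suc n) - q ^ suc n * u l)
      B l = q ^ suc n * p ^ l * c (suc n) l
      termwise : ∀ l → (q ^ k * U (suc n) - q ^ suc n * U k) * (c (suc n) l * w l k) ≈ q ^ k * (A l * w l k + B l * w⁻ l k)
      termwise l = begin
        (q ^ k * U (suc n) - q ^ suc n * U k) * (c (suc n) l * w l k)
          ≈⟨ solve 6 (λ a b c d e f →
                (a :* c :- b :* d) :* (e :* f)
                := a :* c :* e :* f :- b :* e :* (d :* f))
              refl (q ^ k) (q ^ suc n) (U (suc n)) (U k) (c (suc n) l) (w l k) ⟩
        q ^ k * U (suc n) * c (suc n) l * w l k - q ^ suc n * c (suc n) l * (U k * w l k)
          ≈⟨ +-congˡ (-‿cong (*-congˡ (absorb (q^*p^ k)))) ⟨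
        q ^ k * U (suc n) * c (suc n) l * w l k - q ^ suc n * c (suc n) l * (q ^ k * p ^ k * (U k * w l k))
          ≈⟨ solve 7 (λ a b c d e f g →
                a :* d :* f :* g :- c :* f :* (a :* b :* (e :* g))
                := a :* d :* f :* g :- a :* c :* f :* (b :* e :* g))
              refl (q ^ k) (p ^ k) (q ^ suc n) (U (suc n)) (U k) (c (suc n) l) (w l k) ⟩
        q ^ k * U (suc n) * c (suc n) l * w l k - q ^ k * q ^ suc n * c (suc n) l * (p ^ k * U k * w l k)
          ≈⟨ +-congˡ (-‿cong (*-congˡ (u*w l k))) ⟩
        q ^ k * U (suc n) * c (suc n) l * w l k - q ^ k * q ^ suc n * c (suc n) l * (u l * w l k - p ^ l * w⁻ l k)
          ≈⟨ solve 8 (λ a b c d e f g h →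
                a :* d :* f :* g :- a :* c :* f :* (e :* g :- b :* h)
                := a :* (f :* (d :- c :* e) :* g :+ c :* b :* f :* h))
              refl (q ^ k) (p ^ l) (q ^ suc n) (U (suc n)) (u l) (c (suc n) l) (w l k) (w⁻ l k) ⟩
        q ^ k * (c (suc n) l * (U (suc n) - q ^ suc n * u l) * w l k + q ^ suc n * p ^ l * c (suc n) l * w⁻ l k) ∎
      -- The shift loses nothing: `w⁻ 0 k` vanishes at the bottom, and `c (suc n) (suc N)` at the
      -- top since n < N.
      shifted : ∑ (suc N) (λ l → B l * w⁻ l k) ≈ ∑ (suc N) (λ l → B (suc l) * w l k)
      shifted = begin
        ∑ (suc N) (λ l → B l * w⁻ l k)
          ≈⟨ ∑-head N ⟩
        B 0 * (0# * ι k) + ∑ N (λ l → B (suc l) * w l k)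
          ≈⟨ solve 6 (λ a b c d e f →
                a :* (con (+ 0) :* b) :+ c
                := c :+ e :* f :* con (+ 0) :* d)
              refl (B 0) (ι k) (∑ N (λ l → B (suc l) * w l k)) (w N k) (q ^ suc n) (p ^ suc N) ⟩
        ∑ N (λ l → B (suc l) * w l k) + q ^ suc n * p ^ suc N * 0# * w N k
          ≈⟨ +-congˡ (*-congʳ (*-congˡ (c-< (suc n) (suc N) (s≤s n<N)))) ⟨
        ∑ (suc N) (λ l → B (suc l) * w l k) ∎

    -- A nonzero term needs k ≤ l ≤ n. Hence both sides vanish for n < k, only l = k survives for n
    -- = k, and for n > k the common recurrence is divided by its invertible leading factor.
    expand : ∀ n → n ℕ.≤ N → g n ≈ expansion n
    expand n n≤N with ℕₚ.<-cmp n k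
    ... | tri< n<k _ _ = trans (g-< n n<k) (sym (∑-zero (suc N) vanish))
      where
      vanish : ∀ l → l ℕ.< suc N → c n l * w l k ≈ 0#
      vanish l _ with ℕₚ.≤-<-connex l n
      ... | inj₁ l≤n = trans (*-congˡ (w-< (ℕₚ.≤-<-trans l≤n n<k))) (zeroʳ _)
      ... | inj₂ n<l = trans (*-congʳ (c-< n l n<l)) (zeroˡ _)
    ... | tri≈ _ ≡.refl _ = trans g-diag (sym (∑-single (suc N) k (s≤s n≤N) vanish))
      where
      vanish : ∀ l → l ≡.≢ k → c k l * w l k ≈ 0#
      vanish l l≢k with ℕₚ.<-cmp l k
      ... | tri< l<k _ _ = trans (*-congˡ (w-< l<k)) (zeroʳ _)
      ... | tri≈ _ l≡k _ = contradiction l≡k l≢k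
      ... | tri> _ _ k<l = trans (*-congʳ (c-< k l k<l)) (zeroˡ _)
    expand (suc n) n<N | tri> _ _ (s≤s k≤n) = cancel-unit (proj₂ (unit-U-diff k≤n)) (begin
      (q ^ k * U (suc n) - q ^ suc n * U k) * g (suc n)
        ≈⟨ g-rec n ⟩
      q ^ k * (θ n * g n)
        ≈⟨ *-congˡ (*-congˡ (expand n (ℕₚ.<⇒≤ n<N))) ⟩
      q ^ k * (θ n * expansion n)
        ≈⟨ expansion-rec n n<N ⟨
      (q ^ k * U (suc n) - q ^ suc n * U k) * expansion (suc n) ∎)

  -- `U-diff` in the shape in which `c-rec` contains it. For a successor n, `κ n (suc l)` is the κ
  -- of the smaller index, as the right-hand side of `c-rec` demands.
  U-diff*κ : ∀ n l → (U n - q ^ n * u l) * κ n l ≈ ⟦ suc (n ℕ.+ l) ⟧ * κ n (suc l)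
  U-diff*κ n l = begin
    (U n - q ^ n * u l) * κ n l
      ≈⟨ *-congʳ (+-congʳ (absorb (q^*p^ l))) ⟨
    (q ^ l * p ^ l * U n - q ^ n * u l) * κ n l
      ≈⟨ solve 6 (λ a b c d e f →
            (a :* b :* d :- c :* (b :* e)) :* f
            := b :* (a :* d :- c :* e) :* f)
          refl (q ^ l) (p ^ l) (q ^ n) (U n) (U l) (κ n l) ⟩
    p ^ l * (q ^ l * U n - q ^ n * U l) * κ n l
      ≈⟨ *-congʳ (*-congˡ (U-diff n l)) ⟩
    p ^ l * ((q ^ l - q ^ n) * ρ * ⟦ suc (n ℕ.+ l) ⟧) * κ n l
      ≈⟨ solve 6 (λ a b c d e f →
            b :* ((a :- c) :* d :* e) :* f
            := e :* (b :* ((a :- c) :* d) :* f))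
          refl (q ^ l) (p ^ l) (q ^ n) ρ (⟦ suc (n ℕ.+ l) ⟧) (κ n l) ⟩
    ⟦ suc (n ℕ.+ l) ⟧ * (p ^ l * ((q ^ l - q ^ n) * ρ) * κ n l)
      ≈⟨ *-congˡ (κ-suc n l) ⟨
    ⟦ suc (n ℕ.+ l) ⟧ * κ n (suc l) ∎

  -- This is q^((n-l)(m-l)), the power in the q-Chu-Vandermonde identity, with the exponent
  -- multiplied out so that no subtraction occurs.
  powers : ℕ → ℕ → ℕ → Carrier
  powers n m l = q ^ (n ℕ.* m) * q ^ (l ℕ.* l) * p ^ ((n ℕ.+ m) ℕ.* l)

  int-powers : ∀ n m l → Integral (powers n m l)
  int-powers n m l = int-* (int-* (int-^ (n ℕ.* m) int-q) (int-^ (l ℕ.* l) int-q)) (int-^ ((n ℕ.+ m) ℕ.* l) int-p)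

  powers-diag : ∀ k m → powers k m k ≈ 1#
  powers-diag k m = begin
    q ^ (k ℕ.* m) * q ^ (k ℕ.* k) * p ^ ((k ℕ.+ m) ℕ.* k)
      ≈⟨ *-congʳ (q^-+ (k ℕ.* m) (k ℕ.* k)) ⟨
    q ^ (k ℕ.* m ℕ.+ k ℕ.* k) * p ^ ((k ℕ.+ m) ℕ.* k)
      ≡⟨ ≡.cong (λ e → q ^ e * p ^ ((k ℕ.+ m) ℕ.* k)) (≡.trans (≡.sym (ℕₚ.*-distribˡ-+ k m k)) (≡.trans (ℕₚ.*-comm k (m ℕ.+ k)) (≡.cong (ℕ._* k) (ℕₚ.+-comm m k)))) ⟩
    q ^ ((k ℕ.+ m) ℕ.* k) * p ^ ((k ℕ.+ m) ℕ.* k)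
      ≈⟨ q^*p^ ((k ℕ.+ m) ℕ.* k) ⟩
    1# ∎

  powers-n : ∀ n m l → powers n m l ≈ powers (suc n) m l * (p ^ m * q ^ l)
  powers-n n m l = sym (begin
    q ^ (m ℕ.+ n ℕ.* m) * q ^ (l ℕ.* l) * p ^ (l ℕ.+ (n ℕ.+ m) ℕ.* l) * (p ^ m * q ^ l)
      ≈⟨ *-congʳ (*-cong (*-congʳ (q^-+ m _)) (^-homo-* p l _)) ⟩
    (q ^ m * q ^ (n ℕ.* m)) * q ^ (l ℕ.* l) * (p ^ l * p ^ ((n ℕ.+ m) ℕ.* l)) * (p ^ m * q ^ l)
      ≈⟨ solve 7 (λ a b c d e f g →
            (a :* b) :* c :* (d :* e) :* (f :* g)
            := a :* f :* (g :* d :* (b :* c :* e)))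
          refl (q ^ m) (q ^ (n ℕ.* m)) (q ^ (l ℕ.* l)) (p ^ l) (p ^ ((n ℕ.+ m) ℕ.* l)) (p ^ m) (q ^ l) ⟩
    q ^ m * p ^ m * (q ^ l * p ^ l * (q ^ (n ℕ.* m) * q ^ (l ℕ.* l) * p ^ ((n ℕ.+ m) ℕ.* l)))
      ≈⟨ absorb (q^*p^ m) ⟩
    q ^ l * p ^ l * powers n m l
      ≈⟨ absorb (q^*p^ l) ⟩
    powers n m l ∎)

  powers-l : ∀ n m l → q ^ n * p ^ suc l * p ^ l * powers n m (suc l) ≈ powers n m l * p ^ m
  powers-l n m l = begin
    q ^ n * p ^ suc l * p ^ l * (q ^ (n ℕ.* m) * q ^ suc (l ℕ.+ l ℕ.* suc l) * p ^ ((n ℕ.+ m) ℕ.* suc l))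
      ≡⟨ ≡.cong₂ (λ e f → q ^ n * p ^ suc l * p ^ l * (q ^ (n ℕ.* m) * q ^ e * p ^ f))
           (≡.cong (λ e → suc (l ℕ.+ e)) (ℕₚ.*-suc l l)) (ℕₚ.*-suc (n ℕ.+ m) l) ⟩
    q ^ n * p ^ suc l * p ^ l * (q ^ (n ℕ.* m) * q ^ suc (l ℕ.+ (l ℕ.+ l ℕ.* l)) * p ^ (n ℕ.+ m ℕ.+ (n ℕ.+ m) ℕ.* l))
      ≈⟨ *-congˡ (*-cong (*-congˡ (*-congˡ (trans (q^-+ l _) (*-congˡ (q^-+ l _))))) (trans (^-homo-* p (n ℕ.+ m) _) (*-congʳ (^-homo-* p n m)))) ⟩
    q ^ n * p ^ suc l * p ^ l * (q ^ (n ℕ.* m) * (q * (q ^ l * (q ^ l * q ^ (l ℕ.* l)))) * (p ^ n * p ^ m * p ^ ((n ℕ.+ m) ℕ.* l)))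
      ≈⟨ solve 10 (λ a b c d e f g h i j →
            c :* (b :* f) :* f :* (h :* (a :* (e :* (e :* i))) :* (d :* g :* j))
            := (c :* d) :* (((a :* e) :* (b :* f)) :* ((e :* f) :* (h :* i :* j :* g))))
          refl q p (q ^ n) (p ^ n) (q ^ l) (p ^ l) (p ^ m) (q ^ (n ℕ.* m)) (q ^ (l ℕ.* l)) (p ^ ((n ℕ.+ m) ℕ.* l)) ⟩
    (q ^ n * p ^ n) * ((q ^ suc l * p ^ suc l) * ((q ^ l * p ^ l) * (q ^ (n ℕ.* m) * q ^ (l ℕ.* l) * p ^ ((n ℕ.+ m) ℕ.* l) * p ^ m)))
      ≈⟨ absorb (q^*p^ n) ⟩
    (q ^ suc l * p ^ suc l) * ((q ^ l * p ^ l) * (powers n m l * p ^ m))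
      ≈⟨ absorb (q^*p^ (suc l)) ⟩
    (q ^ l * p ^ l) * (powers n m l * p ^ m)
      ≈⟨ absorb (q^*p^ l) ⟩
    powers n m l * p ^ m ∎

  -- The q-Chu–Vandermonde identity, in a form symmetric in n and m.
  w*w : ∀ N n m k → n ℕ.≤ N →
    fac (suc (n ℕ.+ m)) * (w n k * w m k) ≈ ∑ (suc N) (λ l → powers n m l * (κ n l * κ m l) * w l k)
  w*w N n m k = Expansion.expand k N
    -- The multiplier θ is the factor by which the factorial in front grows when i increases by one;
    -- `w m k` is a spectator of the recurrence.
    (λ i → fac (suc (i ℕ.+ m)) * (w i k * w m k)) (λ i → ⟦ suc (suc i ℕ.+ m) ⟧)
    c g-rec g-< g-diag c-rec c-< n
    where
    c : ℕ → ℕ → Carrier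
    c i l = powers i m l * (κ i l * κ m l)
    g-rec : ∀ n → (q ^ k * U (suc n) - q ^ suc n * U k) * (fac (suc (suc n ℕ.+ m)) * (w (suc n) k * w m k))
          ≈ q ^ k * (⟦ suc (suc n ℕ.+ m) ⟧ * (fac (suc (n ℕ.+ m)) * (w n k * w m k)))
    g-rec n = begin
      D * (⟦ suc (suc n ℕ.+ m) ⟧ * f * (w (suc n) k * w m k))
        ≈⟨ solve 5 (λ a b c d e →
              a :* (b :* c :* (d :* e))
              := (a :* d) :* (b :* c :* e))
            refl D (⟦ suc (suc n ℕ.+ m) ⟧) f (w (suc n) k) (w m k) ⟩
      (D * w (suc n) k) * (⟦ suc (suc n ℕ.+ m) ⟧ * f * w m k)
        ≈⟨ *-congʳ (w-rec (suc n) k) ⟩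
      (q ^ k * w n k) * (⟦ suc (suc n ℕ.+ m) ⟧ * f * w m k)
        ≈⟨ solve 5 (λ a b c d e →
              (a :* d) :* (b :* c :* e)
              := a :* (b :* (c :* (d :* e))))
            refl (q ^ k) (⟦ suc (suc n ℕ.+ m) ⟧) f (w n k) (w m k) ⟩
      q ^ k * (⟦ suc (suc n ℕ.+ m) ⟧ * (f * (w n k * w m k))) ∎
      where
      D = q ^ k * U (suc n) - q ^ suc n * U k
      f = fac (suc (n ℕ.+ m))
    g-< : ∀ n → n ℕ.< k → fac (suc (n ℕ.+ m)) * (w n k * w m k) ≈ 0#
    g-< n n<k = trans (*-congˡ (trans (*-congʳ (w-< n<k)) (zeroˡ _))) (zeroʳ _)
    g-diag : fac (suc (k ℕ.+ m)) * (w k k * w m k) ≈ c k k * w k k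
    g-diag = begin
      fac (suc (k ℕ.+ m)) * (w k k * (κ m k * ι (suc (m ℕ.+ k))))
        ≡⟨ ≡.cong (λ e → fac (suc (k ℕ.+ m)) * (w k k * (κ m k * ι (suc e)))) (ℕₚ.+-comm m k) ⟩
      fac (suc (k ℕ.+ m)) * (w k k * (κ m k * ι (suc (k ℕ.+ m))))
        ≈⟨ solve 4 (λ a b c d →
              a :* (c :* (d :* b))
              := a :* b :* (d :* c))
            refl (fac (suc (k ℕ.+ m))) (ι (suc (k ℕ.+ m))) (w k k) (κ m k) ⟩
      fac (suc (k ℕ.+ m)) * ι (suc (k ℕ.+ m)) * (κ m k * w k k)
        ≈⟨ absorb (fac*ι (suc (k ℕ.+ m))) ⟩
      κ m k * w k k
        ≈⟨ *-congʳ (trans (absorb (powers-diag k m)) (absorb (reflexive (κ-diag k)))) ⟨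
      powers k m k * (κ k k * κ m k) * w k k ∎
    c-rec : ∀ n l → c (suc n) l * (U (suc n) - q ^ suc n * u l) + q ^ suc n * p ^ suc l * c (suc n) (suc l)
          ≈ ⟦ suc (suc n ℕ.+ m) ⟧ * c n l
    c-rec n l = begin
      z * (κ (suc n) l * κ m l) * (U (suc n) - q ^ suc n * u l) + q ^ suc n * p ^ suc l * (z′ * (κ n l * κ m (suc l)))
        ≈⟨ +-congˡ (*-congˡ (*-congˡ (*-congˡ (κ-suc m l)))) ⟩
      z * (κ (suc n) l * κ m l) * (U (suc n) - q ^ suc n * u l) + q ^ suc n * p ^ suc l * (z′ * (κ n l * (p ^ l * ((q ^ l - q ^ m) * ρ) * κ m l)))
        ≈⟨ solve 10 (λ a b c d e f g h i j →
              a :* (c :* d) :* (f) :+ g :* h :* (b :* (e :* (i :* (j) :* d)))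
              := a :* d :* ((f) :* c) :+ (g :* h :* i :* b) :* (e :* d :* (j)))
            refl z z′ (κ (suc n) l) (κ m l) (κ n l) (U (suc n) - q ^ suc n * u l) (q ^ suc n) (p ^ suc l) (p ^ l) ((q ^ l - q ^ m) * ρ) ⟩
      z * κ m l * ((U (suc n) - q ^ suc n * u l) * κ (suc n) l) + (q ^ suc n * p ^ suc l * p ^ l * z′) * (κ n l * κ m l * ((q ^ l - q ^ m) * ρ))
        ≈⟨ +-cong (*-congˡ (U-diff*κ (suc n) l)) (*-congʳ (powers-l (suc n) m l)) ⟩
      z * κ m l * (⟦ suc (suc n ℕ.+ l) ⟧ * κ n l) + z * p ^ m * (κ n l * κ m l * ((q ^ l - q ^ m) * ρ))
        ≈⟨ solve 8 (λ a b c d e f g h →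
              a :* b :* (d :* c) :+ a :* e :* (c :* b :* ((g :- f) :* h))
              := a :* (c :* b) :* (d :+ (e :* g :- f :* e) :* h))
            refl z (κ m l) (κ n l) (⟦ suc (suc n ℕ.+ l) ⟧) (p ^ m) (q ^ m) (q ^ l) ρ ⟩
      z * (κ n l * κ m l) * (⟦ suc (suc n ℕ.+ l) ⟧ + (p ^ m * q ^ l - q ^ m * p ^ m) * ρ)
        ≈⟨ *-congˡ merge ⟩
      z * (κ n l * κ m l) * (⟦ suc (suc n ℕ.+ m) ⟧ * (p ^ m * q ^ l))
        ≈⟨ solve 5 (λ a b c d e →
              a :* (c :* b) :* (d :* (e))
              := d :* (a :* (e) :* (c :* b)))
            refl z (κ m l) (κ n l) (⟦ suc (suc n ℕ.+ m) ⟧) (p ^ m * q ^ l) ⟩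
      ⟦ suc (suc n ℕ.+ m) ⟧ * (z * (p ^ m * q ^ l) * (κ n l * κ m l))
        ≈⟨ *-congˡ (*-congʳ (powers-n n m l)) ⟨
      ⟦ suc (suc n ℕ.+ m) ⟧ * c n l ∎
      where
      z = powers (suc n) m l
      z′ = powers (suc n) m (suc l)
      -- Both sides are (q^(l-m) - q^(n+l+2)) / (1-q).
      merge : ⟦ suc (suc n ℕ.+ l) ⟧ + (p ^ m * q ^ l - q ^ m * p ^ m) * ρ ≈ ⟦ suc (suc n ℕ.+ m) ⟧ * (p ^ m * q ^ l)
      merge = begin
        ⟦ suc (suc n ℕ.+ l) ⟧ + (p ^ m * q ^ l - q ^ m * p ^ m) * ρ
          ≈⟨ +-cong (⟦1++⟧ (suc n) l) (*-congʳ (+-congˡ (-‿cong (q^*p^ m)))) ⟩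
        (1# - q * (q ^ suc n * q ^ l)) * ρ + (p ^ m * q ^ l - 1#) * ρ
          ≈⟨ solve 5 (λ a b c d e →
                (con (+ 1) :- a :* (b :* c)) :* d :+ (e :* c :- con (+ 1)) :* d
                := (e :* c :- a :* b :* (con (+ 1) :* c)) :* d)
              refl q (q ^ suc n) (q ^ l) ρ (p ^ m) ⟩
        (p ^ m * q ^ l - q * q ^ suc n * (1# * q ^ l)) * ρ
          ≈⟨ *-congʳ (+-congˡ (-‿cong (*-congˡ (*-congʳ (q^*p^ m))))) ⟨
        (p ^ m * q ^ l - q * q ^ suc n * (q ^ m * p ^ m * q ^ l)) * ρ
          ≈⟨ solve 6 (λ a b c d e f →
                (e :* c :- a :* b :* (f :* e :* c)) :* d
                := (con (+ 1) :- a :* (b :* f)) :* d :* (e :* c))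
              refl q (q ^ suc n) (q ^ l) ρ (p ^ m) (q ^ m) ⟩
        (1# - q * (q ^ suc n * q ^ m)) * ρ * (p ^ m * q ^ l)
          ≈⟨ *-congʳ (⟦1++⟧ (suc n) m) ⟨
        ⟦ suc (suc n ℕ.+ m) ⟧ * (p ^ m * q ^ l) ∎
    c-< : ∀ n l → n ℕ.< l → c n l ≈ 0#
    c-< n l n<l = trans (*-congˡ (trans (*-congʳ (reflexive (κ-< n<l))) (zeroˡ _))) (zeroʳ _)

  -- The coefficient q^(l²+l) (1-q)^(n-l) / [n-l]!, with `ρ ^ l` in place of a subtraction in the
  -- exponent. It comes from Bailey's lemma at a = q with both parameters sent to infinity,
  -- rewritten in q-factorials.
  gauss : ℕ → ℕ → Carrier
  gauss n l = q ^ (l ℕ.* l ℕ.+ l) * ((1# - q) ^ n * ρ ^ l * κ n l)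

  -- The factor q^(k²+k) does not depend on the recursion index, so the left side inherits `w-rec`
  -- unchanged, with θ = 1.
  q^k²+k*w : ∀ N n k → n ℕ.≤ N → q ^ (k ℕ.* k ℕ.+ k) * w n k ≈ ∑ (suc N) (λ l → gauss n l * w l k)
  q^k²+k*w N n k = Expansion.expand k N
    (λ i → q ^ (k ℕ.* k ℕ.+ k) * w i k) (λ _ → 1#) gauss g-rec g-< g-diag c-rec c-< n
    where
    g-rec : ∀ n → (q ^ k * U (suc n) - q ^ suc n * U k) * (q ^ (k ℕ.* k ℕ.+ k) * w (suc n) k)
          ≈ q ^ k * (1# * (q ^ (k ℕ.* k ℕ.+ k) * w n k))
    g-rec n = begin
      D * (e * w (suc n) k)         ≈⟨ solve 3 (λ a b c → a :* (b :* c) := b :* (a :* c)) refl D e (w (suc n) k) ⟩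
      e * (D * w (suc n) k)         ≈⟨ *-congˡ (w-rec (suc n) k) ⟩
      e * (q ^ k * w n k)
          ≈⟨ solve 3 (λ a b c →
            a :* (b :* c)
            := b :* (con (+ 1) :* (a :* c)))
          refl e (q ^ k) (w n k) ⟩
      q ^ k * (1# * (e * w n k))    ∎
      where
      D = q ^ k * U (suc n) - q ^ suc n * U k
      e = q ^ (k ℕ.* k ℕ.+ k)
    g-< : ∀ n → n ℕ.< k → q ^ (k ℕ.* k ℕ.+ k) * w n k ≈ 0#
    g-< n n<k = trans (*-congˡ (w-< n<k)) (zeroʳ _)
    g-diag : q ^ (k ℕ.* k ℕ.+ k) * w k k ≈ gauss k k * w k k
    g-diag = *-congʳ (sym (trans (*-congˡ (trans (absorb (^-inverse k [1-q]*ρ≈1)) (reflexive (κ-diag k)))) (*-identityʳ _)))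
    q-step : ∀ n l → q ^ suc n * p ^ suc l * q ^ (suc l ℕ.* suc l ℕ.+ suc l) ≈ q ^ (l ℕ.* l ℕ.+ l) * (q * (q ^ suc n * q ^ l))
    q-step n l = begin
      q ^ suc n * p ^ suc l * q ^ (suc l ℕ.* suc l ℕ.+ suc l)
        ≡⟨ ≡.cong (λ e → q ^ suc n * p ^ suc l * q ^ e)
             (≡.trans (ℕₚ.+-assoc (suc l) (l ℕ.* suc l) (suc l)) (≡.cong (suc l ℕ.+_)
                (≡.trans (≡.cong (ℕ._+ suc l) (≡.trans (ℕₚ.*-suc l l) (ℕₚ.+-comm l (l ℕ.* l)))) (ℕₚ.+-comm (l ℕ.* l ℕ.+ l) (suc l))))) ⟩
      q ^ suc n * p ^ suc l * q ^ (suc l ℕ.+ (suc l ℕ.+ (l ℕ.* l ℕ.+ l)))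
        ≈⟨ *-congˡ (trans (q^-+ (suc l) _) (*-congˡ (q^-+ (suc l) _))) ⟩
      q ^ suc n * p ^ suc l * (q ^ suc l * (q ^ suc l * q ^ (l ℕ.* l ℕ.+ l)))
        ≈⟨ solve 4 (λ a b c d →
              a :* b :* (c :* (c :* d))
              := c :* b :* (d :* (a :* c)))
            refl (q ^ suc n) (p ^ suc l) (q ^ suc l) (q ^ (l ℕ.* l ℕ.+ l)) ⟩
      q ^ suc l * p ^ suc l * (q ^ (l ℕ.* l ℕ.+ l) * (q ^ suc n * q ^ suc l))
        ≈⟨ absorb (q^*p^ (suc l)) ⟩
      q ^ (l ℕ.* l ℕ.+ l) * (q ^ suc n * (q * q ^ l))
        ≈⟨ solve 4 (λ a b c d →
              d :* (b :* (a :* c))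
              := d :* (a :* (b :* c)))
            refl q (q ^ suc n) (q ^ l) (q ^ (l ℕ.* l ℕ.+ l)) ⟩
      q ^ (l ℕ.* l ℕ.+ l) * (q * (q ^ suc n * q ^ l)) ∎
    c-rec : ∀ n l → gauss (suc n) l * (U (suc n) - q ^ suc n * u l) + q ^ suc n * p ^ suc l * gauss (suc n) (suc l) ≈ 1# * gauss n l
    c-rec n l = begin
      e * (((1# - q) * o) * r * κ (suc n) l) * V + q ^ suc n * p ^ suc l * (e′ * (((1# - q) * o) * (ρ * r) * κ n l))
        ≈⟨ solve 11 (λ a b c d e f g h i j k →
              a :* (((c) :* d) :* e :* f) :* h :+ i :* j :* (b :* (((c) :* d) :* (k :* e) :* g))
              := a :* ((c) :* d :* e) :* (h :* f) :+ (i :* j :* b) :* ((c) :* d :* (k :* e) :* g))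
            refl e e′ (1# - q) o r (κ (suc n) l) (κ n l) V (q ^ suc n) (p ^ suc l) ρ ⟩
      e * ((1# - q) * o * r) * (V * κ (suc n) l) + (q ^ suc n * p ^ suc l * e′) * ((1# - q) * o * (ρ * r) * κ n l)
        ≈⟨ +-cong (*-congˡ (trans (U-diff*κ (suc n) l) (*-congʳ (⟦1++⟧ (suc n) l)))) (*-congʳ (q-step n l)) ⟩
      e * ((1# - q) * o * r) * ((1# - X) * ρ * κ n l) + e * X * ((1# - q) * o * (ρ * r) * κ n l)
        -- The contributions 1 - X and X of the two neighbouring coefficients add up to 1.
        ≈⟨ solve 7 (λ a b c d e f g →
              a :* ((b) :* e :* f) :* ((con (+ 1) :- d) :* c :* g) :+ a :* d :* ((b) :* e :* (c :* f) :* g)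
              := (b) :* c :* (con (+ 1) :* (a :* (e :* f :* g))))
            refl e (1# - q) ρ X o r (κ n l) ⟩
      (1# - q) * ρ * (1# * (e * (o * r * κ n l)))
        ≈⟨ absorb [1-q]*ρ≈1 ⟩
      1# * gauss n l ∎
      where
      e = q ^ (l ℕ.* l ℕ.+ l)
      e′ = q ^ (suc l ℕ.* suc l ℕ.+ suc l)
      o = (1# - q) ^ n
      r = ρ ^ l
      V = U (suc n) - q ^ suc n * u l
      X = q * (q ^ suc n * q ^ l)
    c-< : ∀ n l → n ℕ.< l → gauss n l ≈ 0#
    c-< n l n<l = trans (*-congˡ (trans (*-congˡ (reflexive (κ-< n<l))) (zeroʳ _))) (zeroʳ _)

-- Moments and admissible functions

module Moments (Q : QRing) (n : ℕ) where
  open QCalculus Q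
  open Expansions Q

  -- The positive integer of the theorem. Written as a successor, it lets `w⁻ N k` reduce to
  -- `w n k`.
  N : ℕ
  N = suc n

  -- One range of summation serves all orders: for m ≤ N the terms with k > m vanish through
  -- `w m k`.
  moment : ℕ → (ℕ → Carrier) → Carrier
  moment m f = ∑ (suc N) λ k → v k * w m k * f k

  -- `κ N m` is 1/[N-m]! and vanishes for m > N, so only the orders m ≤ N impose a condition.
  Admissible : (ℕ → Carrier) → Set
  Admissible f = ∀ m → Integral (fac N * fac m * κ N m * moment m f)

  int-zero : ∀ {x} → x ≈ 0# → Integral x
  int-zero e = int-≈ (sym e) int-0

  adm-≈ : ∀ {f g : ℕ → Carrier} → (∀ k → f k ≈ g k) → Admissible f → Admissible g
  adm-≈ e i m = int-≈ (*-congˡ (∑-cong (suc N) λ k → *-congˡ (e k))) (i m)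

  adm-+ : ∀ {f g} → Admissible f → Admissible g → Admissible (λ k → f k + g k)
  adm-+ {f} {g} i j m = int-≈ (begin
    z * moment m f + z * moment m g                     ≈⟨ distribˡ _ _ _ ⟨
    z * (moment m f + moment m g)                       ≈⟨ *-congˡ (∑-+ (suc N)) ⟨
    z * ∑ (suc N) (λ k → v k * w m k * f k + v k * w m k * g k)
      ≈⟨ *-congˡ (∑-cong (suc N) λ k → distribˡ (v k * w m k) (f k) (g k)) ⟨
    z * moment m (λ k → f k + g k)                      ∎) (int-+ (i m) (j m))
    where z = fac N * fac m * κ N m

  moment-* : ∀ m a {f : ℕ → Carrier} → moment m (λ k → a * f k) ≈ a * moment m f
  moment-* m a {f} = trans (∑-cong (suc N) term) (sym (*-∑ (suc N)))
    where
    term : ∀ k → v k * w m k * (a * f k) ≈ a * (v k * w m k * f k)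
    term k = begin
      v k * w m k * (a * f k)
          ≈⟨ solve 4 (λ a b c d →
            a :* b :* (c :* d)
            := c :* (a :* b :* d))
          refl (v k) (w m k) a (f k) ⟩
      a * (v k * w m k * f k)    ∎

  adm-* : ∀ a {f} → Integral a → Admissible f → Admissible (λ k → a * f k)
  adm-* a {f} ia i m = int-≈ (begin
    a * (z * moment m f)               ≈⟨ solve 3 (λ a b c → a :* (b :* c) := b :* (a :* c)) refl a z (moment m f) ⟩
    z * (a * moment m f)               ≈⟨ *-congˡ (moment-* m a) ⟨
    z * moment m (λ k → a * f k)       ∎) (int-* ia (i m))
    where z = fac N * fac m * κ N m

  moment-expand : ∀ {g c f : ℕ → Carrier} → (∀ k → g k ≈ ∑ (suc N) (λ l → c l * w l k)) →
    ∑ (suc N) (λ k → v k * g k * f k) ≈ ∑ (suc N) (λ l → c l * moment l f)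
  moment-expand {g} {c} {f} e = begin
    ∑ (suc N) (λ k → v k * g k * f k)
      ≈⟨ ∑-cong (suc N) term ⟩
    ∑ (suc N) (λ k → ∑ (suc N) (λ l → c l * (v k * w l k * f k)))
      ≈⟨ ∑-swap (suc N) (suc N) ⟩
    ∑ (suc N) (λ l → ∑ (suc N) (λ k → c l * (v k * w l k * f k)))
      ≈⟨ ∑-cong (suc N) (λ l → *-∑ (suc N)) ⟨
    ∑ (suc N) (λ l → c l * moment l f) ∎
    where
    swap-factors : ∀ k l → c l * w l k * (v k * f k) ≈ c l * (v k * w l k * f k)
    swap-factors k l = begin
      c l * w l k * (v k * f k)
          ≈⟨ solve 4 (λ a b c d →
            a :* b :* (c :* d)
            := a :* (c :* b :* d))
          refl (c l) (w l k) (v k) (f k) ⟩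
      c l * (v k * w l k * f k)      ∎
    term : ∀ k → v k * g k * f k ≈ ∑ (suc N) (λ l → c l * (v k * w l k * f k))
    term k = begin
      v k * g k * f k                                     ≈⟨ solve 3 (λ a b c → a :* b :* c := b :* (a :* c)) refl (v k) (g k) (f k) ⟩
      g k * (v k * f k)                                   ≈⟨ *-congʳ (e k) ⟩
      ∑ (suc N) (λ l → c l * w l k) * (v k * f k)         ≈⟨ ∑-* (suc N) ⟩
      ∑ (suc N) (λ l → c l * w l k * (v k * f k))         ≈⟨ ∑-cong (suc N) (swap-factors k) ⟩
      ∑ (suc N) (λ l → c l * (v k * w l k * f k))         ∎

  -- For m ≤ a this is a q-binomial coefficient with top c and lower parts a - m and b; for m > a it
  -- is zero.
  int-κι : ∀ a b c m → a ℕ.+ b ≡ c ℕ.+ m → Integral (fac c * (κ a m * ι b))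
  int-κι a b c m e with ℕₚ.≤-<-connex m a
  ... | inj₂ a<m = int-zero (trans (*-congˡ (trans (*-congʳ (reflexive (κ-< a<m))) (zeroˡ _))) (zeroʳ _))
  ... | inj₁ m≤a with ℕₚ.m≤n⇒∃[o]m+o≡n m≤a
  ... | i , ≡.refl = int-≈ (*-congˡ (*-congʳ (reflexive (≡.sym (κ-+ m i)))))
    (int-binomial i b (ℕₚ.+-cancelˡ-≡ m _ _ (≡.trans (≡.sym (ℕₚ.+-assoc m i b)) (≡.trans e (ℕₚ.+-comm c m)))))

  int-κι′ : ∀ m l → Integral (fac m * (κ m l * ι l))
  int-κι′ m l = int-κι m l m l ≡.refl

  -- By `u*w` the new moment of order m combines the old ones of orders m and m - 1, and the weight
  -- of order m is that of order m - 1 times [m] [N-m+1].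
  adm-u : ∀ {f} → Admissible f → Admissible (λ k → u k * f k)
  adm-u {f} i m = int-≈ (sym (begin
    z * moment m (λ k → u k * f k)
      ≈⟨ *-congˡ (∑-cong (suc N) term) ⟩
    z * ∑ (suc N) (λ k → u m * (v k * w m k * f k) + (- p ^ m) * (v k * w⁻ m k * f k))
      ≈⟨ *-congˡ (∑-+ (suc N)) ⟩
    z * (∑ (suc N) (λ k → u m * (v k * w m k * f k)) + ∑ (suc N) (λ k → (- p ^ m) * (v k * w⁻ m k * f k)))
      ≈⟨ *-congˡ (+-cong (*-∑ (suc N)) (*-∑ (suc N))) ⟨
    z * (u m * moment m f + (- p ^ m) * moment⁻)
      ≈⟨ solve 5 (λ a b c d e →
            a :* (b :* c :+ (d) :* e)
            := b :* (a :* c) :+ (d) :* (a :* e))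
          refl z (u m) (moment m f) (- p ^ m) moment⁻ ⟩
    u m * (z * moment m f) + (- p ^ m) * (z * moment⁻) ∎))
    (int-+ (int-* int-u (i m)) (int-* (int-neg (int-^ m int-p)) (lower m)))
    where
    z = fac N * fac m * κ N m
    moment⁻ = ∑ (suc N) λ k → v k * w⁻ m k * f k
    int-u : Integral (u m)
    int-u = int-* (int-^ m int-p) (int-* (int-⟦⟧ m) (int-⟦⟧ (suc m)))
    term : ∀ k → v k * w m k * (u k * f k) ≈ u m * (v k * w m k * f k) + (- p ^ m) * (v k * w⁻ m k * f k)
    term k = begin
      v k * w m k * (u k * f k)
          ≈⟨ solve 4 (λ a b c d →
            a :* b :* (c :* d)
            := a :* d :* (c :* b))
          refl (v k) (w m k) (u k) (f k) ⟩
      v k * f k * (u k * w m k)                                            ≈⟨ *-congˡ (u*w m k) ⟩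
      v k * f k * (u m * w m k - p ^ m * w⁻ m k)
          ≈⟨ solve 6 (λ a b c d e f →
            a :* b :* (c :* d :- e :* f)
            := c :* (a :* d :* b) :+ (con (+ 0) :- e) :* (a :* f :* b))
          refl (v k) (f k) (u m) (w m k) (p ^ m) (w⁻ m k) ⟩
      u m * (v k * w m k * f k) + (0# - p ^ m) * (v k * w⁻ m k * f k)      ≈⟨ +-congˡ (*-congʳ (+-identityˡ _)) ⟩
      u m * (v k * w m k * f k) + (- p ^ m) * (v k * w⁻ m k * f k)         ∎
    lower : ∀ m → Integral (fac N * fac m * κ N m * ∑ (suc N) (λ k → v k * w⁻ m k * f k))
    lower zero    = int-zero (trans (*-congˡ (∑-zero (suc N) λ k _ → trans (*-congʳ (trans (*-congˡ (zeroˡ _)) (zeroʳ _))) (zeroˡ _))) (zeroʳ _))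
    lower (suc m) = int-≈ (sym (begin
      fac N * (⟦ suc m ⟧ * fac m) * κ N (suc m) * moment m f
        ≈⟨ *-congʳ (*-congˡ (κ-suc N m)) ⟩
      fac N * (⟦ suc m ⟧ * fac m) * (E * κ N m) * moment m f
        ≈⟨ solve 6 (λ a b c d e f →
              a :* (b :* c) :* (d :* e) :* f
              := b :* d :* (a :* c :* e :* f))
            refl (fac N) (⟦ suc m ⟧) (fac m) E (κ N m) (moment m f) ⟩
      ⟦ suc m ⟧ * E * (fac N * fac m * κ N m * moment m f) ∎))
      (int-* (int-* (int-⟦⟧ (suc m)) (int-κ-factor N m)) (i m))
      where E = p ^ m * ((q ^ m - q ^ N) * ρ)

  T : ℕ → Carrier
  T k = v k * v k

  -- With X = q^(-k) + q^(k+1) one has v² = (X² - 4q) ρ² and X = 1 + q + (1-q)² u; substitution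
  -- yields these coefficients of u and u².
  α β : Carrier
  α = (1# + 1#) * (1# + q)
  β = (1# - q) * (1# - q)

  -- Under k -> -1-k the function u is invariant and v changes sign, so v² is again invariant and
  -- can be expressed through u.
  T-u : ∀ k → T k ≈ 1# + α * u k + β * (u k * u k)
  T-u k = begin
    v k * v k
      ≈⟨ *-cong v-form v-form ⟩
    (P - q * K) * ρ * ((P - q * K) * ρ)
      ≈⟨ solve 4 (λ a b c d →
            (a :- b :* c) :* d :* ((a :- b :* c) :* d)
            := ((a :+ b :* c) :* (a :+ b :* c) :- (con (+ 1) :+ con (+ 1) :+ con (+ 1) :+ con (+ 1)) :* b :* (c :* a)) :* (d :* d))
          refl P q K ρ ⟩
    ((P + q * K) * (P + q * K) - (1# + 1# + 1# + 1#) * q * (K * P)) * (ρ * ρ)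
      ≈⟨ *-congʳ (+-congˡ (-‿cong (*-congˡ (q^*p^ k)))) ⟩
    ((P + q * K) * (P + q * K) - (1# + 1# + 1# + 1#) * q * 1#) * (ρ * ρ)
      ≈⟨ solve 4 (λ a b c d →
            ((a :+ b :* c) :* (a :+ b :* c) :- (con (+ 1) :+ con (+ 1) :+ con (+ 1) :+ con (+ 1)) :* b :* con (+ 1)) :* (d :* d)
            := (con (+ 1) :- b) :* d :* ((con (+ 1) :- b) :* d) :+ (con (+ 1) :+ con (+ 1)) :* (con (+ 1) :+ b) :* ((a :- con (+ 1) :- b :+ b :* c) :* (d :* d)) :+ (a :- con (+ 1) :- b :+ b :* c) :* ((a :- con (+ 1) :- b :+ b :* c) :* (d :* d)))
          refl P q K ρ ⟩
    (1# - q) * ρ * ((1# - q) * ρ) + (1# + 1#) * (1# + q) * ((P - 1# - q + q * K) * (ρ * ρ)) + (P - 1# - q + q * K) * ((P - 1# - q + q * K) * (ρ * ρ))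
      ≈⟨ +-cong (+-cong (trans (absorb [1-q]*ρ≈1) [1-q]*ρ≈1) (*-congˡ (sym u-form))) (sym (trans (absorb [1-q]*ρ≈1) (absorb [1-q]*ρ≈1))) ⟩
    1# + α * u k + (1# - q) * ρ * ((1# - q) * ρ * ((P - 1# - q + q * K) * ((P - 1# - q + q * K) * (ρ * ρ))))
      ≈⟨ solve 6 (λ a b c d e f →
            con (+ 1) :+ a :* b :+ (con (+ 1) :- d) :* f :* ((con (+ 1) :- d) :* f :* ((c :- con (+ 1) :- d :+ d :* e) :* ((c :- con (+ 1) :- d :+ d :* e) :* (f :* f))))
            := con (+ 1) :+ a :* b :+ (con (+ 1) :- d) :* (con (+ 1) :- d) :* (((c :- con (+ 1) :- d :+ d :* e) :* (f :* f)) :* ((c :- con (+ 1) :- d :+ d :* e) :* (f :* f))))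
          refl α (u k) P q K ρ ⟩
    1# + α * u k + (1# - q) * (1# - q) * (((P - 1# - q + q * K) * (ρ * ρ)) * ((P - 1# - q + q * K) * (ρ * ρ)))
      ≈⟨ +-congˡ (*-congˡ (*-cong u-form u-form)) ⟨
    1# + α * u k + β * (u k * u k) ∎
    where
    P = p ^ k
    K = q ^ k
    v-form : v k ≈ (P - q * K) * ρ
    v-form = begin
      P * ⟦ suc (k ℕ.+ k) ⟧                   ≈⟨ *-congˡ (⟦1++⟧ k k) ⟩
      P * ((1# - q * (K * K)) * ρ)
          ≈⟨ solve 4 (λ a b c d →
            a :* ((con (+ 1) :- b :* (c :* c)) :* d)
            := (a :- c :* a :* (b :* c)) :* d)
          refl P q K ρ ⟩
      (P - K * P * (q * K)) * ρ               ≈⟨ *-congʳ (+-congˡ (-‿cong (absorb (q^*p^ k)))) ⟩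
      (P - q * K) * ρ                         ∎
    u-form : u k ≈ (P - 1# - q + q * K) * (ρ * ρ)
    u-form = begin
      P * ((1# - K) * ρ * ((1# - q * K) * ρ))
          ≈⟨ solve 4 (λ a b c d →
            a :* ((con (+ 1) :- c) :* d :* ((con (+ 1) :- b :* c) :* d))
            := (a :- c :* a :- b :* (c :* a) :+ b :* (c :* a :* c)) :* (d :* d))
          refl P q K ρ ⟩
      (P - K * P - q * (K * P) + q * (K * P * K)) * (ρ * ρ)
        ≈⟨ *-congʳ (+-cong (+-cong (+-congˡ (-‿cong (q^*p^ k))) (-‿cong (trans (*-congˡ (q^*p^ k)) (*-identityʳ q)))) (*-congˡ (absorb (q^*p^ k)))) ⟩
      (P - 1# - q + q * K) * (ρ * ρ)                        ∎

  int-α : Integral α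
  int-α = int-* (int-+ int-1 int-1) (int-+ int-1 int-q)

  int-β : Integral β
  int-β = int-* (int-+ int-1 (int-neg int-q)) (int-+ int-1 (int-neg int-q))

  adm-T : ∀ {f} → Admissible f → Admissible (λ k → T k * f k)
  adm-T {f} i = adm-≈ eq (adm-+ (adm-+ i (adm-* α int-α (adm-u i))) (adm-* β int-β (adm-u (adm-u i))))
    where
    eq : ∀ k → f k + α * (u k * f k) + β * (u k * (u k * f k)) ≈ T k * f k
    eq k = begin
      f k + α * (u k * f k) + β * (u k * (u k * f k))
          ≈⟨ solve 4 (λ a b c d →
            a :+ b :* (d :* a) :+ c :* (d :* (d :* a))
            := (con (+ 1) :+ b :* d :+ c :* (d :* d)) :* a)
          refl (f k) α β (u k) ⟩
      (1# + α * u k + β * (u k * u k)) * f k             ≈⟨ *-congʳ (T-u k) ⟨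
      T k * f k                                          ∎

  -- The divided difference of T N and T k with respect to u N and u k, for the quadratic polynomial
  -- in `T-u`.
  cofactor : ℕ → Carrier
  cofactor k = α + β * (u N + u k)

  -- The first summand carries [2N+1]² inside `T N`. In the second, u N - u k has lowered the kernel
  -- to index n, where [2N]! is enough. `x` is the rest of the summand.
  T*w : ∀ k x → T k * (w N k * x) ≈ T N * (w N k * x) - p ^ N * (cofactor k * (w n k * x))
  T*w k x = begin
    T k * (w N k * x)
      ≈⟨ *-congʳ (T-u k) ⟩
    (1# + α * u k + β * (u k * u k)) * (w N k * x)
      ≈⟨ solve 6 (λ a b c d e f →
            (con (+ 1) :+ a :* c :+ b :* (c :* c)) :* (e :* f)
            := (con (+ 1) :+ a :* d :+ b :* (d :* d)) :* (e :* f) :- (a :+ b :* (d :+ c)) :* f :* (d :* e :- c :* e))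
          refl α β (u k) (u N) (w N k) x ⟩
    (1# + α * u N + β * (u N * u N)) * (w N k * x) - (α + β * (u N + u k)) * x * (u N * w N k - u k * w N k)
      ≈⟨ +-cong (*-congʳ (sym (T-u N))) (-‿cong (*-congˡ (+-congˡ (-‿cong (u*w N k))))) ⟩
    T N * (w N k * x) - cofactor k * x * (u N * w N k - (u N * w N k - p ^ N * w n k))
      ≈⟨ solve 7 (λ a b c d e f g →
            a :* (b :* c) :- d :* c :* (e :* b :- (e :* b :- f :* g))
            := a :* (b :* c) :- f :* (d :* (g :* c)))
          refl (T N) (w N k) x (cofactor k) (u N) (p ^ N) (w n k) ⟩
    T N * (w N k * x) - p ^ N * (cofactor k * (w n k * x)) ∎

  adm-cofactor : ∀ {f} → Admissible f → Admissible (λ k → cofactor k * f k)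
  adm-cofactor {f} i = adm-≈ eq (adm-+ (adm-* (α + β * u N) (int-+ int-α (int-* int-β int-uN)) i) (adm-* β int-β (adm-u i)))
    where
    int-uN : Integral (u N)
    int-uN = int-* (int-^ N int-p) (int-* (int-⟦⟧ N) (int-⟦⟧ (suc N)))
    eq : ∀ k → (α + β * u N) * f k + β * (u k * f k) ≈ cofactor k * f k
    eq k = begin
      (α + β * u N) * f k + β * (u k * f k)
          ≈⟨ solve 5 (λ a b c d e →
            (a :+ b :* c) :* e :+ b :* (d :* e)
            := (a :+ b :* (c :+ d)) :* e)
          refl α β (u N) (u k) (f k) ⟩
      (α + β * (u N + u k)) * f k              ∎

  moment-w : ∀ i m f → i ℕ.≤ N →
    fac (suc (i ℕ.+ m)) * moment m (λ k → w i k * f k) ≈ ∑ (suc N) (λ l → powers i m l * (κ i l * κ m l) * moment l f)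
  moment-w i m f i≤N = begin
    fac (suc (i ℕ.+ m)) * moment m (λ k → w i k * f k)
      ≈⟨ *-∑ (suc N) ⟩
    ∑ (suc N) (λ k → fac (suc (i ℕ.+ m)) * (v k * w m k * (w i k * f k)))
      ≈⟨ ∑-cong (suc N) term ⟩
    ∑ (suc N) (λ k → v k * (fac (suc (i ℕ.+ m)) * (w i k * w m k)) * f k)
      ≈⟨ moment-expand (λ k → w*w N i m k i≤N) ⟩
    ∑ (suc N) (λ l → powers i m l * (κ i l * κ m l) * moment l f) ∎
    where
    term : ∀ k → fac (suc (i ℕ.+ m)) * (v k * w m k * (w i k * f k)) ≈ v k * (fac (suc (i ℕ.+ m)) * (w i k * w m k)) * f k
    term k = begin
      fac (suc (i ℕ.+ m)) * (v k * w m k * (w i k * f k))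
          ≈⟨ solve 5 (λ a b c d e →
            a :* (b :* c :* (d :* e))
            := b :* (a :* (d :* c)) :* e)
          refl (fac (suc (i ℕ.+ m))) (v k) (w m k) (w i k) (f k) ⟩
      v k * (fac (suc (i ℕ.+ m)) * (w i k * w m k)) * f k    ∎

  int-*-∑ : ∀ {a x} {c : ℕ → Carrier} → x ≈ ∑ (suc N) c → (∀ l → Integral (a * c l)) → Integral (a * x)
  int-*-∑ e i = int-≈ (sym (trans (*-congˡ e) (*-∑ (suc N)))) (int-∑ (suc N) i)

  -- Multiplication of an admissible function by w N trades the factor κ N m
  -- for the larger fac (suc (N + m)).
  Lifted : (ℕ → Carrier) → Set
  Lifted f = ∀ m → Integral (fac N * fac m * (fac (suc (N ℕ.+ m)) * moment m f))

  -- In the expansion of the product of kernels, `κ N l` supplies the weight of order l, and `κ m l`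
  -- becomes a q-binomial coefficient of m over l.
  lift-w : ∀ {f} → Admissible f → Lifted (λ k → w N k * f k)
  lift-w {f} i m = int-*-∑ (moment-w N m f ℕₚ.≤-refl) λ l → int-≈ (sym (eq l))
    (int-* (int-* (int-powers N m l) (int-κι′ m l)) (i l))
    where
    eq : ∀ l → fac N * fac m * (powers N m l * (κ N l * κ m l) * moment l f)
             ≈ powers N m l * (fac m * (κ m l * ι l)) * (fac N * fac l * κ N l * moment l f)
    eq l = begin
      fac N * fac m * (powers N m l * (κ N l * κ m l) * moment l f)
        -- Inserting [l]! / [l]! completes the weight of order l and that q-binomial coefficient at
        -- the same time.
        ≈⟨ absorb (fac*ι l) ⟨
      fac l * ι l * (fac N * fac m * (powers N m l * (κ N l * κ m l) * moment l f))
        ≈⟨ solve 8 (λ a b c d e f g h →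
              a :* b :* (c :* d :* (e :* (f :* g) :* h))
              := e :* (d :* (g :* b)) :* (c :* a :* f :* h))
            refl (fac l) (ι l) (fac N) (fac m) (powers N m l) (κ N l) (κ m l) (moment l f) ⟩
      powers N m l * (fac m * (κ m l * ι l)) * (fac N * fac l * κ N l * moment l f) ∎

  -- [2N+1]! divided by [N-m]! [N+m+1]! is a q-binomial coefficient; this is where one factor [2N+1]
  -- too many is spent.
  adm-lifted : ∀ {f} → Lifted f → Admissible (λ k → fac (suc (N ℕ.+ N)) * f k)
  adm-lifted {f} i m = int-≈ (sym (begin
    fac N * fac m * κ N m * moment m (λ k → fac (suc (N ℕ.+ N)) * f k)
      ≈⟨ *-congˡ (moment-* m _) ⟩
    fac N * fac m * κ N m * (F * moment m f)
      ≈⟨ absorb (fac*ι (suc (N ℕ.+ m))) ⟨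
    G * I * (fac N * fac m * κ N m * (F * moment m f))
      ≈⟨ solve 7 (λ a b c d e f g →
            a :* b :* (c :* d :* e :* (f :* g))
            := f :* (e :* b) :* (c :* d :* (a :* g)))
          refl G I (fac N) (fac m) (κ N m) F (moment m f) ⟩
    F * (κ N m * I) * (fac N * fac m * (G * moment m f)) ∎))
    (int-* (int-κι N (suc (N ℕ.+ m)) (suc (N ℕ.+ N)) m (≡.trans (ℕₚ.+-suc N _) (≡.cong suc (≡.sym (ℕₚ.+-assoc N N m))))) (i m))
    where
    F = fac (suc (N ℕ.+ N))
    G = fac (suc (N ℕ.+ m))
    I = ι (suc (N ℕ.+ m))

  adm-w : ∀ {f} → Admissible f → Admissible (λ k → fac (suc (N ℕ.+ N)) * (w N k * f k))
  adm-w i = adm-lifted (lift-w i)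

  F₂ : Carrier
  F₂ = fac (N ℕ.+ N)

  -- For the kernel of index n the product expansion needs only [N+m]!, so [2N]! suffices and leaves
  -- a q-binomial coefficient of 2N over N - m. The scalar `a` is 1 or `F₂`.
  adm-w⁻-from : ∀ {a f} → (∀ m l → Integral (fac N * fac m * a * (powers n m l * (κ n l * κ m l) * moment l f))) →
                Admissible (λ k → a * (F₂ * (w n k * f k)))
  adm-w⁻-from {a} {f} i m = int-≈ (sym (begin
    fac N * fac m * κ N m * moment m (λ k → a * (F₂ * (w n k * f k)))
      ≈⟨ *-congˡ (trans (moment-* m a) (*-congˡ (moment-* m F₂))) ⟩
    fac N * fac m * κ N m * (a * (F₂ * X))
      ≈⟨ absorb (fac*ι (N ℕ.+ m)) ⟨
    fac (N ℕ.+ m) * ι (N ℕ.+ m) * (fac N * fac m * κ N m * (a * (F₂ * X)))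
      ≈⟨ solve 8 (λ a b c d e f g h →
            a :* b :* (c :* d :* e :* (f :* (g :* h)))
            := g :* (e :* b) :* (c :* d :* f :* (a :* h)))
          refl (fac (N ℕ.+ m)) (ι (N ℕ.+ m)) (fac N) (fac m) (κ N m) a F₂ X ⟩
    F₂ * (κ N m * ι (N ℕ.+ m)) * (fac N * fac m * a * (fac (N ℕ.+ m) * X)) ∎))
    (int-* (int-κι N (N ℕ.+ m) (N ℕ.+ N) m (≡.sym (ℕₚ.+-assoc N N m)))
           (int-*-∑ (moment-w n m f (ℕₚ.n≤1+n n)) (i m)))
    where X = moment m (λ k → w n k * f k)

  adm-w⁻ : ∀ {f} → Admissible f → Admissible (λ k → F₂ * (w n k * f k))
  adm-w⁻ {f} i = adm-≈ (λ k → *-identityˡ _) (adm-w⁻-from λ m l → int-≈ (sym (eq m l))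
    (int-* (int-* (int-* (int-powers n m l) (int-κ-factor N l)) (int-κι′ m l)) (i l)))
    where
    eq : ∀ m l → fac N * fac m * 1# * (powers n m l * (κ n l * κ m l) * moment l f)
               ≈ powers n m l * (p ^ l * ((q ^ l - q ^ N) * ρ)) * (fac m * (κ m l * ι l)) * (fac N * fac l * κ N l * moment l f)
    eq m l = begin
      fac N * fac m * 1# * (powers n m l * (κ n l * κ m l) * moment l f)
        -- `κ n l` is `κ N (suc l)` by definition, hence a Laurent multiple of the `κ N l` that the
        -- weight requires.
        ≈⟨ *-congˡ (*-congʳ (*-congˡ (*-congʳ (κ-suc N l)))) ⟩
      fac N * fac m * 1# * (powers n m l * (E * κ N l * κ m l) * moment l f)
        ≈⟨ absorb (fac*ι l) ⟨
      fac l * ι l * (fac N * fac m * 1# * (powers n m l * (E * κ N l * κ m l) * moment l f))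
        ≈⟨ solve 9 (λ a b c d e f g h i →
              a :* b :* (c :* d :* con (+ 1) :* (e :* (f :* g :* h) :* i))
              := e :* f :* (d :* (h :* b)) :* (c :* a :* g :* i))
            refl (fac l) (ι l) (fac N) (fac m) (powers n m l) E (κ N l) (κ m l) (moment l f) ⟩
      powers n m l * E * (fac m * (κ m l * ι l)) * (fac N * fac l * κ N l * moment l f) ∎
      where E = p ^ l * ((q ^ l - q ^ N) * ρ)

  -- The lifted f brings [N+l+1]! where the weight would have `κ N l`; against `F₂` and `κ n l` this
  -- leaves a q-binomial coefficient of 2N over n - l. Thus the pair `w N`, `w n` costs only [2N]!
  -- twice, although `adm-w` by itself costs [2N+1]!.
  adm-w⁻-lifted : ∀ {f} → Lifted f → Admissible (λ k → F₂ * (F₂ * (w n k * f k)))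
  adm-w⁻-lifted {f} i = adm-w⁻-from λ m l → int-≈ (sym (eq m l))
    (int-* (int-* (int-* (int-powers n m l) (int-κι′ m l))
      (int-κι n (suc (N ℕ.+ l)) (N ℕ.+ N) l (≡.trans (ℕₚ.+-suc n _) (≡.sym (ℕₚ.+-assoc N N l))))) (i l))
    where
    eq : ∀ m l → fac N * fac m * F₂ * (powers n m l * (κ n l * κ m l) * moment l f)
               ≈ powers n m l * (fac m * (κ m l * ι l)) * (F₂ * (κ n l * ι (suc (N ℕ.+ l)))) * (fac N * fac l * (fac (suc (N ℕ.+ l)) * moment l f))
    eq m l = begin
      fac N * fac m * F₂ * (powers n m l * (κ n l * κ m l) * moment l f)
        ≈⟨ trans (absorb (fac*ι l)) (absorb (fac*ι (suc (N ℕ.+ l)))) ⟨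
      fac l * ι l * (G * I * (fac N * fac m * F₂ * (powers n m l * (κ n l * κ m l) * moment l f)))
        ≈⟨ solve 11 (λ a b c d e f g h i j k →
              a :* b :* (c :* d :* (e :* f :* g :* (h :* (i :* j) :* k)))
              := h :* (f :* (j :* b)) :* (g :* (i :* d)) :* (e :* a :* (c :* k)))
            refl (fac l) (ι l) G I (fac N) (fac m) F₂ (powers n m l) (κ n l) (κ m l) (moment l f) ⟩
      powers n m l * (fac m * (κ m l * ι l)) * (F₂ * (κ n l * I)) * (fac N * fac l * (G * moment l f)) ∎
      where
      G = fac (suc (N ℕ.+ l))
      I = ι (suc (N ℕ.+ l))

  -- For k ≤ N the ballot number is q^N `v k` `ω k`.
  ω : ℕ → Carrier
  ω k = F₂ * w N k

  int-vN : Integral (v N)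
  int-vN = int-* (int-^ N int-p) (int-⟦⟧ (suc (N ℕ.+ N)))

  -- One of the two factors [2N+1] of `T N` extends `F₂` to [2N+1]!, as `adm-w` wants; the other
  -- stays behind in `v N`.
  adm-Tω : ∀ {f} → Admissible f → Admissible (λ k → T k * (ω k * f k))
  adm-Tω {f} i = adm-≈ eq (adm-+ (adm-* (v N * p ^ N) (int-* int-vN (int-^ N int-p)) (adm-w i))
    (adm-* (- p ^ N) (int-neg (int-^ N int-p)) (adm-cofactor (adm-w⁻ i))))
    where
    eq : ∀ k → v N * p ^ N * (⟦ suc (N ℕ.+ N) ⟧ * F₂ * (w N k * f k)) + (- p ^ N) * (cofactor k * (F₂ * (w n k * f k))) ≈ T k * (F₂ * w N k * f k)
    eq k = begin
      v N * p ^ N * (⟦ suc (N ℕ.+ N) ⟧ * F₂ * (w N k * f k)) + (- p ^ N) * (cofactor k * (F₂ * (w n k * f k)))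
        ≈⟨ +-congˡ (*-congʳ (+-identityˡ _)) ⟨
      v N * p ^ N * (⟦ suc (N ℕ.+ N) ⟧ * F₂ * (w N k * f k)) + (0# - p ^ N) * (cofactor k * (F₂ * (w n k * f k)))
        ≈⟨ solve 8 (λ a b c d e f g h →
              a :* b :* (c :* d :* (e :* f)) :+ (con (+ 0) :- b) :* (g :* (d :* (h :* f)))
              := a :* (b :* c) :* (e :* (d :* f)) :- b :* (g :* (h :* (d :* f))))
            refl (v N) (p ^ N) (⟦ suc (N ℕ.+ N) ⟧) F₂ (w N k) (f k) (cofactor k) (w n k) ⟩
      v N * (p ^ N * ⟦ suc (N ℕ.+ N) ⟧) * (w N k * (F₂ * f k)) - p ^ N * (cofactor k * (w n k * (F₂ * f k)))
        ≈⟨ T*w k (F₂ * f k) ⟨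
      T k * (w N k * (F₂ * f k))
        ≈⟨ solve 4 (λ a b c d →
              a :* (b :* (c :* d))
              := a :* (c :* b :* d))
            refl (T k) (w N k) F₂ (f k) ⟩
      T k * (F₂ * w N k * f k) ∎

  -- Both factors [2N+1] of `T N` are consumed, one for each ω; the remainder is a product of
  -- kernels of index n and N, covered by `adm-w⁻-lifted`.
  adm-Tωω : ∀ {f} → Admissible f → Admissible (λ k → T k * (ω k * (ω k * f k)))
  adm-Tωω {f} i = adm-≈ eq (adm-+ (adm-* (p ^ N * p ^ N) (int-* (int-^ N int-p) (int-^ N int-p)) (adm-w (adm-w i)))
    (adm-* (- p ^ N) (int-neg (int-^ N int-p)) (adm-cofactor (adm-w⁻-lifted (lift-w i)))))
    where
    eq : ∀ k → p ^ N * p ^ N * (⟦ suc (N ℕ.+ N) ⟧ * F₂ * (w N k * (⟦ suc (N ℕ.+ N) ⟧ * F₂ * (w N k * f k)))) + (- p ^ N) * (cofactor k * (F₂ * (F₂ * (w n k * (w N k * f k)))))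
             ≈ T k * (ω k * (ω k * f k))
    eq k = begin
      p ^ N * p ^ N * (⟦ suc (N ℕ.+ N) ⟧ * F₂ * (w N k * (⟦ suc (N ℕ.+ N) ⟧ * F₂ * (w N k * f k)))) + (- p ^ N) * (cofactor k * (F₂ * (F₂ * (w n k * (w N k * f k)))))
        ≈⟨ +-congˡ (*-congʳ (+-identityˡ _)) ⟨
      p ^ N * p ^ N * (⟦ suc (N ℕ.+ N) ⟧ * F₂ * (w N k * (⟦ suc (N ℕ.+ N) ⟧ * F₂ * (w N k * f k)))) + (0# - p ^ N) * (cofactor k * (F₂ * (F₂ * (w n k * (w N k * f k)))))
        ≈⟨ solve 7 (λ a b c d e f g →
              a :* a :* (b :* c :* (d :* (b :* c :* (d :* e)))) :+ (con (+ 0) :- a) :* (f :* (c :* (c :* (g :* (d :* e)))))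
              := a :* b :* (a :* b) :* (d :* (c :* c :* d :* e)) :- a :* (f :* (g :* (c :* c :* d :* e))))
            refl (p ^ N) (⟦ suc (N ℕ.+ N) ⟧) F₂ (w N k) (f k) (cofactor k) (w n k) ⟩
      p ^ N * ⟦ suc (N ℕ.+ N) ⟧ * (p ^ N * ⟦ suc (N ℕ.+ N) ⟧) * (w N k * (F₂ * F₂ * w N k * f k)) - p ^ N * (cofactor k * (w n k * (F₂ * F₂ * w N k * f k)))
        ≈⟨ T*w k (F₂ * F₂ * w N k * f k) ⟨
      T k * (w N k * (F₂ * F₂ * w N k * f k))
        ≈⟨ solve 4 (λ a b c d →
              a :* (b :* (c :* c :* b :* d))
              := a :* (c :* b :* (c :* b :* d)))
            refl (T k) (w N k) F₂ (f k) ⟩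
      T k * (F₂ * w N k * (F₂ * w N k * f k)) ∎

  -- Each factor T takes up at most two factors ω, whence the bound on b.
  adm-powers : ∀ a b {f} → b ℕ.≤ a ℕ.+ a → Admissible f → Admissible (λ k → T k ^ a * (ω k ^ b * f k))
  adm-powers zero    zero          b≤ i = adm-≈ (λ k → sym (trans (*-identityˡ _) (*-identityˡ _))) i
  adm-powers (suc a) zero          b≤ i = adm-≈ (λ k → sym (*-assoc _ _ _)) (adm-T (adm-powers a 0 z≤n i))
  adm-powers (suc a) (suc zero)    {f} b≤ i = adm-≈ eq (adm-Tω (adm-powers a 0 z≤n i))
    where
    eq : ∀ k → T k * (ω k * (T k ^ a * (1# * f k))) ≈ T k * T k ^ a * (ω k * 1# * f k)
    eq k = begin
      T k * (ω k * (T k ^ a * (1# * f k)))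
          ≈⟨ solve 4 (λ a b c d →
            a :* (b :* (c :* (con (+ 1) :* d)))
            := a :* c :* (b :* con (+ 1) :* d))
          refl (T k) (ω k) (T k ^ a) (f k) ⟩
      T k * T k ^ a * (ω k * 1# * f k)           ∎
  adm-powers (suc a) (suc (suc b)) {f} b≤ i = adm-≈ eq (adm-Tωω (adm-powers a b (ℕₚ.≤-pred (ℕₚ.≤-pred (ℕₚ.≤-trans b≤ (ℕₚ.≤-reflexive (≡.cong suc (ℕₚ.+-suc a a)))))) i))
    where
    eq : ∀ k → T k * (ω k * (ω k * (T k ^ a * (ω k ^ b * f k)))) ≈ T k * T k ^ a * (ω k * (ω k * ω k ^ b) * f k)
    eq k = begin
      T k * (ω k * (ω k * (T k ^ a * (ω k ^ b * f k))))
          ≈⟨ solve 5 (λ a b c d e →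
            a :* (b :* (b :* (c :* (d :* e))))
            := a :* c :* (b :* (b :* d) :* e))
          refl (T k) (ω k) (T k ^ a) (ω k ^ b) (f k) ⟩
      T k * T k ^ a * (ω k * (ω k * ω k ^ b) * f k)           ∎

-- Starting functions and divisibility by the central coefficient

module Divisibility (Q : QRing) (n : ℕ) where
  open QCalculus Q
  open Expansions Q
  open Moments Q n

  -- As long as l + i ≤ N, the ratio [N-l]! / [N-l-i]! is a product of i q-integers; beyond that one
  -- of the factors vanishes.
  κ-ratio : ∀ l i → Σ Carrier λ E → Integral E × κ N (i ℕ.+ l) ≈ E * κ N l
  κ-ratio l zero    = 1# , int-1 , sym (*-identityˡ _)
  κ-ratio l (suc i) with κ-ratio l i
  ... | E , int-E , e = E′ * E , int-* (int-κ-factor N (i ℕ.+ l)) int-E ,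
    trans (κ-suc N (i ℕ.+ l)) (trans (*-congˡ e) (sym (*-assoc _ _ _)))
    where E′ = p ^ (i ℕ.+ l) * ((q ^ (i ℕ.+ l) - q ^ N) * ρ)

  adm-cases : ∀ {f} → (∀ m → m ℕ.≤ N → Integral (fac N * fac m * κ N m * moment m f)) → Admissible f
  adm-cases i m with ℕₚ.≤-<-connex m N
  ... | inj₁ m≤N = i m m≤N
  ... | inj₂ N<m = int-zero (trans (*-congʳ (trans (*-congˡ (reflexive (κ-< N<m))) (zeroʳ _))) (zeroˡ _))

  -- The ratio of the weights of orders m and l is [m]! / [l]! times the integral factor of
  -- `κ-ratio`. The denominator [m-l]! in `gauss m l` completes the former to a q-binomial
  -- coefficient, and (1-q)^(m-l) is harmless.
  adm-q^k²+k : ∀ {f} → Admissible f → Admissible (λ k → q ^ (k ℕ.* k ℕ.+ k) * f k)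
  adm-q^k²+k {f} i = adm-cases λ m m≤N → int-*-∑ (expanded m m≤N) (term m)
    where
    expanded : ∀ m → m ℕ.≤ N → moment m (λ k → q ^ (k ℕ.* k ℕ.+ k) * f k) ≈ ∑ (suc N) (λ l → gauss m l * moment l f)
    expanded m m≤N = trans (∑-cong (suc N) regroup) (moment-expand (λ k → q^k²+k*w N m k m≤N))
      where
      regroup : ∀ k → v k * w m k * (q ^ (k ℕ.* k ℕ.+ k) * f k) ≈ v k * (q ^ (k ℕ.* k ℕ.+ k) * w m k) * f k
      regroup k = begin
        v k * w m k * (q ^ (k ℕ.* k ℕ.+ k) * f k)
            ≈⟨ solve 4 (λ a b c d →
              a :* b :* (c :* d)
              := a :* (c :* b) :* d)
            refl (v k) (w m k) (q ^ (k ℕ.* k ℕ.+ k)) (f k) ⟩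
        v k * (q ^ (k ℕ.* k ℕ.+ k) * w m k) * f k    ∎
    term : ∀ m l → Integral (fac N * fac m * κ N m * (gauss m l * moment l f))
    term m l with ℕₚ.≤-<-connex l m
    ... | inj₂ m<l = int-zero (trans (*-congˡ (trans (*-congʳ (trans (*-congˡ (trans (*-congˡ (reflexive (κ-< m<l))) (zeroʳ _))) (zeroʳ _))) (zeroˡ _))) (zeroʳ _))
    ... | inj₁ l≤m with ℕₚ.m≤n⇒∃[o]m+o≡n l≤m
    -- The order becomes j + l, the index to which the recursion of `κ-ratio` on j applies.
    ... | j , ≡.refl rewrite ℕₚ.+-comm l j with κ-ratio l j
    ... | E , int-E , e = int-≈ (sym eq)
      (int-* (int-* (int-* (int-* (int-^ (l ℕ.* l ℕ.+ l) int-q) (int-^ j (int-+ int-1 (int-neg int-q)))) int-E) (int-κι′ (j ℕ.+ l) l)) (i l))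
      where
      M = j ℕ.+ l
      e² = q ^ (l ℕ.* l ℕ.+ l)
      eq : fac N * fac M * κ N M * (gauss M l * moment l f)
         ≈ q ^ (l ℕ.* l ℕ.+ l) * (1# - q) ^ j * E * (fac M * (κ M l * ι l)) * (fac N * fac l * κ N l * moment l f)
      eq = begin
        fac N * fac M * κ N M * (e² * ((1# - q) ^ M * ρ ^ l * κ M l) * moment l f)
          ≈⟨ *-cong (*-congˡ e) (*-congʳ (*-congˡ (*-congʳ (*-congʳ (^-homo-* (1# - q) j l))))) ⟩
        fac N * fac M * (E * κ N l) * (e² * ((1# - q) ^ j * (1# - q) ^ l * ρ ^ l * κ M l) * moment l f)
          ≈⟨ absorb (fac*ι l) ⟨
        fac l * ι l * (fac N * fac M * (E * κ N l) * (e² * ((1# - q) ^ j * (1# - q) ^ l * ρ ^ l * κ M l) * moment l f))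
          ≈⟨ solve 12 (λ a b c d e f g h i j k l →
                a :* b :* (c :* d :* (e :* f) :* (g :* (h :* i :* j :* k) :* l))
                := i :* j :* (g :* h :* e :* (d :* (k :* b)) :* (c :* a :* f :* l)))
              refl (fac l) (ι l) (fac N) (fac M) E (κ N l) e² ((1# - q) ^ j) ((1# - q) ^ l) (ρ ^ l) (κ M l) (moment l f) ⟩
        (1# - q) ^ l * ρ ^ l * (e² * (1# - q) ^ j * E * (fac M * (κ M l * ι l)) * (fac N * fac l * κ N l * moment l f))
          ≈⟨ absorb (^-inverse l [1-q]*ρ≈1) ⟩
        e² * (1# - q) ^ j * E * (fac M * (κ M l * ι l)) * (fac N * fac l * κ N l * moment l f) ∎

  -- The moment telescopes to q^(-m) / [m]!², so the weight leaves q^(-m) times the q-binomial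
  -- coefficient of N over m.
  adm-1 : Admissible (λ _ → 1#)
  adm-1 = adm-cases λ m m≤N → int-≈ (eq m m≤N) (int-* (int-^ m int-p) (int-κι N m N m ≡.refl))
    where
    sum : ∀ m → m ℕ.≤ N → q ^ m * moment m (λ _ → 1#) ≈ ι m * ι m
    sum m m≤N = begin
      q ^ m * moment m (λ _ → 1#)
        ≈⟨ *-∑ (suc N) ⟩
      ∑ (suc N) (λ k → q ^ m * (v k * w m k * 1#))
        ≈⟨ ∑-cong (suc N) (κι-diff m) ⟨
      ∑ (suc N) (λ k → κ m k * ι (m ℕ.+ k) - κ m (suc k) * ι (m ℕ.+ suc k))
        ≈⟨ ∑-telescope (suc N) {λ k → κ m k * ι (m ℕ.+ k)} ⟩
      ι m * ι (m ℕ.+ 0) - κ m (suc N) * ι (m ℕ.+ suc N)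
        ≈⟨ +-cong (*-congˡ (reflexive (≡.cong ι (ℕₚ.+-identityʳ m)))) (-‿cong (*-congʳ (reflexive (κ-< (s≤s m≤N))))) ⟩
      ι m * ι m - 0# * ι (m ℕ.+ suc N)
        ≈⟨ solve 2 (λ a b → a :* a :- con (+ 0) :* b := a :* a) refl (ι m) (ι (m ℕ.+ suc N)) ⟩
      ι m * ι m ∎
    eq : ∀ m → m ℕ.≤ N → p ^ m * (fac N * (κ N m * ι m)) ≈ fac N * fac m * κ N m * moment m (λ _ → 1#)
    eq m m≤N = begin
      p ^ m * (fac N * (κ N m * ι m))
        ≈⟨ absorb (fac*ι m) ⟨
      fac m * ι m * (p ^ m * (fac N * (κ N m * ι m)))
        ≈⟨ solve 5 (λ a b c d e →
              a :* b :* (c :* (d :* (e :* b)))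
              := d :* a :* e :* (c :* (b :* b)))
            refl (fac m) (ι m) (p ^ m) (fac N) (κ N m) ⟩
      fac N * fac m * κ N m * (p ^ m * (ι m * ι m))
        ≈⟨ *-congˡ (*-congˡ (sum m m≤N)) ⟨
      fac N * fac m * κ N m * (p ^ m * (q ^ m * moment m (λ _ → 1#)))
        ≈⟨ solve 6 (λ a b c d e f →
              c :* a :* d :* (b :* (e :* f))
              := e :* b :* (c :* a :* d :* f))
            refl (fac m) (p ^ m) (fac N) (κ N m) (q ^ m) (moment m (λ _ → 1#)) ⟩
      q ^ m * p ^ m * (fac N * fac m * κ N m * moment m (λ _ → 1#))
        ≈⟨ absorb (q^*p^ m) ⟩
      fac N * fac m * κ N m * moment m (λ _ → 1#) ∎

  -- (-1)^k q^(k(k+1)/2)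
  alt : ℕ → Carrier
  alt zero    = 1#
  alt (suc k) = - (q ^ suc k * alt k)

  -- An antidifference, up to [l], of the summand of the moment of `alt`. It vanishes at k = 0
  -- through [k] and for k > l through κ.
  alt-term : ℕ → ℕ → Carrier
  alt-term l k = p ^ k * alt k * ⟦ k ⟧ * (κ l k * ι (l ℕ.+ k))

  -- Up to common factors this is [k] [l+k+1] + q^k [k+1] [l-k] = [l] [2k+1].
  alt-diff : ∀ l k → alt-term l k - alt-term l (suc k) ≈ ⟦ l ⟧ * (v k * w l k * alt k)
  alt-diff l k = begin
    p ^ k * alt k * ⟦ k ⟧ * (κ l k * ι (l ℕ.+ k)) - p ^ suc k * (- (q ^ suc k * alt k)) * ⟦ suc k ⟧ * (κ l (suc k) * ι (l ℕ.+ suc k))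
      ≈⟨ +-cong (*-congˡ (*-congˡ (sym (trans (*-congʳ (sym (⟦1++⟧ l k))) (⟦⟧*ι (l ℕ.+ k)))))) (-‿cong (*-congˡ (*-cong (κ-suc l k) (reflexive (≡.cong ι (ℕₚ.+-suc l k)))))) ⟩
    p ^ k * alt k * ⟦ k ⟧ * (κ l k * ((1# - q * (q ^ l * q ^ k)) * ρ * I)) - p ^ suc k * (- (q ^ suc k * alt k)) * ⟦ suc k ⟧ * (p ^ k * ((q ^ k - q ^ l) * ρ) * κ l k * I)
      -- The power q^(k+1) in `alt (suc k)` cancels against p^(k+1), which leaves the negative of
      -- `alt k`.
      ≈⟨ +-congˡ (trans (-‿cong (*-congʳ (*-congʳ (trans (sym (-‿distribʳ-* _ _)) (-‿cong (trans (sym (*-assoc _ _ _)) (absorb (trans (*-comm _ _) (q^*p^ (suc k))))))))))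
           (-‿cong (*-congʳ (*-congʳ (sym (+-identityˡ _)))))) ⟩
    p ^ k * alt k * ⟦ k ⟧ * (κ l k * ((1# - q * (q ^ l * q ^ k)) * ρ * I)) - (0# - alt k) * ⟦ suc k ⟧ * (p ^ k * ((q ^ k - q ^ l) * ρ) * κ l k * I)
      ≈⟨ solve 8 (λ a b c d e f g h →
            a :* c :* ((con (+ 1) :- b) :* f) :* (g :* ((con (+ 1) :- e :* (d :* b)) :* f :* h)) :- (con (+ 0) :- c) :* ((con (+ 1) :- (e :* b)) :* f) :* (a :* ((b :- d) :* f) :* g :* h)
            := ((con (+ 1) :- d) :* f) :* (a :* ((con (+ 1) :- e :* (b :* b)) :* f) :* (g :* h) :* c))
          refl (p ^ k) (q ^ k) (alt k) (q ^ l) q ρ (κ l k) I ⟩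
    ⟦ l ⟧ * (p ^ k * ((1# - q * (q ^ k * q ^ k)) * ρ) * (κ l k * I) * alt k)
      ≈⟨ *-congˡ (*-congʳ (*-congʳ (*-congˡ (⟦1++⟧ k k)))) ⟨
    ⟦ l ⟧ * (v k * w l k * alt k) ∎
    where
    I = ι (suc (l ℕ.+ k))
    open Algebra.Properties.Ring ring using (-‿distribʳ-*)

  -- For m > 0 the product of the invertible [m] with the moment telescopes to 0, so the moment
  -- vanishes; for m = 0 only k = 0 contributes, and the moment is 1.
  adm-alt : Admissible alt
  adm-alt = adm-cases cases
    where
    cases : ∀ m → m ℕ.≤ N → Integral (fac N * fac m * κ N m * moment m alt)
    cases zero _ = int-≈ (sym (begin
      fac N * 1# * ι N * moment 0 alt
        ≈⟨ *-congˡ (∑-single (suc N) 0 (s≤s z≤n) vanish) ⟩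
      fac N * 1# * ι N * (1# * ⟦ 1 ⟧ * (1# * ι 1) * 1#)
        ≈⟨ solve 4 (λ a b c d →
              a :* con (+ 1) :* b :* (con (+ 1) :* c :* (con (+ 1) :* d) :* con (+ 1))
              := a :* b :* (c :* d))
            refl (fac N) (ι N) (⟦ 1 ⟧) (ι 1) ⟩
      fac N * ι N * (⟦ 1 ⟧ * ι 1)
        ≈⟨ trans (absorb (fac*ι N)) (⟦⟧*ι 0) ⟩
      1# ∎)) int-1
      where
      vanish : ∀ k → k ≡.≢ 0 → v k * w 0 k * alt k ≈ 0#
      vanish zero    k≢0 = contradiction ≡.refl k≢0
      vanish (suc k) _   = trans (*-congʳ (trans (*-congˡ (zeroˡ _)) (zeroʳ _))) (zeroˡ _)
    cases (suc m) m<N = int-zero (trans (*-congˡ (cancel-unit (⟦⟧-inverse m) vanish)) (zeroʳ _))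
      where
      vanish : ⟦ suc m ⟧ * moment (suc m) alt ≈ ⟦ suc m ⟧ * 0#
      vanish = begin
        ⟦ suc m ⟧ * moment (suc m) alt
          ≈⟨ *-∑ (suc N) ⟩
        ∑ (suc N) (λ k → ⟦ suc m ⟧ * (v k * w (suc m) k * alt k))
          ≈⟨ ∑-cong (suc N) (alt-diff (suc m)) ⟨
        ∑ (suc N) (λ k → alt-term (suc m) k - alt-term (suc m) (suc k))
          ≈⟨ ∑-telescope (suc N) {alt-term (suc m)} ⟩
        1# * 1# * ⟦ 0 ⟧ * (ι (suc m) * ι (suc m ℕ.+ 0)) - p ^ suc N * alt (suc N) * ⟦ suc N ⟧ * (κ (suc m) (suc N) * ι (suc m ℕ.+ suc N))
          ≈⟨ +-cong (*-congʳ (*-congˡ ⟦0⟧)) (-‿cong (*-congˡ (*-congʳ (reflexive (κ-< (s≤s m<N)))))) ⟩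
        1# * 1# * 0# * (ι (suc m) * ι (suc m ℕ.+ 0)) - p ^ suc N * alt (suc N) * ⟦ suc N ⟧ * (0# * ι (suc m ℕ.+ suc N))
          ≈⟨ solve 7 (λ a b c d e f g →
                con (+ 1) :* con (+ 1) :* con (+ 0) :* (a :* b) :- c :* d :* e :* (con (+ 0) :* f)
                := g :* con (+ 0))
              refl (ι (suc m)) (ι (suc m ℕ.+ 0)) (p ^ suc N) (alt (suc N)) (⟦ suc N ⟧) (ι (suc m ℕ.+ suc N)) (⟦ suc m ⟧) ⟩
        ⟦ suc m ⟧ * 0# ∎

  adm-q^j : ∀ j {f} → Admissible f → Admissible (λ k → (q ^ (k ℕ.* k ℕ.+ k)) ^ j * f k)
  adm-q^j zero    i = adm-≈ (λ k → sym (*-identityˡ _)) i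
  adm-q^j (suc j) i = adm-≈ (λ k → sym (*-assoc _ _ _)) (adm-q^k²+k (adm-q^j j i))

  central : Carrier
  central = fac (N ℕ.+ N) * (ι N * ι N)

  -- A term of the theorem's sums without the constant unit q^(Ns): q^(-rk) [2k+1]^r is v^r, and
  -- each ballot number adds one v and one ω.
  summand : (r s j : ℕ) → (ℕ → Carrier) → ℕ → Carrier
  summand r s j f k = v k ^ (r ℕ.+ s) * ω k ^ s * ((q ^ (k ℕ.* k ℕ.+ k)) ^ j * f k)

  -- With s = b + 1, one v and one ω are set aside to form the moment of order N. The remaining
  -- v^(2a) is T^a, and r + b = 2a gives the bound b ≤ 2a that `adm-powers` asks for.
  central-divides : ∀ r b j {f} a → r ℕ.+ b ≡ a ℕ.+ a → Admissible f →
    Σ Carrier λ c → Integral c × ∑ (suc N) (summand r (suc b) j f) ≈ c * central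
  central-divides r b j {f} a e i = J , adm N , (begin
    ∑ (suc N) (summand r (suc b) j f)
      ≈⟨ ∑-cong (suc N) term ⟩
    ∑ (suc N) (λ k → F₂ * (v k * w N k * g k))
      ≈⟨ *-∑ (suc N) ⟨
    F₂ * moment N g
      ≈⟨ trans (absorb (fac*ι N)) (absorb (fac*ι N)) ⟨
    fac N * ι N * (fac N * ι N * (F₂ * moment N g))
      ≈⟨ solve 4 (λ a b c d →
            a :* b :* (a :* b :* (c :* d))
            := a :* a :* con (+ 1) :* d :* (c :* (b :* b)))
          refl (fac N) (ι N) F₂ (moment N g) ⟩
    fac N * fac N * 1# * moment N g * (F₂ * (ι N * ι N))
      ≈⟨ *-congʳ (*-congʳ (*-congˡ (reflexive (κ-diag N)))) ⟨
    J * central ∎)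
    where
    f′ g : ℕ → Carrier
    f′ k = (q ^ (k ℕ.* k ℕ.+ k)) ^ j * f k
    g k = T k ^ a * (ω k ^ b * f′ k)
    J : Carrier
    J = fac N * fac N * κ N N * moment N g
    adm : Admissible g
    adm = adm-powers a b (ℕₚ.≤-trans (ℕₚ.m≤n+m b r) (ℕₚ.≤-reflexive e)) (adm-q^j j i)
    v-power : ∀ k → v k ^ (r ℕ.+ suc b) ≈ v k * T k ^ a
    v-power k = begin
      v k ^ (r ℕ.+ suc b)        ≡⟨ ≡.cong (v k ^_) (≡.trans (ℕₚ.+-suc r b) (≡.cong suc e)) ⟩
      v k * v k ^ (a ℕ.+ a)      ≈⟨ *-congˡ (^-homo-* (v k) a a) ⟩
      v k * (v k ^ a * v k ^ a)  ≈⟨ *-congˡ (^-distrib-* (v k) (v k) a) ⟨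
      v k * T k ^ a              ∎
    term : ∀ k → summand r (suc b) j f k ≈ F₂ * (v k * w N k * g k)
    term k = begin
      v k ^ (r ℕ.+ suc b) * (F₂ * w N k * ω k ^ b) * f′ k
        ≈⟨ *-congʳ (*-congʳ (v-power k)) ⟩
      v k * T k ^ a * (F₂ * w N k * ω k ^ b) * f′ k
        ≈⟨ solve 6 (λ a b c d e f →
              a :* b :* (c :* d :* e) :* f
              := c :* (a :* d :* (b :* (e :* f))))
            refl (v k) (T k ^ a) F₂ (w N k) (ω k ^ b) (f′ k) ⟩
      F₂ * (v k * w N k * (T k ^ a * (ω k ^ b * f′ k))) ∎

-- Rings of fractions

module _ {A : Set} (_≈_ : Rel A 0ℓ) (isEquivalence : IsEquivalence _≈_) where
  open Algebra.Definitions _≈_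

  private
    setoid : Setoid 0ℓ 0ℓ
    setoid = record { isEquivalence = isEquivalence }

  open Algebra.Consequences.Setoid setoid

  mkIsCommutativeRing : ∀ {_+_ _*_ -_ 0# 1#} →
    Congruent₂ _+_ → Associative _+_ → Commutative _+_ → LeftIdentity 0# _+_ →
    Congruent₁ -_ → LeftInverse 0# -_ _+_ →
    Congruent₂ _*_ → Associative _*_ → Commutative _*_ → LeftIdentity 1# _*_ →
    _*_ DistributesOverʳ _+_ → IsCommutativeRing _≈_ _+_ _*_ -_ 0# 1#
  mkIsCommutativeRing +-cong +-assoc +-comm +-identityˡ -‿cong -‿inverseˡ *-cong *-assoc *-comm *-identityˡ distribʳ = record
    { isRing = record
      { +-isAbelianGroup = record
        { isGroup = record
          { isMonoid = record
            { isSemigroup = record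
              { isMagma = record { isEquivalence = isEquivalence ; ∙-cong = +-cong }
              ; assoc = +-assoc }
            ; identity = comm∧idˡ⇒id +-comm +-identityˡ }
          ; inverse = comm∧invˡ⇒inv +-comm -‿inverseˡ
          ; ⁻¹-cong = -‿cong }
        ; comm = +-comm }
      ; *-cong = *-cong
      ; *-assoc = *-assoc
      ; *-identity = comm∧idˡ⇒id *-comm *-identityˡ
      ; distrib = comm∧distrʳ⇒distr +-cong *-comm distribʳ }
    ; *-comm = *-comm }

module Regularity (K : CommutativeRing 0ℓ 0ℓ) where
  open CommutativeRing K
  open IntegerCoefficients K
  open Relation.Binary.Reasoning.Setoid setoid

  Regular : Carrier → Set
  Regular d = ∀ x → d * x ≈ 0# → x ≈ 0#

  regular-1 : Regular 1#
  regular-1 x e = trans (sym (*-identityˡ x)) e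

  regular-* : ∀ {c d} → Regular c → Regular d → Regular (c * d)
  regular-* r s x e = s x (r _ (trans (sym (*-assoc _ _ _)) e))

  difference-0 : ∀ {x y} → x - y ≈ 0# → x ≈ y
  difference-0 {x} {y} e = begin
    x              ≈⟨ solve 2 (λ a b → a := (a :- b) :+ b) refl x y ⟩
    (x - y) + y    ≈⟨ +-congʳ e ⟩
    0# + y         ≈⟨ +-identityˡ y ⟩
    y              ∎

  cancel : ∀ {d x y} → Regular d → d * x ≈ d * y → x ≈ y
  cancel {d} {x} {y} r e = difference-0 (r _ (begin
    d * (x - y)      ≈⟨ solve 3 (λ a b c → a :* (b :- c) := a :* b :- a :* c) refl d x y ⟩
    d * x - d * y    ≈⟨ +-congʳ e ⟩
    d * y - d * y    ≈⟨ -‿inverseʳ _ ⟩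
    0#               ∎))

module Localization (K : CommutativeRing 0ℓ 0ℓ) where
  open CommutativeRing K
  open Regularity K
  open IntegerCoefficients K
  open Relation.Binary.Reasoning.Setoid setoid

  -- Denominators carry a proof that they are not zero divisors; that property makes equality by
  -- cross multiplication transitive.
  record Fraction : Set where
    constructor _/_[_]
    field
      num den : Carrier
      regular : Regular den
  open Fraction

  infix 4 _≃_
  record _≃_ (x y : Fraction) : Set where
    constructor mk≃
    field cross : num x * den y ≈ num y * den x
  open _≃_ public

  ≃-isEquivalence : IsEquivalence _≃_
  ≃-isEquivalence = record
    { refl  = mk≃ refl
    ; sym   = λ e → mk≃ (sym (cross e))
    ; trans = λ {x} {y} {z} e f → mk≃ (cancel (regular y) (transitive x y z e f))
    }
    where
    transitive : ∀ x y z → x ≃ y → y ≃ z → den y * (num x * den z) ≈ den y * (num z * den x)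
    transitive (a / b [ _ ]) (c / d [ _ ]) (e / f [ _ ]) (mk≃ h₁) (mk≃ h₂) = begin
      d * (a * f)    ≈⟨ solve 3 (λ a b c → b :* (a :* c) := a :* b :* c) refl a d f ⟩
      a * d * f      ≈⟨ *-congʳ h₁ ⟩
      c * b * f      ≈⟨ solve 3 (λ a b c → b :* a :* c := b :* c :* a) refl b c f ⟩
      c * f * b      ≈⟨ *-congʳ h₂ ⟩
      e * d * b      ≈⟨ solve 3 (λ a b c → c :* b :* a := b :* (c :* a)) refl b d e ⟩
      d * (e * b)    ∎

  _⊕_ _⊗_ : Fraction → Fraction → Fraction
  x ⊕ y = (num x * den y + num y * den x) / (den x * den y) [ regular-* (regular x) (regular y) ]
  x ⊗ y = (num x * num y) / (den x * den y) [ regular-* (regular x) (regular y) ]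

  ⊝_ : Fraction → Fraction
  ⊝ x = (- num x) / den x [ regular x ]

  emb : Carrier → Fraction
  emb a = a / 1# [ regular-1 ]

  ⊕-cong : ∀ {x x′ y y′} → x ≃ x′ → y ≃ y′ → x ⊕ y ≃ x′ ⊕ y′
  ⊕-cong {a / b [ _ ]} {a′ / b′ [ _ ]} {c / d [ _ ]} {c′ / d′ [ _ ]} (mk≃ h₁) (mk≃ h₂) = mk≃ (begin
    (a * d + c * b) * (b′ * d′)
        ≈⟨ solve 6 (λ a b c d e f →
          (a :* d :+ c :* b) :* (e :* f)
          := a :* e :* (d :* f) :+ c :* f :* (b :* e))
        refl a b c d b′ d′ ⟩
    a * b′ * (d * d′) + c * d′ * (b * b′)      ≈⟨ +-cong (*-congʳ h₁) (*-congʳ h₂) ⟩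
    a′ * b * (d * d′) + c′ * d * (b * b′)
        ≈⟨ solve 6 (λ a b c d e f →
          a :* b :* (d :* f) :+ c :* d :* (b :* e)
          := (a :* f :+ c :* e) :* (b :* d))
        refl a′ b c′ d b′ d′ ⟩
    (a′ * d′ + c′ * b′) * (b * d)              ∎)

  ⊗-cong : ∀ {x x′ y y′} → x ≃ x′ → y ≃ y′ → x ⊗ y ≃ x′ ⊗ y′
  ⊗-cong {a / b [ _ ]} {a′ / b′ [ _ ]} {c / d [ _ ]} {c′ / d′ [ _ ]} (mk≃ h₁) (mk≃ h₂) = mk≃ (begin
    (a * c) * (b′ * d′)      ≈⟨ solve 4 (λ a b c d → (a :* b) :* (c :* d) := (a :* c) :* (b :* d)) refl a c b′ d′ ⟩
    (a * b′) * (c * d′)      ≈⟨ *-cong h₁ h₂ ⟩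
    (a′ * b) * (c′ * d)      ≈⟨ solve 4 (λ a b c d → (a :* b) :* (c :* d) := (a :* c) :* (b :* d)) refl a′ b c′ d ⟩
    (a′ * c′) * (b * d)      ∎)

  ⊝-cong : ∀ {x x′} → x ≃ x′ → ⊝ x ≃ ⊝ x′
  ⊝-cong {a / b [ _ ]} {a′ / b′ [ _ ]} (mk≃ h) = mk≃ (begin
    - a * b′             ≈⟨ solve 2 (λ a b → :- a :* b := :- (a :* b)) refl a b′ ⟩
    - (a * b′)           ≈⟨ -‿cong h ⟩
    - (a′ * b)           ≈⟨ solve 2 (λ a b → :- (a :* b) := :- a :* b) refl a′ b ⟩
    - a′ * b             ∎)

  ⊕-assoc : ∀ x y z → (x ⊕ y) ⊕ z ≃ x ⊕ (y ⊕ z)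
  ⊕-assoc (a / b [ _ ]) (c / d [ _ ]) (e / f [ _ ]) = mk≃ (begin
    ((a * d + c * b) * f + e * (b * d)) * (b * (d * f))
        ≈⟨ solve 6 (λ a b c d e f →
          ((a :* d :+ c :* b) :* f :+ e :* (b :* d)) :* (b :* (d :* f))
          := (a :* (d :* f) :+ (c :* f :+ e :* d) :* b) :* (b :* d :* f))
        refl a b c d e f ⟩
    (a * (d * f) + (c * f + e * d) * b) * (b * d * f)        ∎)

  ⊕-comm : ∀ x y → x ⊕ y ≃ y ⊕ x
  ⊕-comm (a / b [ _ ]) (c / d [ _ ]) = mk≃ (begin
    (a * d + c * b) * (d * b)
        ≈⟨ solve 4 (λ a b c d →
          (a :* d :+ c :* b) :* (d :* b)
          := (c :* b :+ a :* d) :* (b :* d))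
        refl a b c d ⟩
    (c * b + a * d) * (b * d)      ∎)

  ⊕-identityˡ : ∀ x → emb 0# ⊕ x ≃ x
  ⊕-identityˡ (a / b [ _ ]) = mk≃ (begin
    (0# * b + a * 1#) * b
        ≈⟨ solve 2 (λ a b →
          (con (+ 0) :* b :+ a :* con (+ 1)) :* b
          := a :* (con (+ 1) :* b))
        refl a b ⟩
    a * (1# * b)               ∎)

  ⊝-inverseˡ : ∀ x → (⊝ x) ⊕ x ≃ emb 0#
  ⊝-inverseˡ (a / b [ _ ]) = mk≃ (solve 2 (λ a b → (:- a :* b :+ a :* b) :* con (+ 1) := con (+ 0) :* (b :* b)) refl a b)

  ⊗-assoc : ∀ x y z → (x ⊗ y) ⊗ z ≃ x ⊗ (y ⊗ z)
  ⊗-assoc (a / b [ _ ]) (c / d [ _ ]) (e / f [ _ ]) = mk≃ (begin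
    (a * c * e) * (b * (d * f))
        ≈⟨ solve 6 (λ a b c d e f →
          (a :* c :* e) :* (b :* (d :* f))
          := (a :* (c :* e)) :* (b :* d :* f))
        refl a b c d e f ⟩
    (a * (c * e)) * (b * d * f)      ∎)

  ⊗-comm : ∀ x y → x ⊗ y ≃ y ⊗ x
  ⊗-comm (a / b [ _ ]) (c / d [ _ ]) = mk≃ (begin
    (a * c) * (d * b)      ≈⟨ solve 4 (λ a b c d → (a :* c) :* (d :* b) := (c :* a) :* (b :* d)) refl a b c d ⟩
    (c * a) * (b * d)      ∎)

  ⊗-identityˡ : ∀ x → emb 1# ⊗ x ≃ x
  ⊗-identityˡ (a / b [ _ ]) = mk≃ (begin
    1# * a * b        ≈⟨ solve 2 (λ a b → con (+ 1) :* a :* b := a :* (con (+ 1) :* b)) refl a b ⟩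
    a * (1# * b)      ∎)

  ⊗-distribʳ : ∀ z x y → (x ⊕ y) ⊗ z ≃ (x ⊗ z) ⊕ (y ⊗ z)
  ⊗-distribʳ (e / f [ _ ]) (a / b [ _ ]) (c / d [ _ ]) = mk≃ (begin
    ((a * d + c * b) * e) * (b * f * (d * f))
        ≈⟨ solve 6 (λ a b c d e f →
          ((a :* d :+ c :* b) :* e) :* (b :* f :* (d :* f))
          := (a :* e :* (d :* f) :+ c :* e :* (b :* f)) :* (b :* d :* f))
        refl a b c d e f ⟩
    (a * e * (d * f) + c * e * (b * f)) * (b * d * f)     ∎)

  fractions : CommutativeRing 0ℓ 0ℓ
  fractions = record
    { Carrier = Fraction
    ; _≈_ = _≃_
    ; _+_ = _⊕_
    ; _*_ = _⊗_
    ; -_  = ⊝_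
    ; 0#  = emb 0#
    ; 1#  = emb 1#
    ; isCommutativeRing = mkIsCommutativeRing _≃_ ≃-isEquivalence
        ⊕-cong ⊕-assoc ⊕-comm ⊕-identityˡ ⊝-cong ⊝-inverseˡ
        ⊗-cong ⊗-assoc ⊗-comm ⊗-identityˡ ⊗-distribʳ
    }

  emb-cong : ∀ {a b} → a ≈ b → emb a ≃ emb b
  emb-cong e = mk≃ (*-congʳ e)

  emb-injective : ∀ {a b} → emb a ≃ emb b → a ≈ b
  emb-injective (mk≃ e) = trans (sym (*-identityʳ _)) (trans e (*-identityʳ _))

  emb-+ : ∀ a b → emb (a + b) ≃ emb a ⊕ emb b
  emb-+ a b = mk≃ (begin
    (a + b) * (1# * 1#)
        ≈⟨ solve 2 (λ a b →
          (a :+ b) :* (con (+ 1) :* con (+ 1))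
          := (a :* con (+ 1) :+ b :* con (+ 1)) :* con (+ 1))
        refl a b ⟩
    (a * 1# + b * 1#) * 1#        ∎)

  emb-* : ∀ a b → emb (a * b) ≃ emb a ⊗ emb b
  emb-* a b = mk≃ (*-congˡ (*-identityˡ 1#))

  emb-neg : ∀ a → emb (- a) ≃ ⊝ emb a
  emb-neg a = mk≃ refl

  reciprocal : ∀ d → Regular d → Fraction
  reciprocal d r = 1# / d [ r ]

  emb*reciprocal : ∀ d r → emb d ⊗ reciprocal d r ≃ emb 1#
  emb*reciprocal d r = mk≃ (begin
    d * 1# * 1#            ≈⟨ solve 1 (λ a → a :* con (+ 1) :* con (+ 1) := con (+ 1) :* (con (+ 1) :* a)) refl d ⟩
    1# * (1# * d)          ∎)

-- The later modules work with an arbitrary instance, so that fractions stay opaque there; the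
-- construction itself enters only in the proof of the theorem.
record FractionRing (K : CommutativeRing 0ℓ 0ℓ) : Set₁ where
  private
    module K = CommutativeRing K
  open Regularity K using (Regular)
  field
    ring : CommutativeRing 0ℓ 0ℓ
  open CommutativeRing ring
  field
    emb           : K.Carrier → Carrier
    emb-cong      : ∀ {a b} → a K.≈ b → emb a ≈ emb b
    emb-injective : ∀ {a b} → emb a ≈ emb b → a K.≈ b
    emb-+         : ∀ a b → emb (a K.+ b) ≈ emb a + emb b
    emb-*         : ∀ a b → emb (a K.* b) ≈ emb a * emb b
    emb-neg       : ∀ a → emb (K.- a) ≈ - emb a
    emb-0         : emb K.0# ≈ 0#
    emb-1         : emb K.1# ≈ 1#
    reciprocal    : ∀ d → Regular d → Carrier
    emb*reciprocal : ∀ d r → emb d * reciprocal d r ≈ 1#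

fractionRing : ∀ K → FractionRing K
fractionRing K = record
  { ring           = fractions
  ; emb            = emb
  ; emb-cong       = emb-cong
  ; emb-injective  = emb-injective
  ; emb-+          = emb-+
  ; emb-*          = emb-*
  ; emb-neg        = emb-neg
  ; emb-0          = CommutativeRing.refl fractions
  ; emb-1          = CommutativeRing.refl fractions
  ; reciprocal     = reciprocal
  ; emb*reciprocal = emb*reciprocal
  }
  where open Localization K

-- q-integers and Laurent polynomials in a ring of fractions

module QInteger (K : CommutativeRing 0ℓ 0ℓ) where
  open CommutativeRing K
  open Algebra.Properties.Semiring.Exp semiring
  open IntegerCoefficients K
  open Relation.Binary.Reasoning.Setoid setoid

  -- The recursive form makes sense before 1 - q is inverted, and for polynomials it shows the
  -- constant term 1 that gives regularity.
  q-integer : Carrier → ℕ → Carrier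
  q-integer q zero    = 0#
  q-integer q (suc n) = 1# + q * q-integer q n

  [1-q]*q-integer : ∀ q m → (1# - q) * q-integer q m ≈ 1# - q ^ m
  [1-q]*q-integer q zero    = trans (zeroʳ _) (sym (-‿inverseʳ 1#))
  [1-q]*q-integer q (suc m) = begin
    (1# - q) * (1# + q * i)
        ≈⟨ solve 2 (λ a b →
          (con (+ 1) :- a) :* (con (+ 1) :+ a :* b)
          := (con (+ 1) :- a) :+ a :* ((con (+ 1) :- a) :* b))
        refl q i ⟩
    (1# - q) + q * ((1# - q) * i)         ≈⟨ +-congˡ (*-congˡ ([1-q]*q-integer q m)) ⟩
    (1# - q) + q * (1# - q ^ m)
        ≈⟨ solve 2 (λ a b →
          (con (+ 1) :- a) :+ a :* (con (+ 1) :- b)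
          := con (+ 1) :- a :* b)
        refl q (q ^ m) ⟩
    1# - q * q ^ m                        ∎
    where i = q-integer q m

module FractionQRing (K : CommutativeRing 0ℓ 0ℓ) (Φ : FractionRing K) (qK : CommutativeRing.Carrier K)
  (qK-regular : Regularity.Regular K qK)
  (1-q-regular : Regularity.Regular K (CommutativeRing._-_ K (CommutativeRing.1# K) qK))
  (q-integer-regular : ∀ n → Regularity.Regular K (QInteger.q-integer K qK (suc n)))
  where
  private module K = CommutativeRing K
  open QInteger K
  open FractionRing Φ renaming (ring to fractions)
  open CommutativeRing fractions
  open Algebra.Properties.Ring ring using (-‿distribʳ-*)
  open Algebra.Properties.Semiring.Exp semiring
  open Algebra.Properties.Semiring.Exp K.semiring using () renaming (_^_ to _^K_)
  open Relation.Binary.Reasoning.Setoid setoid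

  emb-^ : ∀ a m → emb (a ^K m) ≈ emb a ^ m
  emb-^ a zero    = emb-1
  emb-^ a (suc m) = trans (emb-* a (a ^K m)) (*-congˡ (emb-^ a m))

  q p ρ : Carrier
  q = emb qK
  p = reciprocal qK qK-regular
  ρ = reciprocal (K.1# K.- qK) 1-q-regular

  emb-1- : ∀ a → emb (K.1# K.- a) ≈ 1# - emb a
  emb-1- a = trans (emb-+ _ _) (+-cong emb-1 (emb-neg a))

  ⟦⟧-emb : ∀ m → (1# - q ^ m) * ρ ≈ emb (q-integer qK m)
  ⟦⟧-emb m = begin
    (1# - q ^ m) * ρ                                    ≈⟨ *-congʳ (+-congˡ (-‿cong (emb-^ qK m))) ⟨
    (1# - emb (qK ^K m)) * ρ                            ≈⟨ *-congʳ (emb-1- _) ⟨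
    emb (K.1# K.- qK ^K m) * ρ                          ≈⟨ *-congʳ (emb-cong ([1-q]*q-integer qK m)) ⟨
    emb ((K.1# K.- qK) K.* q-integer qK m) * ρ          ≈⟨ *-congʳ (trans (emb-* _ _) (*-comm _ _)) ⟩
    emb (q-integer qK m) * emb (K.1# K.- qK) * ρ        ≈⟨ *-assoc _ _ _ ⟩
    emb (q-integer qK m) * (emb (K.1# K.- qK) * ρ)      ≈⟨ *-congˡ (emb*reciprocal _ _) ⟩
    emb (q-integer qK m) * 1#                           ≈⟨ *-identityʳ _ ⟩
    emb (q-integer qK m)                                ∎

  Laurent-integral : Carrier → Set
  Laurent-integral x = Σ ℕ λ e → Σ K.Carrier λ c → q ^ e * x ≈ emb c

  private
    module F = IntegerCoefficients fractions

  laurent-+ : ∀ {x y} → Laurent-integral x → Laurent-integral y → Laurent-integral (x + y)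
  laurent-+ {x} {y} (e , c , h) (f , d , k) = e ℕ.+ f , (qK ^K f) K.* c K.+ (qK ^K e) K.* d , (begin
    q ^ (e ℕ.+ f) * (x + y)
      ≈⟨ *-congʳ (^-homo-* q e f) ⟩
    q ^ e * q ^ f * (x + y)
      ≈⟨ F.solve 4 (λ a b x y → a F.:* b F.:* (x F.:+ y) F.:= b F.:* (a F.:* x) F.:+ a F.:* (b F.:* y)) refl (q ^ e) (q ^ f) x y ⟩
    q ^ f * (q ^ e * x) + q ^ e * (q ^ f * y)
      ≈⟨ +-cong (*-cong (sym (emb-^ qK f)) h) (*-cong (sym (emb-^ qK e)) k) ⟩
    emb (qK ^K f) * emb c + emb (qK ^K e) * emb d
      ≈⟨ +-cong (emb-* _ _) (emb-* _ _) ⟨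
    emb ((qK ^K f) K.* c) + emb ((qK ^K e) K.* d)
      ≈⟨ emb-+ _ _ ⟨
    emb ((qK ^K f) K.* c K.+ (qK ^K e) K.* d) ∎)

  laurent-* : ∀ {x y} → Laurent-integral x → Laurent-integral y → Laurent-integral (x * y)
  laurent-* {x} {y} (e , c , h) (f , d , k) = e ℕ.+ f , c K.* d , (begin
    q ^ (e ℕ.+ f) * (x * y)
      ≈⟨ *-congʳ (^-homo-* q e f) ⟩
    q ^ e * q ^ f * (x * y)
      ≈⟨ F.solve 4 (λ a b x y → a F.:* b F.:* (x F.:* y) F.:= a F.:* x F.:* (b F.:* y)) refl (q ^ e) (q ^ f) x y ⟩
    q ^ e * x * (q ^ f * y)
      ≈⟨ *-cong h k ⟩
    emb c * emb d
      ≈⟨ emb-* _ _ ⟨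
    emb (c K.* d) ∎)

  laurent-neg : ∀ {x} → Laurent-integral x → Laurent-integral (- x)
  laurent-neg {x} (e , c , h) = e , K.- c , trans (sym (-‿distribʳ-* _ _)) (trans (-‿cong h) (sym (emb-neg c)))

  fractionQRing : QRing
  fractionQRing = record
    { commutativeRing = fractions
    ; q = q
    ; p = p
    ; ρ = ρ
    ; q*p≈1 = emb*reciprocal qK qK-regular
    ; [1-q]*ρ≈1 = trans (*-congʳ (sym (emb-1- qK))) (emb*reciprocal _ _)
    ; ⟦⟧⁻¹ = λ n → reciprocal (q-integer qK (suc n)) (q-integer-regular n)
    ; ⟦⟧-inverse = λ n → trans (*-congʳ (⟦⟧-emb (suc n))) (emb*reciprocal _ _)
    ; Integral = Laurent-integral
    ; int-≈ = λ { x≈y (e , c , h) → e , c , trans (*-congˡ (sym x≈y)) h }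
    ; int-+ = laurent-+
    ; int-* = laurent-*
    ; int-neg = laurent-neg
    ; int-1 = 0 , K.1# , trans (*-identityˡ 1#) (sym emb-1)
    ; int-q = 0 , qK , *-identityˡ q
    ; int-p = 1 , K.1# , trans (*-congʳ (*-identityʳ q)) (trans (emb*reciprocal qK qK-regular) (sym emb-1))
    }

-- Polynomials as coefficient lists

module Polynomials where

  -- _≈P_ unfolds to a function type, from which the two polynomials cannot be
  -- inferred; the record makes them inferable.
  infix 4 _≋_
  record _≋_ (x y : Poly) : Set where
    constructor mk≋
    field coeff-≡ : x ≈P y
  open _≋_ public

  ≋-isEquivalence : IsEquivalence _≋_
  ≋-isEquivalence = record
    { refl  = mk≋ λ _ → ≡.refl
    ; sym   = λ e → mk≋ λ i → ≡.sym (coeff-≡ e i)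
    ; trans = λ e f → mk≋ λ i → ≡.trans (coeff-≡ e i) (coeff-≡ f i)
    }

  ≋-setoid : Setoid 0ℓ 0ℓ
  ≋-setoid = record { isEquivalence = ≋-isEquivalence }

  private
    module S = Setoid ≋-setoid
  open Relation.Binary.Reasoning.Setoid ≋-setoid

  coeff-+ : ∀ x y i → coeff (x +P y) i ≡ coeff x i ℤ.+ coeff y i
  coeff-+ []      y       i       = ≡.sym (ℤₚ.+-identityˡ _)
  coeff-+ (a ∷ x) []      i       = ≡.sym (ℤₚ.+-identityʳ _)
  coeff-+ (a ∷ x) (b ∷ y) zero    = ≡.refl
  coeff-+ (a ∷ x) (b ∷ y) (suc i) = coeff-+ x y i

  coeff-scale : ∀ c x i → coeff (scaleP c x) i ≡ c ℤ.* coeff x i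
  coeff-scale c []      i       = ≡.sym (ℤₚ.*-zeroʳ c)
  coeff-scale c (a ∷ x) zero    = ≡.refl
  coeff-scale c (a ∷ x) (suc i) = coeff-scale c x i

  coeff-neg : ∀ x i → coeff (negP x) i ≡ ℤ.- coeff x i
  coeff-neg x i = ≡.trans (coeff-scale (ℤ.- + 1) x i) (ℤₚ.-1*i≡-i (coeff x i))

  ∷-cong : ∀ {a b x y} → a ≡ b → x ≋ y → a ∷ x ≋ b ∷ y
  ∷-cong a≡b x≋y = mk≋ λ { zero → a≡b ; (suc i) → coeff-≡ x≋y i }

  0∷[] : + 0 ∷ [] ≋ []
  0∷[] = mk≋ λ { zero → ≡.refl ; (suc i) → ≡.refl }

  tail-≋ : ∀ {a b x y} → a ∷ x ≋ b ∷ y → x ≋ y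
  tail-≋ e = mk≋ λ i → coeff-≡ e (suc i)

  +P-cong : ∀ {x x′ y y′} → x ≋ x′ → y ≋ y′ → x +P y ≋ x′ +P y′
  +P-cong {x} {x′} {y} {y′} e f = mk≋ λ i →
    ≡.trans (coeff-+ x y i) (≡.trans (≡.cong₂ ℤ._+_ (coeff-≡ e i) (coeff-≡ f i)) (≡.sym (coeff-+ x′ y′ i)))

  +P-comm : ∀ x y → x +P y ≋ y +P x
  +P-comm x y = mk≋ λ i → ≡.trans (coeff-+ x y i) (≡.trans (ℤₚ.+-comm (coeff x i) _) (≡.sym (coeff-+ y x i)))

  +P-assoc : ∀ x y z → (x +P y) +P z ≋ x +P (y +P z)
  +P-assoc x y z = mk≋ λ i →
    ≡.trans (coeff-+ (x +P y) z i) (≡.trans (≡.cong (ℤ._+ coeff z i) (coeff-+ x y i))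
    (≡.trans (ℤₚ.+-assoc (coeff x i) _ _) (≡.sym (≡.trans (coeff-+ x (y +P z) i) (≡.cong (λ t → coeff x i ℤ.+ t) (coeff-+ y z i))))))

  +P-identityʳ : ∀ x → x +P [] ≋ x
  +P-identityʳ x = +P-comm x []

  +P-interchange : ∀ x y z w → (x +P y) +P (z +P w) ≋ (x +P z) +P (y +P w)
  +P-interchange x y z w = begin
    (x +P y) +P (z +P w)   ≈⟨ +P-assoc x y (z +P w) ⟩
    x +P (y +P (z +P w))   ≈⟨ +P-cong {x = x} S.refl (S.sym (+P-assoc y z w)) ⟩
    x +P ((y +P z) +P w)   ≈⟨ +P-cong {x = x} S.refl (+P-cong (+P-comm y z) (S.refl {w})) ⟩
    x +P ((z +P y) +P w)   ≈⟨ +P-cong {x = x} S.refl (+P-assoc z y w) ⟩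
    x +P (z +P (y +P w))   ≈⟨ +P-assoc x z (y +P w) ⟨
    (x +P z) +P (y +P w)   ∎

  negP-cong : ∀ {x y} → x ≋ y → negP x ≋ negP y
  negP-cong {x} {y} e = mk≋ λ i → ≡.trans (coeff-neg x i) (≡.trans (≡.cong ℤ.-_ (coeff-≡ e i)) (≡.sym (coeff-neg y i)))

  negP-inverseˡ : ∀ x → negP x +P x ≋ []
  negP-inverseˡ x = mk≋ λ i →
    ≡.trans (coeff-+ (negP x) x i) (≡.trans (≡.cong (ℤ._+ coeff x i) (coeff-neg x i)) (ℤₚ.+-inverseˡ (coeff x i)))

  scale-cong : ∀ {c d x y} → c ≡ d → x ≋ y → scaleP c x ≋ scaleP d y
  scale-cong {c} {d} {x} {y} e f = mk≋ λ i →
    ≡.trans (coeff-scale c x i) (≡.trans (≡.cong₂ ℤ._*_ e (coeff-≡ f i)) (≡.sym (coeff-scale d y i)))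

  scale-+ : ∀ c x y → scaleP c (x +P y) ≋ scaleP c x +P scaleP c y
  scale-+ c x y = mk≋ λ i →
    ≡.trans (coeff-scale c (x +P y) i) (≡.trans (≡.cong (c ℤ.*_) (coeff-+ x y i)) (≡.trans (ℤₚ.*-distribˡ-+ c _ _)
    (≡.sym (≡.trans (coeff-+ (scaleP c x) (scaleP c y) i) (≡.cong₂ ℤ._+_ (coeff-scale c x i) (coeff-scale c y i))))))

  +-scale : ∀ c d x → scaleP (c ℤ.+ d) x ≋ scaleP c x +P scaleP d x
  +-scale c d x = mk≋ λ i →
    ≡.trans (coeff-scale (c ℤ.+ d) x i) (≡.trans (ℤₚ.*-distribʳ-+ (coeff x i) c d)
    (≡.sym (≡.trans (coeff-+ (scaleP c x) (scaleP d x) i) (≡.cong₂ ℤ._+_ (coeff-scale c x i) (coeff-scale d x i)))))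

  scale-scale : ∀ c d x → scaleP c (scaleP d x) ≋ scaleP (c ℤ.* d) x
  scale-scale c d x = mk≋ λ i →
    ≡.trans (coeff-scale c (scaleP d x) i) (≡.trans (≡.cong (c ℤ.*_) (coeff-scale d x i))
    (≡.trans (≡.sym (ℤₚ.*-assoc c d _)) (≡.sym (coeff-scale (c ℤ.* d) x i))))

  scale-0 : ∀ x → scaleP (+ 0) x ≋ []
  scale-0 x = mk≋ λ i → coeff-scale (+ 0) x i

  scale-1 : ∀ x → scaleP (+ 1) x ≋ x
  scale-1 x = mk≋ λ i → ≡.trans (coeff-scale (+ 1) x i) (ℤₚ.*-identityˡ _)

  *P-zeroʳ : ∀ x → x *P [] ≋ []
  *P-zeroʳ []      = S.refl
  *P-zeroʳ (a ∷ x) = S.trans (∷-cong ≡.refl (*P-zeroʳ x)) 0∷[]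

  *P-congˡ : ∀ x {y z} → y ≋ z → x *P y ≋ x *P z
  *P-congˡ []      e = S.refl
  *P-congˡ (a ∷ x) e = +P-cong (scale-cong {a} ≡.refl e) (∷-cong ≡.refl (*P-congˡ x e))

  *P-∷ : ∀ x b y → x *P (b ∷ y) ≋ scaleP b x +P (+ 0 ∷ (x *P y))
  *P-∷ []      b y = S.sym 0∷[]
  *P-∷ (a ∷ x) b y = ∷-cong (≡.trans (ℤₚ.+-identityʳ _) (≡.trans (ℤₚ.*-comm a b) (≡.sym (ℤₚ.+-identityʳ _)))) (begin
    scaleP a y +P (x *P (b ∷ y))                           ≈⟨ +P-cong {x = scaleP a y} S.refl (*P-∷ x b y) ⟩
    scaleP a y +P (scaleP b x +P (+ 0 ∷ (x *P y)))         ≈⟨ +P-assoc (scaleP a y) (scaleP b x) _ ⟨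
    (scaleP a y +P scaleP b x) +P (+ 0 ∷ (x *P y))         ≈⟨ +P-cong (+P-comm (scaleP a y) (scaleP b x)) S.refl ⟩
    (scaleP b x +P scaleP a y) +P (+ 0 ∷ (x *P y))         ≈⟨ +P-assoc (scaleP b x) (scaleP a y) _ ⟩
    scaleP b x +P (scaleP a y +P (+ 0 ∷ (x *P y)))         ∎)

  *P-comm : ∀ x y → x *P y ≋ y *P x
  *P-comm []      y = S.sym (*P-zeroʳ y)
  *P-comm (a ∷ x) y = begin
    scaleP a y +P (+ 0 ∷ (x *P y))   ≈⟨ +P-cong {x = scaleP a y} S.refl (∷-cong ≡.refl (*P-comm x y)) ⟩
    scaleP a y +P (+ 0 ∷ (y *P x))   ≈⟨ *P-∷ y a x ⟨
    y *P (a ∷ x)                     ∎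

  *P-cong : ∀ {x x′ y y′} → x ≋ x′ → y ≋ y′ → x *P y ≋ x′ *P y′
  *P-cong {x} {x′} {y} {y′} e f = begin
    x *P y     ≈⟨ *P-congˡ x f ⟩
    x *P y′    ≈⟨ *P-comm x y′ ⟩
    y′ *P x    ≈⟨ *P-congˡ y′ e ⟩
    y′ *P x′   ≈⟨ *P-comm y′ x′ ⟩
    x′ *P y′   ∎

  *P-distribʳ : ∀ z x y → (x +P y) *P z ≋ x *P z +P y *P z
  *P-distribʳ z []      y       = S.refl
  *P-distribʳ z (a ∷ x) []      = S.sym (+P-identityʳ _)
  *P-distribʳ z (a ∷ x) (b ∷ y) = begin
    scaleP (a ℤ.+ b) z +P (+ 0 ∷ ((x +P y) *P z))
      ≈⟨ +P-cong (+-scale a b z) (∷-cong ≡.refl (*P-distribʳ z x y)) ⟩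
    (scaleP a z +P scaleP b z) +P ((+ 0 ∷ (x *P z)) +P (+ 0 ∷ (y *P z)))
      ≈⟨ +P-interchange (scaleP a z) (scaleP b z) _ _ ⟩
    (scaleP a z +P (+ 0 ∷ (x *P z))) +P (scaleP b z +P (+ 0 ∷ (y *P z))) ∎

  scale-* : ∀ c x y → scaleP c x *P y ≋ scaleP c (x *P y)
  scale-* c []      y = S.refl
  scale-* c (a ∷ x) y = begin
    scaleP (c ℤ.* a) y +P (+ 0 ∷ (scaleP c x *P y))
      ≈⟨ +P-cong (S.sym (scale-scale c a y)) (∷-cong (≡.sym (ℤₚ.*-zeroʳ c)) (scale-* c x y)) ⟩
    scaleP c (scaleP a y) +P scaleP c (+ 0 ∷ (x *P y))
      ≈⟨ scale-+ c (scaleP a y) (+ 0 ∷ (x *P y)) ⟨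
    scaleP c (scaleP a y +P (+ 0 ∷ (x *P y))) ∎

  0∷-* : ∀ x y → (+ 0 ∷ x) *P y ≋ + 0 ∷ (x *P y)
  0∷-* x y = +P-cong (scale-0 y) S.refl

  *P-assoc : ∀ x y z → (x *P y) *P z ≋ x *P (y *P z)
  *P-assoc []      y z = S.refl
  *P-assoc (a ∷ x) y z = begin
    (scaleP a y +P (+ 0 ∷ (x *P y))) *P z
      ≈⟨ *P-distribʳ z (scaleP a y) (+ 0 ∷ (x *P y)) ⟩
    scaleP a y *P z +P (+ 0 ∷ (x *P y)) *P z
      ≈⟨ +P-cong (scale-* a y z) (S.trans (0∷-* (x *P y) z) (∷-cong ≡.refl (*P-assoc x y z))) ⟩
    scaleP a (y *P z) +P (+ 0 ∷ (x *P (y *P z))) ∎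

  *P-identityˡ : ∀ x → oneP *P x ≋ x
  *P-identityˡ x = begin
    scaleP (+ 1) x +P (+ 0 ∷ [])   ≈⟨ +P-cong (scale-1 x) 0∷[] ⟩
    x +P []                        ≈⟨ +P-identityʳ x ⟩
    x                              ∎

  polyRing : CommutativeRing 0ℓ 0ℓ
  polyRing = record
    { Carrier = Poly
    ; _≈_ = _≋_
    ; _+_ = _+P_
    ; _*_ = _*P_
    ; -_  = negP
    ; 0#  = []
    ; 1#  = oneP
    ; isCommutativeRing = mkIsCommutativeRing _≋_ ≋-isEquivalence
        +P-cong +P-assoc +P-comm (λ _ → S.refl) negP-cong negP-inverseˡ
        *P-cong *P-assoc *P-comm *P-identityˡ *P-distribʳ
    }

  -- Induction on x: the constant term of the product is that of x, so it is zero, and then d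
  -- annihilates the tail of x as well.
  constant-1-regular : ∀ d x → coeff d 0 ≡ + 1 → d *P x ≋ [] → x ≋ []
  constant-1-regular d []      d₀ e = S.refl
  constant-1-regular d (b ∷ x) d₀ e = S.trans (∷-cong b≡0 (constant-1-regular d x d₀ dx≋0)) 0∷[]
    where
    split : scaleP b d +P (+ 0 ∷ (d *P x)) ≋ []
    split = S.trans (S.sym (*P-∷ d b x)) e
    b≡0 : b ≡ + 0
    b≡0 = ≡.trans (≡.sym (≡.trans (coeff-+ (scaleP b d) (+ 0 ∷ (d *P x)) 0)
      (≡.trans (ℤₚ.+-identityʳ _) (≡.trans (coeff-scale b d 0) (≡.trans (≡.cong (b ℤ.*_) d₀) (ℤₚ.*-identityʳ b))))))
      (coeff-≡ split 0)
    dx≋0 : d *P x ≋ []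
    dx≋0 = tail-≋ {+ 0} {+ 0} (begin
      + 0 ∷ (d *P x)                       ≡⟨⟩
      [] +P (+ 0 ∷ (d *P x))               ≈⟨ +P-cong (S.sym (S.trans (scale-cong {x = d} b≡0 S.refl) (scale-0 d))) S.refl ⟩
      scaleP b d +P (+ 0 ∷ (d *P x))       ≈⟨ split ⟩
      []                                   ≈⟨ 0∷[] ⟨
      + 0 ∷ []                             ∎)

  qP : Poly
  qP = + 0 ∷ + 1 ∷ []

  0∷-as-* : ∀ x → + 0 ∷ x ≋ qP *P x
  0∷-as-* x = S.sym (S.trans (0∷-* oneP x) (∷-cong ≡.refl (*P-identityˡ x)))

  qP-regular : ∀ x → qP *P x ≋ [] → x ≋ []
  qP-regular x e = tail-≋ {+ 0} {+ 0} (S.trans (0∷-as-* x) (S.trans e (S.sym 0∷[])))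

  module K = CommutativeRing polyRing

  headP-≡ : ∀ x → headP x ≡ coeff x 0
  headP-≡ []      = ≡.refl
  headP-≡ (a ∷ x) = ≡.refl

  coeff-tailP : ∀ x i → coeff (tailP x) i ≡ coeff x (suc i)
  coeff-tailP []      i = ≡.refl
  coeff-tailP (a ∷ x) i = ≡.refl

  head∷tail : ∀ x → x ≋ headP x ∷ tailP x
  head∷tail []      = K.sym 0∷[]
  head∷tail (a ∷ x) = K.refl

  tailP-cong : ∀ {x y} → x ≋ y → tailP x ≋ tailP y
  tailP-cong {x} {y} e = mk≋ λ i → ≡.trans (coeff-tailP x i) (≡.trans (coeff-≡ e (suc i)) (≡.sym (coeff-tailP y i)))

  -- Since d has constant term 1, the heads of a and x agree, and subtracting that multiple of d
  -- leaves q times the product of the tail of x with d. The degree bound on x says that f steps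
  -- reach all its coefficients.
  divS-unique : ∀ f {a d x} → coeff d 0 ≡ + 1 → a ≋ x *P d → (∀ i → f ℕ.≤ i → coeff x i ≡ + 0) → divS f a d ≋ x
  divS-unique zero    d₀ e deg = mk≋ λ i → ≡.sym (deg i z≤n)
  divS-unique (suc f) {a} {d} {x} d₀ e deg = K.trans (∷-cong head≡ tail≋) (K.sym (head∷tail x))
    where
    split : x *P d ≋ scaleP (headP x) d +P (+ 0 ∷ (tailP x *P d))
    split = *P-cong (head∷tail x) (K.refl {d})
    head≡ : headP a ≡ headP x
    head≡ = ≡.trans (headP-≡ a) (≡.trans (coeff-≡ (K.trans e split) 0)
      (≡.trans (coeff-+ (scaleP (headP x) d) _ 0) (≡.trans (ℤₚ.+-identityʳ _)
      (≡.trans (coeff-scale (headP x) d 0) (≡.trans (≡.cong (headP x ℤ.*_) d₀) (ℤₚ.*-identityʳ (headP x)))))))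
    remainder : a -P scaleP (headP a) d ≋ + 0 ∷ (tailP x *P d)
    remainder = begin
      a -P scaleP (headP a) d
        ≈⟨ K.+-cong (K.trans e split) (K.-‿cong (scale-cong {x = d} head≡ K.refl)) ⟩
      (s +P t) -P s
        ≈⟨ K.trans (K.+-cong (K.+-comm s t) K.refl) (K.+-assoc t s (negP s)) ⟩
      t +P (s -P s)
        ≈⟨ K.trans (K.+-congˡ {t} (K.-‿inverseʳ s)) (K.+-identityʳ t) ⟩
      t ∎
      where
      s = scaleP (headP x) d
      t = + 0 ∷ (tailP x *P d)
    tail≋ : divS f (tailP (a -P scaleP (headP a) d)) d ≋ tailP x
    tail≋ = divS-unique f d₀ (tailP-cong remainder) λ i f≤i → ≡.trans (coeff-tailP x i) (deg (suc i) (s≤s f≤i))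

  length-+P : ∀ x y → length (x +P y) ≡ length x ℕ.⊔ length y
  length-+P []      y       = ≡.refl
  length-+P (a ∷ x) []      = ≡.refl
  length-+P (a ∷ x) (b ∷ y) = ≡.cong suc (length-+P x y)

  length-*P : ∀ {m n} x y → m ℕ.< length x → n ℕ.< length y → m ℕ.+ n ℕ.< length (x *P y)
  length-*P {zero}  {n} (a ∷ x) y       _         n<y = ℕₚ.≤-trans n<y (ℕₚ.≤-trans (ℕₚ.≤-reflexive (≡.sym (Listₚ.length-map _ y)))
    (ℕₚ.≤-trans (ℕₚ.m≤m⊔n _ _) (ℕₚ.≤-reflexive (≡.sym (length-+P (scaleP a y) _)))))
  length-*P {suc m} {n} (a ∷ x) y (s≤s m<x) n<y = ℕₚ.≤-trans (s≤s (length-*P x y m<x n<y))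
    (ℕₚ.≤-trans (ℕₚ.m≤n⊔m (length (scaleP a y)) _) (ℕₚ.≤-reflexive (≡.sym (length-+P (scaleP a y) _))))

  length-oneMinusQ : ∀ m → m ℕ.< length (oneMinusQ m)
  length-oneMinusQ m = ℕₚ.≤-trans (shifted m) (ℕₚ.≤-trans (ℕₚ.m≤n⊔m 1 _) (ℕₚ.≤-reflexive (≡.sym (length-+P oneP (negP (shiftP m oneP))))))
    where
    shifted : ∀ m → m ℕ.< length (negP (shiftP m oneP))
    shifted zero    = s≤s z≤n
    shifted (suc m) = s≤s (shifted m)

  numerator : ℕ → ℕ → Poly
  numerator n k = prodP (applyUpTo (λ i → oneMinusQ (n ∸ i)) k)

  denominator : ℕ → Poly
  denominator k = prodP (applyUpTo (λ i → oneMinusQ (suc i)) k)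

  -- n + (n-1) + ... with k summands, the degree of the numerator for k ≤ n. It also bounds the
  -- degree of the quotient, crudely but well enough for the number of division steps.
  degree : ℕ → ℕ → ℕ
  degree n       zero    = 0
  degree zero    (suc k) = 0
  degree (suc n) (suc k) = suc n ℕ.+ degree n k

  degree-suc : ∀ n k → degree n (suc k) ≡ degree n k ℕ.+ (n ∸ k)
  degree-suc zero    zero    = ≡.refl
  degree-suc zero    (suc k) = ≡.refl
  degree-suc (suc n) zero    = ℕₚ.+-identityʳ _
  degree-suc (suc n) (suc k) = ≡.trans (≡.cong (suc n ℕ.+_) (degree-suc n k)) (≡.sym (ℕₚ.+-assoc (suc n) _ _))

  length-numerator : ∀ {n k} → k ℕ.≤ n → degree n k ℕ.< length (numerator n k)
  length-numerator {n}     z≤n       = s≤s z≤n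
  length-numerator {suc n} {suc k} (s≤s k≤n) = length-*P (oneMinusQ (suc n)) (numerator n k) (length-oneMinusQ (suc n)) (length-numerator k≤n)

  -- The candidate for the quotient, a polynomial by construction thanks to the q-Pascal rule.
  gaussP : ℕ → ℕ → Poly
  gaussP n       zero    = oneP
  gaussP zero    (suc k) = []
  gaussP (suc n) (suc k) = gaussP n k +P shiftP (suc k) (gaussP n (suc k))

  shiftP-0 : ∀ m {x} → x ≋ [] → shiftP m x ≋ []
  shiftP-0 zero    e = e
  shiftP-0 (suc m) e = K.trans (∷-cong ≡.refl (shiftP-0 m e)) 0∷[]

  gaussP-< : ∀ {n k} → n ℕ.< k → gaussP n k ≋ []
  gaussP-< {zero}  {suc k} _         = K.refl
  gaussP-< {suc n} {suc k} (s≤s n<k) = K.+-cong (gaussP-< n<k) (shiftP-0 (suc k) (gaussP-< (ℕₚ.m<n⇒m<1+n n<k)))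

  shiftP-degree : ∀ m n {x} → (∀ i → n ℕ.< i → coeff x i ≡ + 0) → ∀ i → m ℕ.+ n ℕ.< i → coeff (shiftP m x) i ≡ + 0
  shiftP-degree zero    n deg i       lt       = deg i lt
  shiftP-degree (suc m) n deg (suc i) (s≤s lt) = shiftP-degree m n deg i lt

  gaussP-degree : ∀ n k i → degree n k ℕ.< i → coeff (gaussP n k) i ≡ + 0
  gaussP-degree n       zero    (suc i) _  = ≡.refl
  gaussP-degree zero    (suc k) i       _  = ≡.refl
  gaussP-degree (suc n) (suc k) i       lt = ≡.trans (coeff-+ (gaussP n k) _ i)
    (≡.cong₂ ℤ._+_ (gaussP-degree n k i (ℕₚ.≤-<-trans (ℕₚ.m≤n+m (degree n k) (suc n)) lt)) upper)
    where
    upper : coeff (shiftP (suc k) (gaussP n (suc k))) i ≡ + 0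
    upper with ℕₚ.≤-<-connex k n
    ... | inj₂ n<k = coeff-≡ (shiftP-0 (suc k) (gaussP-< (ℕₚ.m<n⇒m<1+n n<k))) i
    ... | inj₁ k≤n = shiftP-degree (suc k) (degree n (suc k)) (gaussP-degree n (suc k)) i (ℕₚ.≤-<-trans (ℕₚ.≤-reflexive eq) lt)
      where
      eq : suc k ℕ.+ degree n (suc k) ≡ suc n ℕ.+ degree n k
      eq = ≡.cong suc (≡.trans (≡.cong (k ℕ.+_) (≡.trans (degree-suc n k) (ℕₚ.+-comm (degree n k) _)))
        (≡.trans (≡.sym (ℕₚ.+-assoc k _ _)) (≡.cong (ℕ._+ degree n k) (ℕₚ.m+[n∸m]≡n k≤n))))

  coeff₀-* : ∀ x y → coeff (x *P y) 0 ≡ coeff x 0 ℤ.* coeff y 0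
  coeff₀-* []      y = ≡.sym (ℤₚ.*-zeroˡ (coeff y 0))
  coeff₀-* (a ∷ x) y = ≡.trans (coeff-+ (scaleP a y) _ 0) (≡.trans (ℤₚ.+-identityʳ _) (coeff-scale a y 0))

  denominator₀ : ∀ k → coeff (denominator k) 0 ≡ + 1
  denominator₀ k = product₀ (λ i → suc i) k (λ i → s≤s z≤n)
    where
    product₀ : ∀ (f : ℕ → ℕ) k → (∀ i → 0 ℕ.< f i) → coeff (prodP (applyUpTo (λ i → oneMinusQ (f i)) k)) 0 ≡ + 1
    product₀ f zero    pos = ≡.refl
    product₀ f (suc k) pos = ≡.trans (coeff₀-* (oneMinusQ (f 0)) _) (≡.cong₂ ℤ._*_ (factor₀ (f 0) (pos 0)) (product₀ (f ∘ suc) k (pos ∘ suc)))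
      where
      factor₀ : ∀ m → 0 ℕ.< m → coeff (oneMinusQ m) 0 ≡ + 1
      factor₀ (suc m) _ = ≡.refl

  q-integer₀ : ∀ n → coeff (QInteger.q-integer polyRing qP (suc n)) 0 ≡ + 1
  q-integer₀ n = ≡.trans (coeff-+ oneP (qP *P x) 0) (≡.cong (λ t → + 1 ℤ.+ t) (coeff-≡ (K.sym (0∷-as-* x)) 0))
    where x = QInteger.q-integer polyRing qP n

open Polynomials

-- Laurent polynomials inside the ring of fractions

module Transfer (Φ : FractionRing polyRing) where
  open FractionRing Φ using (emb; emb-cong; emb-injective; emb-+; emb-*; emb-neg; emb-0; emb-1)

  qRing : QRing
  qRing = FractionQRing.fractionQRing polyRing Φ qP qP-regular
    (λ x → constant-1-regular (oneP -P qP) x ≡.refl)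
    (λ n x → constant-1-regular (QInteger.q-integer polyRing qP (suc n)) x (q-integer₀ n))

  open QCalculus qRing
  open Algebra.Properties.Ring ring using (-‿distribʳ-*)

  emb-0∷ : ∀ x → emb (+ 0 ∷ x) ≈ q * emb x
  emb-0∷ x = trans (emb-cong (0∷-as-* x)) (emb-* qP x)

  emb-shift : ∀ m x → emb (shiftP m x) ≈ q ^ m * emb x
  emb-shift zero    x = sym (*-identityˡ _)
  emb-shift (suc m) x = trans (emb-0∷ (shiftP m x)) (trans (*-congˡ (emb-shift m x)) (sym (*-assoc _ _ _)))

  emb-- : ∀ x y → emb (x -P y) ≈ emb x - emb y
  emb-- x y = trans (emb-+ x (negP y)) (+-congˡ (emb-neg y))

  emb-^P : ∀ x m → emb (x ^P m) ≈ emb x ^ m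
  emb-^P x zero    = emb-1
  emb-^P x (suc m) = trans (emb-* x (x ^P m)) (*-congˡ (emb-^P x m))

  emb-qint : ∀ m → emb (qint m) ≈ ⟦ m ⟧
  emb-qint zero    = trans emb-0 (sym ⟦0⟧)
  emb-qint (suc m) = begin
    emb (oneP +P (+ 0 ∷ qint m))      ≈⟨ emb-+ oneP (+ 0 ∷ qint m) ⟩
    emb oneP + emb (+ 0 ∷ qint m)     ≈⟨ +-cong emb-1 (trans (emb-0∷ (qint m)) (*-congˡ (emb-qint m))) ⟩
    1# + q * ⟦ m ⟧                    ≈⟨ ⟦1+⟧ m ⟨
    ⟦ suc m ⟧                         ∎

  emb-oneMinusQ : ∀ m → emb (oneMinusQ m) ≈ (1# - q) * ⟦ m ⟧
  emb-oneMinusQ m = begin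
    emb (oneMinusQ m)                   ≈⟨ emb-- oneP (shiftP m oneP) ⟩
    emb oneP - emb (shiftP m oneP)      ≈⟨ +-cong emb-1 (-‿cong (trans (emb-shift m oneP) (*-congˡ emb-1))) ⟩
    1# - q ^ m * 1#                     ≈⟨ solve 1 (λ a → con (+ 1) :- a :* con (+ 1) := con (+ 1) :* (con (+ 1) :- a)) refl (q ^ m) ⟩
    1# * (1# - q ^ m)                   ≈⟨ *-congʳ [1-q]*ρ≈1 ⟨
    (1# - q) * ρ * (1# - q ^ m)
        ≈⟨ solve 3 (λ a b c →
          (con (+ 1) :- a) :* c :* (con (+ 1) :- b)
          := (con (+ 1) :- a) :* ((con (+ 1) :- b) :* c))
        refl q (q ^ m) ρ ⟩
    (1# - q) * ⟦ m ⟧                    ∎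

  emb-numerator : ∀ b k → emb (numerator (k ℕ.+ b) k) * fac b ≈ (1# - q) ^ k * fac (k ℕ.+ b)
  emb-numerator b zero    = *-congʳ emb-1
  emb-numerator b (suc k) = begin
    emb (oneMinusQ (suc (k ℕ.+ b)) *P numerator (k ℕ.+ b) k) * fac b
      ≈⟨ *-congʳ (trans (emb-* _ _) (*-congʳ (emb-oneMinusQ (suc (k ℕ.+ b))))) ⟩
    (1# - q) * ⟦ suc (k ℕ.+ b) ⟧ * emb (numerator (k ℕ.+ b) k) * fac b
      ≈⟨ *-assoc _ _ _ ⟩
    (1# - q) * ⟦ suc (k ℕ.+ b) ⟧ * (emb (numerator (k ℕ.+ b) k) * fac b)
      ≈⟨ *-congˡ (emb-numerator b k) ⟩
    (1# - q) * ⟦ suc (k ℕ.+ b) ⟧ * ((1# - q) ^ k * fac (k ℕ.+ b))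
      ≈⟨ solve 4 (λ a b c d →
            (a) :* b :* (c :* d)
            := (a) :* c :* (b :* d))
          refl (1# - q) (⟦ suc (k ℕ.+ b) ⟧) ((1# - q) ^ k) (fac (k ℕ.+ b)) ⟩
    (1# - q) * (1# - q) ^ k * (⟦ suc (k ℕ.+ b) ⟧ * fac (k ℕ.+ b)) ∎

  -- `prodP` splits off its first factor, while the recursion of the factorial needs the last one.
  emb-prodP-last : ∀ f k → emb (prodP (applyUpTo f (suc k))) ≈ emb (prodP (applyUpTo f k)) * emb (f k)
  emb-prodP-last f zero    = trans (emb-* (f 0) oneP) (*-comm _ _)
  emb-prodP-last f (suc k) = begin
    emb (f 0 *P prodP (applyUpTo (f ∘ suc) (suc k)))               ≈⟨ emb-* _ _ ⟩
    emb (f 0) * emb (prodP (applyUpTo (f ∘ suc) (suc k)))          ≈⟨ *-congˡ (emb-prodP-last (f ∘ suc) k) ⟩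
    emb (f 0) * (emb (prodP (applyUpTo (f ∘ suc) k)) * emb (f (suc k)))
      ≈⟨ trans (*-congʳ (emb-* _ _)) (*-assoc _ _ _) ⟨
    emb (prodP (applyUpTo f (suc k))) * emb (f (suc k))            ∎

  emb-denominator : ∀ k → emb (denominator k) ≈ (1# - q) ^ k * fac k
  emb-denominator zero    = trans emb-1 (sym (*-identityˡ 1#))
  emb-denominator (suc k) = begin
    emb (denominator (suc k))
      ≈⟨ emb-prodP-last (λ i → oneMinusQ (suc i)) k ⟩
    emb (denominator k) * emb (oneMinusQ (suc k))
      ≈⟨ *-cong (emb-denominator k) (emb-oneMinusQ (suc k)) ⟩
    (1# - q) ^ k * fac k * ((1# - q) * ⟦ suc k ⟧)
      ≈⟨ solve 4 (λ a b c d →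
            a :* b :* ((c) :* d)
            := (c) :* a :* (d :* b))
          refl ((1# - q) ^ k) (fac k) (1# - q) (⟦ suc k ⟧) ⟩
    (1# - q) * (1# - q) ^ k * (⟦ suc k ⟧ * fac k) ∎

  emb-gaussP : ∀ a b → emb (gaussP (a ℕ.+ b) a) ≈ gaussian a b
  emb-gaussP zero    b       = trans emb-1 (sym (gaussian-0ˡ b))
  emb-gaussP (suc a) zero    = begin
    emb (gaussP (a ℕ.+ 0) a +P shiftP (suc a) (gaussP (a ℕ.+ 0) (suc a)))
      ≈⟨ emb-cong (K.+-congˡ {gaussP (a ℕ.+ 0) a} (shiftP-0 (suc a) (gaussP-< (s≤s (ℕₚ.≤-reflexive (ℕₚ.+-identityʳ a)))))) ⟩
    emb (gaussP (a ℕ.+ 0) a +P [])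
      ≈⟨ emb-cong (K.+-identityʳ _) ⟩
    emb (gaussP (a ℕ.+ 0) a)
      ≈⟨ emb-gaussP a 0 ⟩
    gaussian a 0
      ≈⟨ trans (gaussian-0ʳ a) (sym (gaussian-0ʳ (suc a))) ⟩
    gaussian (suc a) 0 ∎
  emb-gaussP (suc a) (suc b) = begin
    emb (gaussP (a ℕ.+ suc b) a +P shiftP (suc a) (gaussP (a ℕ.+ suc b) (suc a)))
      ≈⟨ emb-+ (gaussP (a ℕ.+ suc b) a) _ ⟩
    emb (gaussP (a ℕ.+ suc b) a) + emb (shiftP (suc a) (gaussP (a ℕ.+ suc b) (suc a)))
      ≈⟨ +-cong (emb-gaussP a (suc b)) (trans (emb-shift (suc a) _) (*-congˡ (trans (reflexive (≡.cong (λ n → emb (gaussP n (suc a))) (ℕₚ.+-suc a b))) (emb-gaussP (suc a) b)))) ⟩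
    gaussian a (suc b) + q ^ suc a * gaussian (suc a) b
      ≈⟨ gaussian-pascal a b ⟨
    gaussian (suc a) (suc b) ∎

  -- Verified in the ring of fractions, where both sides are quotients of q-factorials, and pulled
  -- back along the injective `emb`.
  gaussP*denominator : ∀ a b → numerator (a ℕ.+ b) a ≋ gaussP (a ℕ.+ b) a *P denominator a
  gaussP*denominator a b = emb-injective (begin
    emb (numerator (a ℕ.+ b) a)
      ≈⟨ absorb (fac*ι b) ⟨
    fac b * ι b * emb (numerator (a ℕ.+ b) a)
      ≈⟨ solve 3 (λ a b c →
            a :* b :* c
            := b :* (c :* a))
          refl (fac b) (ι b) (emb (numerator (a ℕ.+ b) a)) ⟩
    ι b * (emb (numerator (a ℕ.+ b) a) * fac b)
      ≈⟨ *-congˡ (emb-numerator b a) ⟩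
    ι b * ((1# - q) ^ a * fac (a ℕ.+ b))
      ≈⟨ absorb (fac*ι a) ⟨
    fac a * ι a * (ι b * ((1# - q) ^ a * fac (a ℕ.+ b)))
      ≈⟨ solve 5 (λ a b c d e →
            a :* b :* (c :* (d :* e))
            := e :* (b :* c) :* (d :* a))
          refl (fac a) (ι a) (ι b) ((1# - q) ^ a) (fac (a ℕ.+ b)) ⟩
    fac (a ℕ.+ b) * (ι a * ι b) * ((1# - q) ^ a * fac a)
      ≈⟨ *-cong (emb-gaussP a b) (emb-denominator a) ⟨
    emb (gaussP (a ℕ.+ b) a) * emb (denominator a)
      ≈⟨ emb-* _ _ ⟨
    emb (gaussP (a ℕ.+ b) a *P denominator a) ∎)

  emb-qbinomℕ : ∀ a b {n} → a ℕ.+ b ≡ n → emb (qbinomℕ n a) ≈ fac n * (ι a * ι b)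
  emb-qbinomℕ a b ≡.refl = trans (emb-cong (K.trans (K.reflexive unfold) quotient)) (emb-gaussP a b)
    where
    n = a ℕ.+ b
    -- The factors agree without proof: `suc n ∸ suc i` reduces to `n ∸ i`.
    unfold : qbinomℕ n a ≡ divP (numerator n a) (denominator a)
    unfold = ≡.cong₂ (λ x y → divP (prodP x) (prodP y)) (Listₚ.map-applyUpTo id _ a) (Listₚ.map-applyUpTo id _ a)
    quotient : divP (numerator n a) (denominator a) ≋ gaussP n a
    quotient = divS-unique (length (numerator n a)) (denominator₀ a) (gaussP*denominator a b)
      λ i len≤i → gaussP-degree n a i (ℕₚ.≤-trans (length-numerator (ℕₚ.m≤m+n a b)) len≤i)

  φ : Laurent → Carrier
  φ (e , x) = p ^ e * emb x

  φ-+ : ∀ x y → φ (x +L y) ≈ φ x + φ y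
  φ-+ (e , x) (f , y) = begin
    p ^ (e ℕ.+ f) * emb (shiftP f x +P shiftP e y)
      ≈⟨ *-cong (^-homo-* p e f) (trans (emb-+ (shiftP f x) (shiftP e y)) (+-cong (emb-shift f x) (emb-shift e y))) ⟩
    p ^ e * p ^ f * (q ^ f * emb x + q ^ e * emb y)
      ≈⟨ solve 6 (λ a b c d e f →
            a :* b :* (c :* e :+ d :* f)
            := c :* b :* (a :* e) :+ d :* a :* (b :* f))
          refl (p ^ e) (p ^ f) (q ^ f) (q ^ e) (emb x) (emb y) ⟩
    q ^ f * p ^ f * (p ^ e * emb x) + q ^ e * p ^ e * (p ^ f * emb y)
      ≈⟨ +-cong (absorb (q^*p^ f)) (absorb (q^*p^ e)) ⟩
    p ^ e * emb x + p ^ f * emb y ∎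

  φ-* : ∀ x y → φ (x *L y) ≈ φ x * φ y
  φ-* (e , x) (f , y) = begin
    p ^ (e ℕ.+ f) * emb (x *P y)               ≈⟨ *-cong (^-homo-* p e f) (emb-* x y) ⟩
    p ^ e * p ^ f * (emb x * emb y)
        ≈⟨ solve 4 (λ a b c d →
          a :* b :* (c :* d)
          := a :* c :* (b :* d))
        refl (p ^ e) (p ^ f) (emb x) (emb y) ⟩
    p ^ e * emb x * (p ^ f * emb y)            ∎

  φ-neg : ∀ x → φ (negL x) ≈ - φ x
  φ-neg (e , x) = trans (*-congˡ (emb-neg x)) (sym (-‿distribʳ-* _ _))

  φ-poly : ∀ x → φ (poly x) ≈ emb x
  φ-poly x = *-identityˡ _

  φ-reflects : ∀ x y → φ x ≈ φ y → x ≈L y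
  φ-reflects (e , x) (f , y) h = coeff-≡ (emb-injective (begin
    emb (shiftP f x)                       ≈⟨ emb-shift f x ⟩
    q ^ f * emb x                          ≈⟨ absorb (q^*p^ e) ⟨
    q ^ e * p ^ e * (q ^ f * emb x)
        ≈⟨ solve 4 (λ a b c d →
          a :* b :* (c :* d)
          := a :* c :* (b :* d))
        refl (q ^ e) (p ^ e) (q ^ f) (emb x) ⟩
    q ^ e * q ^ f * (p ^ e * emb x)        ≈⟨ *-congˡ h ⟩
    q ^ e * q ^ f * (p ^ f * emb y)
        ≈⟨ solve 4 (λ a b c d →
          a :* c :* (b :* d)
          := c :* b :* (a :* d))
        refl (q ^ e) (p ^ f) (q ^ f) (emb y) ⟩
    q ^ f * p ^ f * (q ^ e * emb y)        ≈⟨ absorb (q^*p^ f) ⟩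
    q ^ e * emb y                          ≈⟨ emb-shift e y ⟨
    emb (shiftP e y)                       ∎))

  φ-0 : φ zeroL ≈ 0#
  φ-0 = trans (φ-poly []) emb-0

  φ-sum : ∀ n f → φ (sumL n f) ≈ ∑ (suc n) (λ k → φ (f k))
  φ-sum n f = trans (reflexive (≡.cong (λ l → φ (foldr _+L_ zeroL l)) (Listₚ.map-applyUpTo id f (suc n)))) (φ-foldr (suc n) f)
    where
    φ-foldr : ∀ n f → φ (foldr _+L_ zeroL (applyUpTo f n)) ≈ ∑ n (λ k → φ (f k))
    φ-foldr zero    f = φ-0
    φ-foldr (suc n) f = trans (φ-+ (f 0) _) (trans (+-congˡ (φ-foldr n (f ∘ suc))) (sym (∑-head n)))

  φ-qpow-⊖ : ∀ a b → φ (qpow (a ℤ.⊖ b)) ≈ q ^ a * p ^ b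
  φ-qpow-⊖ zero    zero    = *-congˡ emb-1
  φ-qpow-⊖ (suc a) zero    = trans (φ-poly _) (trans (emb-shift (suc a) oneP) (*-congˡ emb-1))
  φ-qpow-⊖ zero    (suc b) = trans (*-congˡ emb-1) (*-comm _ _)
  φ-qpow-⊖ (suc a) (suc b) = begin
    φ (qpow (suc a ℤ.⊖ suc b))      ≡⟨ ≡.cong (λ z → φ (qpow z)) (ℤₚ.[1+m]⊖[1+n]≡m⊖n a b) ⟩
    φ (qpow (a ℤ.⊖ b))              ≈⟨ φ-qpow-⊖ a b ⟩
    q ^ a * p ^ b                   ≈⟨ absorb q*p≈1 ⟨
    q * p * (q ^ a * p ^ b)
        ≈⟨ solve 4 (λ a b c d →
          a :* b :* (c :* d)
          := a :* c :* (b :* d))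
        refl q p (q ^ a) (p ^ b) ⟩
    q * q ^ a * (p * p ^ b)         ∎

  φ-qpow : ∀ {z} a b → z ≡ + a ℤ.- + b → φ (qpow z) ≈ q ^ a * p ^ b
  φ-qpow a b e = trans (reflexive (≡.cong (λ z → φ (qpow z)) (≡.trans e (ℤₚ.m-n≡m⊖n a b)))) (φ-qpow-⊖ a b)

-- Arithmetic of indices and exponents

double : ∀ n → n ℕ.+ n ≡ 2 ℕ.* n
double n = ≡.cong (n ℕ.+_) (≡.sym (ℕₚ.+-identityʳ n))

half : ∀ m n → (m ℕ.+ suc n) ℕ.% 2 ≡ 1 → Σ ℕ λ a → m ℕ.+ n ≡ a ℕ.+ a
half m n odd = a , ≡.trans (ℕₚ.suc-injective (≡.trans (≡.sym (ℕₚ.+-suc m n)) (≡.trans (DivMod.m≡m%n+[m/n]*n (m ℕ.+ suc n) 2) (≡.cong (ℕ._+ a ℕ.* 2) odd))))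
                     (≡.trans (ℕₚ.*-comm a 2) (≡.sym (double a)))
  where a = (m ℕ.+ suc n) ℕ./ 2

C2-suc : ∀ k → suc k C 2 ≡ k ℕ.+ k C 2
C2-suc k = ≡.trans (≡.sym (nCk+nC[k+1]≡[n+1]C[k+1] k 1)) (≡.cong (ℕ._+ k C 2) (nC1≡n k))

[m+n]-m : ∀ m n → + (m ℕ.+ n) ℤ.- + m ≡ + n
[m+n]-m m n = ≡.trans (ℤₚ.m-n≡m⊖n (m ℕ.+ n) m) (≡.trans (ℤₚ.⊖-≥ (ℕₚ.m≤m+n m n)) (≡.cong +_ (ℕₚ.m+n∸m≡n m n)))

ballot-≡ : ∀ n k i → k ℕ.+ i ≡ n → ballot n k ≡ qbinom (2 ℕ.* n) (+ i) -P qbinom (2 ℕ.* n) (+ i ℤ.- + 1)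
ballot-≡ n k i ≡.refl = ≡.cong (λ z → qbinom (2 ℕ.* (k ℕ.+ i)) z -P qbinom (2 ℕ.* (k ℕ.+ i)) (z ℤ.- + 1)) ([m+n]-m k i)

-- The k split off from -(r-1)k joins c = k(k-1)/2 to give the exponent k(k+1)/2 of `alt`; what
-- remains negative is rk, as in the first sum.
alternating-exponent : ∀ c e r k → + c ℤ.+ + e ℤ.- (+ r ℤ.- + 1) ℤ.* + k ≡ + (k ℕ.+ c ℕ.+ e) ℤ.- + (r ℕ.* k)
alternating-exponent c e r k = ≡.trans
  (solve 4 (λ c e r k → c :+ e :- (r :- con (+ 1)) :* k := k :+ c :+ e :- r :* k) ≡.refl (+ c) (+ e) (+ r) (+ k))
  (≡.cong (λ z → + (k ℕ.+ c ℕ.+ e) ℤ.- z) (≡.sym (ℤₚ.pos-* r k)))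
  where open Data.Integer.Solver.+-*-Solver

-- Ballot numbers in the ring of fractions

module BallotTransfer (Φ : FractionRing polyRing) where
  open FractionRing Φ using (emb; emb-0)
  open Transfer Φ
  open QCalculus qRing

  emb-central : ∀ n → emb (qbinom (2 ℕ.* n) (+ n)) ≈ gaussian n n
  emb-central n = trans (emb-qbinomℕ n n (double n)) (*-congʳ (reflexive (≡.cong fac (≡.sym (double n)))))

  -- The lower parts of the two q-binomials are n-k, n+k and n-k-1, n+k+1: up to [2n]! they are the
  -- two terms of `κι-diff n k`.
  emb-qbinom-difference : ∀ M n k i → k ℕ.+ i ≡ n → n ℕ.+ n ≡ M →
    emb (qbinom M (+ i) -P qbinom M (+ i ℤ.- + 1)) ≈ q ^ n * (v k * (fac M * w n k))
  emb-qbinom-difference M n k i k+i≡n 2n≡M = begin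
    emb (qbinom M (+ i) -P qbinom M (+ i ℤ.- + 1))
      ≈⟨ emb-- (qbinom M (+ i)) (qbinom M (+ i ℤ.- + 1)) ⟩
    emb (qbinom M (+ i)) - emb (qbinom M (+ i ℤ.- + 1))
      ≈⟨ +-cong upper (-‿cong (lower i k+i≡n)) ⟩
    fac M * (κ n k * ι (n ℕ.+ k)) - fac M * (κ n (suc k) * ι (n ℕ.+ suc k))
      ≈⟨ solve 5 (λ a b c d e →
            a :* (b :* c) :- a :* (d :* e)
            := a :* (b :* c :- d :* e))
          refl (fac M) (κ n k) (ι (n ℕ.+ k)) (κ n (suc k)) (ι (n ℕ.+ suc k)) ⟩
    fac M * (κ n k * ι (n ℕ.+ k) - κ n (suc k) * ι (n ℕ.+ suc k))
      ≈⟨ *-congˡ (κι-diff n k) ⟩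
    fac M * (q ^ n * (v k * w n k * 1#))
      ≈⟨ solve 4 (λ a b c d →
            a :* (b :* (c :* d :* con (+ 1)))
            := b :* (c :* (a :* d)))
          refl (fac M) (q ^ n) (v k) (w n k) ⟩
    q ^ n * (v k * (fac M * w n k)) ∎
    where
    regroup : ∀ i m → i ℕ.+ (n ℕ.+ m) ≡ (m ℕ.+ i) ℕ.+ n
    regroup i m = ≡.trans (ℕₚ.+-comm i (n ℕ.+ m)) (≡.trans (ℕₚ.+-assoc n m i) (ℕₚ.+-comm n (m ℕ.+ i)))
    sum-upper : i ℕ.+ (n ℕ.+ k) ≡ M
    sum-upper = ≡.trans (regroup i k) (≡.trans (≡.cong (ℕ._+ n) k+i≡n) 2n≡M)
    sum-lower : ∀ j → suc (k ℕ.+ j) ≡ n → j ℕ.+ (n ℕ.+ suc k) ≡ M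
    sum-lower j e = ≡.trans (regroup j (suc k)) (≡.trans (≡.cong (ℕ._+ n) e) 2n≡M)
    upper : emb (qbinom M (+ i)) ≈ fac M * (κ n k * ι (n ℕ.+ k))
    upper = trans (emb-qbinomℕ i (n ℕ.+ k) sum-upper)
      (*-congˡ (*-congʳ (reflexive (≡.sym (≡.trans (≡.cong (λ m → κ m k) (≡.sym k+i≡n)) (κ-+ k i))))))
    lower : ∀ i → k ℕ.+ i ≡ n → emb (qbinom M (+ i ℤ.- + 1)) ≈ fac M * (κ n (suc k) * ι (n ℕ.+ suc k))
    -- Here k = n: the lower entry is -1, so the q-binomial is zero by convention, and `κ n (suc k)`
    -- vanishes as well.
    lower zero    e = trans emb-0 (sym (trans (*-congˡ (trans (*-congʳ (reflexive (κ-< (s≤s (ℕₚ.≤-reflexive (≡.trans (≡.sym e) (ℕₚ.+-identityʳ k))))))) (zeroˡ _))) (zeroʳ _)))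
    lower (suc j) e = trans (emb-qbinomℕ j (n ℕ.+ suc k) (sum-lower j (≡.trans (≡.sym (ℕₚ.+-suc k j)) e)))
      (*-congˡ (*-congʳ (reflexive (≡.sym (≡.trans (≡.cong (λ m → κ m (suc k)) (≡.trans (≡.sym e) (ℕₚ.+-suc k j))) (κ-+ (suc k) j))))))

  -- let rather than with: a with-abstraction would normalise the goal and
  -- unfold the power series division hidden in ballot.
  emb-ballot : ∀ n k → k ℕ.≤ n → emb (ballot n k) ≈ q ^ n * (v k * (fac (n ℕ.+ n) * w n k))
  emb-ballot n k k≤n = let i , k+i≡n = ℕₚ.m≤n⇒∃[o]m+o≡n k≤n in
    trans (reflexive (≡.cong emb (ballot-≡ n k i k+i≡n)))
    (trans (emb-qbinom-difference (2 ℕ.* n) n k i k+i≡n (double n))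
    (*-congˡ (*-congˡ (*-congʳ (reflexive (≡.cong fac (≡.sym (double n))))))))

  emb-power-product : ∀ n k r s → k ℕ.≤ n →
    φ (poly (qint (2 ℕ.* k ℕ.+ 1) ^P r)) * φ (poly (ballot n k ^P s))
    ≈ ⟦ suc (k ℕ.+ k) ⟧ ^ r * ((q ^ n) ^ s * (v k ^ s * (fac (n ℕ.+ n) * w n k) ^ s))
  emb-power-product n k r s k≤n = *-cong
    (trans (φ-poly _) (trans (emb-^P _ r) (^-congˡ r (trans (reflexive (≡.cong (λ m → emb (qint m)) (≡.trans (ℕₚ.+-comm (2 ℕ.* k) 1) (≡.cong suc (≡.sym (double k)))))) (emb-qint (suc (k ℕ.+ k)))))))
    (trans (φ-poly _) (trans (emb-^P _ s) (trans (^-congˡ s (emb-ballot n k k≤n))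
      (trans (^-distrib-* (q ^ n) (v k * (fac (n ℕ.+ n) * w n k)) s) (*-congˡ (^-distrib-* (v k) (fac (n ℕ.+ n) * w n k) s))))))

-- The two congruences

module Conclusion (Φ : FractionRing polyRing) (n : ℕ) where
  open FractionRing Φ using (emb; emb-*; emb-1)
  open Transfer Φ
  open BallotTransfer Φ
  open QCalculus qRing
  open Moments qRing n
  open Divisibility qRing n
  open Algebra.Properties.Ring ring using (-‿distribˡ-*; -0#≈0#)

  q-power : ∀ k j → q ^ (j ℕ.* (k ℕ.* k ℕ.+ k)) ≈ (q ^ (k ℕ.* k ℕ.+ k)) ^ j
  q-power k j = trans (reflexive (≡.cong (q ^_) (ℕₚ.*-comm j (k ℕ.* k ℕ.+ k)))) (sym (^-assocʳ q (k ℕ.* k ℕ.+ k) j))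

  summand-split : ∀ r s j f k →
    (q ^ N) ^ s * summand r s j f k
    ≈ f k * (q ^ (j ℕ.* (k ℕ.* k ℕ.+ k)) * p ^ (r ℕ.* k)) * (⟦ suc (k ℕ.+ k) ⟧ ^ r * ((q ^ N) ^ s * (v k ^ s * ω k ^ s)))
  summand-split r s j f k = begin
    B * (v k ^ (r ℕ.+ s) * ω k ^ s * ((q ^ (k ℕ.* k ℕ.+ k)) ^ j * f k))
      ≈⟨ *-congˡ (*-congʳ (*-congʳ (trans (^-homo-* (v k) r s) (*-congʳ v-power)))) ⟩
    B * (p ^ (r ℕ.* k) * ⟦ suc (k ℕ.+ k) ⟧ ^ r * v k ^ s * ω k ^ s * ((q ^ (k ℕ.* k ℕ.+ k)) ^ j * f k))
      ≈⟨ *-congˡ (*-congˡ (*-congʳ (q-power k j))) ⟨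
    B * (p ^ (r ℕ.* k) * ⟦ suc (k ℕ.+ k) ⟧ ^ r * v k ^ s * ω k ^ s * (q ^ (j ℕ.* (k ℕ.* k ℕ.+ k)) * f k))
      ≈⟨ solve 7 (λ a b c d e f g →
            a :* (b :* c :* d :* e :* (f :* g))
            := g :* (f :* b) :* (c :* (a :* (d :* e))))
          refl B (p ^ (r ℕ.* k)) (⟦ suc (k ℕ.+ k) ⟧ ^ r) (v k ^ s) (ω k ^ s) (q ^ (j ℕ.* (k ℕ.* k ℕ.+ k))) (f k) ⟩
    f k * (q ^ (j ℕ.* (k ℕ.* k ℕ.+ k)) * p ^ (r ℕ.* k)) * (⟦ suc (k ℕ.+ k) ⟧ ^ r * (B * (v k ^ s * ω k ^ s))) ∎
    where
    B = (q ^ N) ^ s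
    v-power : v k ^ r ≈ p ^ (r ℕ.* k) * ⟦ suc (k ℕ.+ k) ⟧ ^ r
    v-power = trans (^-distrib-* (p ^ k) _ r) (*-congʳ (trans (^-assocʳ p k r) (reflexive (≡.cong (p ^_) (ℕₚ.*-comm k r)))))

  φ-sign : ∀ k → alt k ≈ φ (signL k) * q ^ (k ℕ.+ k C 2)
  φ-sign zero    = sym (trans (*-identityʳ _) (trans (φ-poly oneP) emb-1))
  φ-sign (suc k) = begin
    - (q ^ suc k * alt k)
      ≈⟨ -‿cong (*-congˡ (φ-sign k)) ⟩
    - (q ^ suc k * (φ (signL k) * q ^ (k ℕ.+ k C 2)))
      ≈⟨ -‿cong (trans (sym (*-assoc _ _ _)) (trans (*-congʳ (*-comm _ _)) (*-assoc _ _ _))) ⟩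
    - (φ (signL k) * (q ^ suc k * q ^ (k ℕ.+ k C 2)))
      ≈⟨ -‿distribˡ-* _ _ ⟩
    - φ (signL k) * (q ^ suc k * q ^ (k ℕ.+ k C 2))
      ≈⟨ *-cong (φ-neg (signL k)) (trans (reflexive (≡.cong (λ m → q ^ (suc k ℕ.+ m)) (C2-suc k))) (q^-+ (suc k) (k ℕ.+ k C 2))) ⟨
    φ (negL (signL k)) * q ^ (suc k ℕ.+ suc k C 2) ∎

  -- Integrality of c means that q^e c is a polynomial y, so the quotient is q^(Ns) y with
  -- denominator q^e.
  laurent-quotient : ∀ s {x c} → Integral c → x ≈ (q ^ N) ^ s * (c * central) → Σ Laurent λ Y → x ≈ φ Y * central
  laurent-quotient s {x} {c} (e , y , q^e*c) x≈ = (e , qN ^P s *P y) , trans x≈ (trans (sym (*-assoc _ _ _)) (*-congʳ (sym quotient)))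
    where
    qN : Poly
    qN = shiftP N oneP
    quotient : φ (e , qN ^P s *P y) ≈ (q ^ N) ^ s * c
    quotient = begin
      p ^ e * emb (qN ^P s *P y)
        ≈⟨ *-congˡ (trans (emb-* (qN ^P s) y) (*-cong (emb-^P qN s) (sym q^e*c))) ⟩
      p ^ e * (emb qN ^ s * (q ^ e * c))
        ≈⟨ *-congˡ (*-congʳ (^-congˡ s (trans (emb-shift N oneP) (trans (*-congˡ emb-1) (*-identityʳ _))))) ⟩
      p ^ e * ((q ^ N) ^ s * (q ^ e * c))
        ≈⟨ solve 4 (λ a b c d →
              a :* (b :* (c :* d))
              := c :* a :* (b :* d))
            refl (p ^ e) ((q ^ N) ^ s) (q ^ e) c ⟩
      q ^ e * p ^ e * ((q ^ N) ^ s * c)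
        ≈⟨ absorb (q^*p^ e) ⟩
      (q ^ N) ^ s * c ∎

  central-divides-∑ : ∀ r s j {f} → ℕ.NonZero s → (r ℕ.+ s) ℕ.% 2 ≡ 1 → Admissible f →
    Σ Laurent λ Y → ∑ (suc N) (λ k → (q ^ N) ^ s * summand r s j f k) ≈ φ Y * central
  central-divides-∑ r (suc s) j {f} _ odd adm =
    let a , r+s≡2a = half r s odd
        c , int-c , sum≈ = central-divides r s j a r+s≡2a adm
    in laurent-quotient (suc s) int-c (trans (sym (*-∑ (suc N))) (*-congˡ sum≈))

  φ-divides : ∀ {D} (A Y : Laurent) → emb D ≈ central → φ A ≈ φ Y * central → A ≡ zeroL [modP D ]
  φ-divides {D} A Y D≈ A≈ = Y , φ-reflects (A -L zeroL) (Y *L poly D) (begin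
    φ (A -L zeroL)            ≈⟨ trans (φ-+ A (negL zeroL)) (+-congˡ (trans (φ-neg zeroL) (trans (-‿cong φ-0) -0#≈0#))) ⟩
    φ A + 0#                  ≈⟨ +-identityʳ _ ⟩
    φ A                       ≈⟨ A≈ ⟩
    φ Y * central             ≈⟨ *-congˡ (trans (φ-poly D) D≈) ⟨
    φ Y * φ (poly D)          ≈⟨ φ-* Y (poly D) ⟨
    φ (Y *L poly D)           ∎)

  central-divides-sum : ∀ r s j {f} → ℕ.NonZero s → (r ℕ.+ s) ℕ.% 2 ≡ 1 → Admissible f → (term : ℕ → Laurent) →
    (∀ k → k ℕ.< suc N → φ (term k) ≈ (q ^ N) ^ s * summand r s j f k) →
    sumL N term ≡ zeroL [modP qbinom (2 ℕ.* N) (+ N) ]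
  central-divides-sum r s j s≢0 odd adm term φ-term =
    let Y , ∑≈ = central-divides-∑ r s j s≢0 odd adm in
    φ-divides (sumL N term) Y (emb-central N) (trans (φ-sum N term) (trans (∑-cong-< (suc N) φ-term) ∑≈))

  ballot-sum : ∀ r s j → ℕ.NonZero s → (r ℕ.+ s) ℕ.% 2 ≡ 1 →
    sumL N (λ k → qpow (+ (j ℕ.* (k ℕ.* k ℕ.+ k)) ℤ.- + (r ℕ.* k))
                  *L poly (qint (2 ℕ.* k ℕ.+ 1) ^P r) *L poly (ballot N k ^P s))
      ≡ zeroL [modP qbinom (2 ℕ.* N) (+ N) ]
  ballot-sum r s j s≢0 odd = central-divides-sum r s j s≢0 odd adm-1 (λ k → Qk k *L Rk k *L Sk k) λ k k≤N → begin
    φ (Qk k *L Rk k *L Sk k)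
      ≈⟨ trans (φ-* (Qk k *L Rk k) (Sk k)) (trans (*-congʳ (φ-* (Qk k) (Rk k))) (*-assoc _ _ _)) ⟩
    φ (Qk k) * (φ (Rk k) * φ (Sk k))
      ≈⟨ *-cong (trans (φ-qpow (j ℕ.* (k ℕ.* k ℕ.+ k)) (r ℕ.* k) ≡.refl) (sym (*-identityˡ _))) (emb-power-product N k r s (ℕₚ.≤-pred k≤N)) ⟩
    1# * (q ^ (j ℕ.* (k ℕ.* k ℕ.+ k)) * p ^ (r ℕ.* k)) * (⟦ suc (k ℕ.+ k) ⟧ ^ r * ((q ^ N) ^ s * (v k ^ s * ω k ^ s)))
      ≈⟨ summand-split r s j (λ _ → 1#) k ⟨
    (q ^ N) ^ s * summand r s j (λ _ → 1#) k ∎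
    where
    Qk Rk Sk : ℕ → Laurent
    Qk k = qpow (+ (j ℕ.* (k ℕ.* k ℕ.+ k)) ℤ.- + (r ℕ.* k))
    Rk k = poly (qint (2 ℕ.* k ℕ.+ 1) ^P r)
    Sk k = poly (ballot N k ^P s)

  alternating-ballot-sum : ∀ r s j → ℕ.NonZero s → (r ℕ.+ s) ℕ.% 2 ≡ 1 →
    sumL N (λ k → signL k
                  *L qpow (+ (k C 2) ℤ.+ + (j ℕ.* (k ℕ.* k ℕ.+ k)) ℤ.- (+ r ℤ.- + 1) ℤ.* + k)
                  *L poly (qint (2 ℕ.* k ℕ.+ 1) ^P r) *L poly (ballot N k ^P s))
      ≡ zeroL [modP qbinom (2 ℕ.* N) (+ N) ]
  alternating-ballot-sum r s j s≢0 odd = central-divides-sum r s j s≢0 odd adm-alt (λ k → signL k *L Qk k *L Rk k *L Sk k) λ k k≤N → begin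
    φ (signL k *L Qk k *L Rk k *L Sk k)
      ≈⟨ trans (φ-* (signL k *L Qk k *L Rk k) (Sk k)) (trans (*-congʳ (φ-* (signL k *L Qk k) (Rk k))) (*-assoc _ _ _)) ⟩
    φ (signL k *L Qk k) * (φ (Rk k) * φ (Sk k))
      ≈⟨ *-cong (sign-power k) (emb-power-product N k r s (ℕₚ.≤-pred k≤N)) ⟩
    alt k * (q ^ (j ℕ.* (k ℕ.* k ℕ.+ k)) * p ^ (r ℕ.* k)) * (⟦ suc (k ℕ.+ k) ⟧ ^ r * ((q ^ N) ^ s * (v k ^ s * ω k ^ s)))
      ≈⟨ summand-split r s j alt k ⟨
    (q ^ N) ^ s * summand r s j alt k ∎
    where
    Qk Rk Sk : ℕ → Laurent
    Qk k = qpow (+ (k C 2) ℤ.+ + (j ℕ.* (k ℕ.* k ℕ.+ k)) ℤ.- (+ r ℤ.- + 1) ℤ.* + k)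
    Rk k = poly (qint (2 ℕ.* k ℕ.+ 1) ^P r)
    Sk k = poly (ballot N k ^P s)
    sign-power : ∀ k → φ (signL k *L Qk k) ≈ alt k * (q ^ (j ℕ.* (k ℕ.* k ℕ.+ k)) * p ^ (r ℕ.* k))
    sign-power k = begin
      φ (signL k *L Qk k)
        ≈⟨ trans (φ-* (signL k) (Qk k)) (*-congˡ (φ-qpow (k ℕ.+ k C 2 ℕ.+ e) (r ℕ.* k) (alternating-exponent (k C 2) e r k))) ⟩
      φ (signL k) * (q ^ (k ℕ.+ k C 2 ℕ.+ e) * p ^ (r ℕ.* k))
        ≈⟨ *-congˡ (*-congʳ (q^-+ (k ℕ.+ k C 2) e)) ⟩
      φ (signL k) * (q ^ (k ℕ.+ k C 2) * q ^ e * p ^ (r ℕ.* k))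
        ≈⟨ solve 4 (λ a b c d →
              a :* (b :* c :* d)
              := a :* b :* (c :* d))
            refl (φ (signL k)) (q ^ (k ℕ.+ k C 2)) (q ^ e) (p ^ (r ℕ.* k)) ⟩
      φ (signL k) * q ^ (k ℕ.+ k C 2) * (q ^ e * p ^ (r ℕ.* k))
        ≈⟨ *-congʳ (φ-sign k) ⟨
      alt k * (q ^ e * p ^ (r ℕ.* k)) ∎
      where e = j ℕ.* (k ℕ.* k ℕ.+ k)

open import Data.Nat using (_+_; _*_; _≤_; _%_; NonZero)

theorem1p3 : (n s r j : ℕ) → NonZero n → NonZero s → (r + s) % 2 ≡ 1 → j ≤ s →
    (sumL n (λ k → qpow (+ (j * (k * k + k)) ℤ.- + (r * k))
    *L poly (qint (2 * k + 1) ^P r) *L poly (ballot n k ^P s))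
    ≡ zeroL [modP qbinom (2 * n) (+ n) ])
    × (sumL n (λ k → signL k
    *L qpow (+ (k C 2) ℤ.+ + (j * (k * k + k)) ℤ.- (+ r ℤ.- + 1) ℤ.* + k)
    *L poly (qint (2 * k + 1) ^P r) *L poly (ballot n k ^P s))
    ≡ zeroL [modP qbinom (2 * n) (+ n) ])
theorem1p3 (suc n) s r j _ s≢0 odd _ = ballot-sum r s j s≢0 odd , alternating-ballot-sum r s j s≢0 odd
  where open Conclusion (fractionRing polyRing) n
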